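{- We have $$\frac{8}{49}n^2-o(n^2)\le g(n,P_4,P_5)\le \frac{4}{23}n^2+o(n^2).$$
   Context: $P_r$ denotes the path on $r$ vertices. For fixed graphs $H$ and $F$, the Constructor–Blocker game is played on the edge set of $K_n$: Constructor and Blocker alternately claim previously unclaimed edges, Constructor moving first. Constructor may only claim an edge if after claiming it his graph (all edges he has claimed) contains no copy of $F$ as a subgraph; Blocker may claim any unclaimed edge. The game ends when Constructor cannot claim a further edge or all edges are claimed. The score is the number of copies of $H$ (as subgraphs) all of whose edges were claimed by Constructor. Constructor maximizes, Blocker minimizes the score; $g(n,H,F)$ is the score under optimal play by both players. -}

module Defs where

open import Data.Nat using (ℕ; zero; suc; _⊔_; _⊓_; _<ᵇ_)
open import Data.Bool using (Bool; true; false; _∧_; _∨_; not)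
open import Data.Fin using (Fin; toℕ; _≟_)
open import Data.List using (List; []; _∷_; map; concatMap; filterᵇ; length; allFin; foldr)
open import Data.Bool.ListAction using (any)
open import Data.Product using (_×_; _,_)
open import Relation.Nullary.Decidable using (⌊_⌋)

Edge : ℕ → Set
Edge n = Fin n × Fin n

module _ {n : ℕ} where

  eqF : Fin n → Fin n → Bool
  eqF a b = ⌊ a ≟ b ⌋

  sameEdge : Edge n → Edge n → Bool
  sameEdge (a , b) (c , d) = (eqF a c ∧ eqF b d) ∨ (eqF a d ∧ eqF b c)

  edgeIn : Edge n → List (Edge n) → Bool
  edgeIn e es = any (sameEdge e) es

  adj : List (Edge n) → Fin n → Fin n → Bool
  adj es u v = edgeIn (u , v) es

  tuples : ℕ → List (List (Fin n))
  tuples zero = [] ∷ []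
  tuples (suc r) = concatMap (λ v → map (v ∷_) (tuples r)) (allFin n)

  distinct : List (Fin n) → Bool
  distinct [] = true
  distinct (x ∷ xs) = not (any (eqF x) xs) ∧ distinct xs

  consecAdj : List (Edge n) → List (Fin n) → Bool
  consecAdj es [] = true
  consecAdj es (x ∷ []) = true
  consecAdj es (x ∷ y ∷ xs) = adj es x y ∧ consecAdj es (y ∷ xs)

  lastOr : Fin n → List (Fin n) → Fin n
  lastOr d [] = d
  lastOr d (x ∷ xs) = lastOr x xs

  firstLtLast : List (Fin n) → Bool
  firstLtLast [] = false
  firstLtLast (x ∷ xs) = toℕ x <ᵇ toℕ (lastOr x xs)

  isPath : List (Edge n) → List (Fin n) → Bool
  isPath es l = distinct l ∧ consecAdj es l

  -- number of copies of P_r (r ≥ 2) in the graph es: each copy v1…vr is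
  -- counted exactly once, via its orientation with v1 < vr.
  pathCopies : ℕ → List (Edge n) → ℕ
  pathCopies r es = length (filterᵇ (λ l → isPath es l ∧ firstLtLast l) (tuples r))

  containsPath : ℕ → List (Edge n) → Bool
  containsPath r es = any (isPath es) (tuples r)

allEdges : (n : ℕ) → List (Edge n)
allEdges n = concatMap (λ i → map (i ,_) (filterᵇ (λ j → toℕ i <ᵇ toℕ j) (allFin n))) (allFin n)

module _ {n : ℕ} where

  freeEdges : List (Edge n) → List (Edge n) → List (Edge n)
  freeEdges C B = filterᵇ (λ e → not (edgeIn e C ∨ edgeIn e B)) (allEdges n)

  -- Minimax value of the Constructor–Blocker game with H = P_h, F = P_f,
  -- from the position where Constructor owns C, Blocker owns B; the Bool is
  -- true iff it is Constructor's turn.  The fuel bounds the number of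
  -- remaining moves (each move claims a free edge).
  gameValue : (h f : ℕ) → ℕ → Bool → List (Edge n) → List (Edge n) → ℕ
  gameValue h f zero _ C B = pathCopies h C
  gameValue h f (suc m) true C B
    with filterᵇ (λ e → not (containsPath f (e ∷ C))) (freeEdges C B)
  ... | [] = pathCopies h C
  ... | e ∷ es = foldr (λ e' acc → gameValue h f m false (e' ∷ C) B ⊔ acc)
                       (gameValue h f m false (e ∷ C) B) es
  gameValue h f (suc m) false C B with freeEdges C B
  ... | [] = pathCopies h C
  ... | e ∷ es = foldr (λ e' acc → gameValue h f m true C (e' ∷ B) ⊓ acc)
                       (gameValue h f m true C (e ∷ B)) es

gPath : (n h f : ℕ) → ℕ
gPath n h f = gameValue {n} h f (length (allEdges n)) true [] []

-- Lower bound. Constructor claims an edge xy and grows a double star on it. A vertex counts 2 if it is a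
-- leaf or untouched, 1 if Blocker owns one of its edges to x, y, and 0 if he owns both. As long as
-- Constructor attaches half-blocked vertices first, the total is preserved. He does so until one centre
-- has 2n/7 leaves, then serves only the other centre until it has 2n/7 leaves, which costs at most 2n/7 of
-- the total, and then returns to the first rule. In the end both centres have 2n/7 leaves and together
-- they have 6n/7, hence at least (2/7)(4/7)n² paths.
--
-- Upper bound. For centres x, y with a and b leaves Blocker watches the potential 6a + 4b plus, for each
-- isolated vertex z, 4, or 2 if he owns xz, or 0 if he also owns yz. A new leaf raises it by at most 2, and
-- taking an edge xz (or yz, if all xz are taken) lowers it by 2, so 6a + 4b ≤ 4n + o(n) at the end. The
-- choice of x must be made before y is known; this is harmless if one of two stars is small when they are
-- joined. Therefore Blocker spends boundedly many moves on separating all pairs of vertices of degree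
-- above n/10k. All but O(n²/k) of the paths lie in double stars with such centres, and if one of these has
-- sides a, b, the others contain at most (n − a − b)²/4 paths. The maximum of ab + (n − a − b)²/4 is 4n²/23
-- unless all double stars are so small that a cruder estimate suffices.

module Submission where

open import Defs
open import Data.Nat
open import Data.Nat.Properties
open import Data.Nat.Tactic.RingSolver using (solve-∀; solve)
open import Data.Bool using (Bool; true; false; _∧_; _∨_; not; if_then_else_; T)
open import Data.Bool.Properties using (∨-comm; ∧-comm; ∨-zeroʳ)
open import Data.Bool.ListAction using (any)
open import Data.Fin using (Fin; zero; suc; toℕ)
import Data.Fin as F
import Data.Fin.Properties as FP
open import Data.List using (List; []; _∷_; map; concatMap; filterᵇ; length; allFin; foldr; tabulate; _++_)
open import Data.Product using (_×_; _,_; proj₁; proj₂; ∃-syntax)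
open import Data.Sum using (_⊎_; inj₁; inj₂; swap)
open import Data.Empty using (⊥; ⊥-elim)
open import Data.Maybe using (Maybe; just; nothing)
open import Relation.Nullary using (¬_; Dec; yes; no)
open import Relation.Nullary.Decidable using (_×-dec_; ¬?)
open import Relation.Binary.PropositionalEquality
open import Function using (_∘_)
open import Algebra.Properties.Semiring.Sum +-*-semiring using (sum; sum-cong-≗; ∑-distrib-+; ∑-comm; *-distribˡ-sum; *-distribʳ-sum)
open import Data.List.Membership.Propositional using (_∈_; find; lose)
open import Data.List.Membership.Propositional.Properties using (∈-filter⁺; ∈-filter⁻; ∈-concatMap⁺; ∈-concatMap⁻; ∈-allFin; ∈-map⁺; ∈-map⁻)
open import Data.List.Relation.Unary.Any using (here; there)
open import Relation.Binary.Definitions using (tri<; tri≈; tri>)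
open import Data.Product.Properties using (≡-dec)
open import Data.List.Properties using (length-filter)
open import Data.Nat.DivMod using (_/_; _%_; m≡m%n+[m/n]*n; m%n<n; m/n*n≤m; m*n/n≡m; /-monoˡ-≤)

-- The weights 6, 4 and 4, 2, 0 are set so that one block always pays for one leaf: a leaf of x is
-- made from weight 4, and a leaf of y from weight 2 if xz has been taken. Leaves of y are thus the
-- cheaper ones, and under 6a + 4b ≤ 4n the extremal proportions are a : b : rest = 8 : 11 : 4,
-- where ab + rest²/4 = 88 + 4 = 92 = (4/23) · 23². The obstacle is that Blocker has one move per
-- turn while many stars grow. In a P₅-free graph two vertices of degree above 3 have no common
-- neighbour. So each big vertex is a centre of one star or double star only, a new leaf raises one
-- potential only, and one local answer restores it. Separating moves interrupt this. Each is
-- charged to the number of separated pairs, which never decreases and is bounded independently of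
-- n; every bound is allowed to drift with it, by 2 per ordered pair. When no block is left in a
-- unit, its potential may stay 2 too high, but then it cannot rise again.

-- A linear certificate: add the hypothesis p ≤ q to the goal l ≤ r and exhibit the slack s.
cert : ∀ {p q} l r s → p ≤ q → l + q + s ≡ r + p → l ≤ r
cert {p} {q} l r s p≤q e = +-cancelʳ-≤ p l r (begin
   l + p     ≤⟨ +-monoʳ-≤ l p≤q ⟩
   l + q     ≤⟨ m≤m+n _ s ⟩
   l + q + s ≡⟨ e ⟩
   r + p     ∎)
  where open ≤-Reasoning

slack : ∀ {l r} s → l + s ≡ r → l ≤ r
slack {l} s e = ≤-trans (m≤m+n l s) (≤-reflexive e)

times : ∀ c {a b} → a ≤ b → c * a ≤ c * b
times c = *-monoʳ-≤ c

infixl 6 _⊹_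
_⊹_ : ∀ {a b c d} → a ≤ b → c ≤ d → a + c ≤ b + d
_⊹_ = +-mono-≤

-- Booleans and their 0-1 indicators.

true≢false : ∀ {b} → b ≡ true → b ≡ false → ⊥
true≢false refl ()

¬true⇒false : ∀ {b} → (b ≡ true → ⊥) → b ≡ false
¬true⇒false {true}  h = ⊥-elim (h refl)
¬true⇒false {false} h = refl

∧-true : ∀ {a b} → a ∧ b ≡ true → a ≡ true × b ≡ true
∧-true {true} {true} refl = refl , refl

∨-true : ∀ {a b} → a ∨ b ≡ true → a ≡ true ⊎ b ≡ true
∨-true {true}  h = inj₁ refl
∨-true {false} h = inj₂ h

∨-false : ∀ {a b} → a ∨ b ≡ false → a ≡ false × b ≡ false
∨-false {false} {false} refl = refl , refl

not-true : ∀ {a} → not a ≡ true → a ≡ false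
not-true {false} refl = refl

bool : ∀ b → b ≡ true ⊎ b ≡ false
bool true  = inj₁ refl
bool false = inj₂ refl

𝟙 : Bool → ℕ
𝟙 true  = 1
𝟙 false = 0

𝟙≤1 : ∀ b → 𝟙 b ≤ 1
𝟙≤1 true  = ≤-refl
𝟙≤1 false = z≤n

𝟙-mono : ∀ {a b} → (a ≡ true → b ≡ true) → 𝟙 a ≤ 𝟙 b
𝟙-mono {true}  h rewrite h refl = ≤-refl
𝟙-mono {false} h = z≤n

𝟙-∧ : ∀ a b → 𝟙 (a ∧ b) ≡ 𝟙 a * 𝟙 b
𝟙-∧ true  b = sym (+-identityʳ _)
𝟙-∧ false b = refl

𝟙-guard : ∀ b {m n} → (b ≡ true → m ≤ n) → 𝟙 b * m ≤ 𝟙 b * n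
𝟙-guard true  h = +-monoˡ-≤ 0 (h refl)
𝟙-guard false h = z≤n

module _ {n : ℕ} where

  eqF-refl : (i : Fin n) → eqF i i ≡ true
  eqF-refl i with i F.≟ i
  ... | yes _ = refl
  ... | no ¬p = ⊥-elim (¬p refl)

  eqF-≡ : {i j : Fin n} → eqF i j ≡ true → i ≡ j
  eqF-≡ {i} {j} h with i F.≟ j
  ... | yes p = p

  eqF-≢ : {i j : Fin n} → i ≢ j → eqF i j ≡ false
  eqF-≢ {i} {j} h with i F.≟ j
  ... | yes p = ⊥-elim (h p)
  ... | no _  = refl

  eqF-false : {i j : Fin n} → eqF i j ≡ false → i ≢ j
  eqF-false {i} h refl = true≢false (eqF-refl i) h

-- Finite sums

sum-mono : ∀ {n} {f g : Fin n → ℕ} → (∀ i → f i ≤ g i) → sum f ≤ sum g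
sum-mono {zero}  h = z≤n
sum-mono {suc n} h = +-mono-≤ (h zero) (sum-mono (h ∘ suc))

sum-const : ∀ n c → sum {n} (λ _ → c) ≡ n * c
sum-const zero    c = refl
sum-const (suc n) c = cong (c +_) (sum-const n c)

sum-zero : ∀ {n} {f : Fin n → ℕ} → (∀ i → f i ≡ 0) → sum f ≡ 0
sum-zero {n} h = trans (sum-cong-≗ h) (trans (sum-const n 0) (*-zeroʳ n))

sum-term : ∀ {n} (f : Fin n → ℕ) i → f i ≤ sum f
sum-term f zero    = m≤m+n _ _
sum-term f (suc i) = ≤-trans (sum-term (f ∘ suc) i) (m≤n+m _ _)

sum-≤-const : ∀ {n} {f : Fin n → ℕ} c → (∀ i → f i ≤ c) → sum f ≤ n * c
sum-≤-const {n} c h = ≤-trans (sum-mono h) (≤-reflexive (sum-const n c))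

sum-single : ∀ {n} (f : Fin n → ℕ) j → (∀ i → i ≢ j → f i ≡ 0) → sum f ≡ f j
sum-single f zero    h = trans (cong (f zero +_) (sum-zero (λ i → h (suc i) (λ ())))) (+-identityʳ _)
sum-single f (suc j) h = cong₂ _+_ (h zero (λ ())) (sum-single (f ∘ suc) j (λ i i≢j → h (suc i) (i≢j ∘ FP.suc-injective)))

sum-point : ∀ {n} (j : Fin n) c → sum (λ i → c * 𝟙 (eqF i j)) ≡ c
sum-point j c = trans (sum-single _ j (λ i h → trans (cong (λ b → c * 𝟙 b) (eqF-≢ h)) (*-zeroʳ c)))
                      (trans (cong (λ b → c * 𝟙 b) (eqF-refl j)) (*-identityʳ c))

-- A claim changes a potential for the worse at one vertex only. This lemma and the next turn such
-- local changes into changes of the sum.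
sum-mono-except : ∀ {n} {f g : Fin n → ℕ} j c → (∀ i → i ≢ j → f i ≤ g i) → f j ≤ g j + c → sum f ≤ sum g + c
sum-mono-except {n} {f} {g} j c h hj = begin
  sum f                                             ≤⟨ sum-mono pw ⟩
  sum (λ i → g i + c * 𝟙 (eqF i j))                 ≡⟨ ∑-distrib-+ g _ ⟩
  sum g + sum (λ i → c * 𝟙 (eqF i j))               ≡⟨ cong (sum g +_) (sum-point j c) ⟩
  sum g + c                                         ∎
  where
  open ≤-Reasoning
  pw : ∀ i → f i ≤ g i + c * 𝟙 (eqF i j)
  pw i with i F.≟ j
  ... | yes refl = ≤-trans hj (≤-reflexive (cong (g i +_) (sym (*-identityʳ c))))
  ... | no i≢j   = ≤-trans (h i i≢j) (m≤m+n _ _)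

sum-mono-gain : ∀ {n} {f g : Fin n → ℕ} j c → (∀ i → f i ≤ g i) → f j + c ≤ g j → sum f + c ≤ sum g
sum-mono-gain {n} {f} {g} j c h hj = begin
  sum f + c                                         ≡⟨ cong (sum f +_) (sym (sum-point j c)) ⟩
  sum f + sum (λ i → c * 𝟙 (eqF i j))               ≡⟨ sym (∑-distrib-+ f _) ⟩
  sum (λ i → f i + c * 𝟙 (eqF i j))                 ≤⟨ sum-mono pw ⟩
  sum g                                             ∎
  where
  open ≤-Reasoning
  pw : ∀ i → f i + c * 𝟙 (eqF i j) ≤ g i
  pw i with i F.≟ j
  ... | yes refl = ≤-trans (≤-reflexive (cong (f i +_) (*-identityʳ c))) hj
  ... | no i≢j   = ≤-trans (≤-reflexive (trans (cong (f i +_) (*-zeroʳ c)) (+-identityʳ _))) (h i)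

sum-unique : ∀ {n} (p : Fin n → Bool) → (∀ i j → p i ≡ true → p j ≡ true → i ≡ j) → sum (𝟙 ∘ p) ≤ 1
sum-unique {n} p h with FP.any? (λ i → p i Data.Bool.≟ true)
... | yes (i , pi) = ≤-trans (≤-reflexive (sum-single (𝟙 ∘ p) i (λ j j≢i → cong 𝟙 (¬true⇒false (λ pj → j≢i (h j i pj pi)))))) (𝟙≤1 _)
... | no ¬p = ≤-trans (≤-reflexive (sum-zero (λ i → cong 𝟙 (¬true⇒false (λ pi → ¬p (i , pi)))))) z≤n

sum-positive : ∀ {n} (f : Fin n → ℕ) → 0 < sum f → ∃[ i ] 0 < f i
sum-positive f h with FP.any? (λ i → 0 <? f i)
... | yes p = p
... | no ¬p = ⊥-elim (<-irrefl (sym (sum-zero (λ i → n≤0⇒n≡0 (≮⇒≥ (λ lt → ¬p (i , lt)))))) h)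

-- Counting in lists

module _ {A : Set} where

  count : (A → Bool) → List A → ℕ
  count p xs = length (filterᵇ p xs)

  count-∷ : ∀ p x xs → count p (x ∷ xs) ≡ 𝟙 (p x) + count p xs
  count-∷ p x xs with p x
  ... | true  = refl
  ... | false = refl

  count-++ : ∀ p xs ys → count p (xs ++ ys) ≡ count p xs + count p ys
  count-++ p []       ys = refl
  count-++ p (x ∷ xs) ys = trans (count-∷ p x (xs ++ ys))
    (trans (cong (𝟙 (p x) +_) (count-++ p xs ys))
    (trans (sym (+-assoc (𝟙 (p x)) _ _)) (cong (_+ count p ys) (sym (count-∷ p x xs)))))

  count-mono : ∀ {p q} xs → (∀ x → p x ≡ true → q x ≡ true) → count p xs ≤ count q xs
  count-mono []       h = z≤n
  count-mono {p} {q} (x ∷ xs) h rewrite count-∷ p x xs | count-∷ q x xs = +-mono-≤ (𝟙-mono (h x)) (count-mono xs h)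

  any-true : ∀ p xs → 0 < count p xs → any p xs ≡ true
  any-true p (x ∷ xs) h with p x
  ... | true  = refl
  ... | false = any-true p xs h

  any-true⁻ : ∀ p xs → any p xs ≡ true → 0 < count p xs
  any-true⁻ p (x ∷ xs) h with p x
  ... | true  = s≤s z≤n
  ... | false = any-true⁻ p xs h

count-map : ∀ {A B : Set} (p : B → Bool) (f : A → B) xs → count p (map f xs) ≡ count (p ∘ f) xs
count-map p f []       = refl
count-map p f (x ∷ xs) = trans (count-∷ p (f x) (map f xs))
  (trans (cong (𝟙 (p (f x)) +_) (count-map p f xs)) (sym (count-∷ (p ∘ f) x xs)))

count-concatMap : ∀ {n} {A B : Set} (p : B → Bool) (f : A → List B) (g : Fin n → A) →
  count p (concatMap f (tabulate g)) ≡ sum (λ i → count p (f (g i)))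
count-concatMap {zero}  p f g = refl
count-concatMap {suc n} p f g = trans (count-++ p (f (g zero)) _) (cong (count p (f (g zero)) +_) (count-concatMap p f (g ∘ suc)))

count-tuples : ∀ {n} r (p : List (Fin n) → Bool) →
  count p (tuples (suc r)) ≡ sum (λ v → count (λ l → p (v ∷ l)) (tuples r))
count-tuples {n} r p = trans (count-concatMap {n} p (λ v → map (v ∷_) (tuples r)) (λ i → i)) (sum-cong-≗ {n} (λ v → count-map p (v ∷_) (tuples r)))

count-tuples-0 : ∀ {n} (p : List (Fin n) → Bool) → count p (tuples 0) ≡ 𝟙 (p [])
count-tuples-0 p = trans (count-∷ p [] []) (+-identityʳ _)

-- Iterated sums

module _ {n : ℕ} where

  sum-rev₃ : (f : Fin n → Fin n → Fin n → ℕ) →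
    sum (λ a → sum (λ b → sum (λ c → f a b c))) ≡ sum (λ c → sum (λ b → sum (λ a → f a b c)))
  sum-rev₃ f = begin
    sum (λ a → sum (λ b → sum (λ c → f a b c))) ≡⟨ ∑-comm {n} {n} _ ⟩
    sum (λ b → sum (λ a → sum (λ c → f a b c))) ≡⟨ sum-cong-≗ {n} (λ b → ∑-comm {n} {n} _) ⟩
    sum (λ b → sum (λ c → sum (λ a → f a b c))) ≡⟨ ∑-comm {n} {n} _ ⟩
    sum (λ c → sum (λ b → sum (λ a → f a b c))) ∎
    where open ≡-Reasoning

  sum₄ : (Fin n → Fin n → Fin n → Fin n → ℕ) → ℕ
  sum₄ f = sum (λ a → sum (λ b → sum (λ c → sum (λ d → f a b c d))))

  sum₄-cong : ∀ {f g} → (∀ a b c d → f a b c d ≡ g a b c d) → sum₄ f ≡ sum₄ g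
  sum₄-cong h = sum-cong-≗ {n} (λ a → sum-cong-≗ {n} (λ b → sum-cong-≗ {n} (λ c → sum-cong-≗ {n} (h a b c))))

  sum₄-mono : ∀ {f g} → (∀ a b c d → f a b c d ≤ g a b c d) → sum₄ f ≤ sum₄ g
  sum₄-mono h = sum-mono (λ a → sum-mono (λ b → sum-mono (λ c → sum-mono (h a b c))))

  sum₄-+ : ∀ f g → sum₄ (λ a b c d → f a b c d + g a b c d) ≡ sum₄ f + sum₄ g
  sum₄-+ f g = begin
    sum₄ (λ a b c d → f a b c d + g a b c d)
      ≡⟨ sum-cong-≗ {n} (λ a → sum-cong-≗ {n} (λ b → sum-cong-≗ {n} (λ c → ∑-distrib-+ {n} _ _))) ⟩
    sum (λ a → sum (λ b → sum (λ c → sum (f a b c) + sum (g a b c))))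
      ≡⟨ sum-cong-≗ {n} (λ a → sum-cong-≗ {n} (λ b → ∑-distrib-+ {n} _ _)) ⟩
    sum (λ a → sum (λ b → sum (λ c → sum (f a b c)) + sum (λ c → sum (g a b c))))
      ≡⟨ sum-cong-≗ {n} (λ a → ∑-distrib-+ {n} _ _) ⟩
    sum (λ a → sum (λ b → sum (λ c → sum (f a b c))) + sum (λ b → sum (λ c → sum (g a b c))))
      ≡⟨ ∑-distrib-+ {n} _ _ ⟩
    sum₄ f + sum₄ g ∎
    where open ≡-Reasoning

  sum₄-rev : ∀ f → sum₄ f ≡ sum₄ (λ d c b a → f a b c d)
  sum₄-rev f = begin
    sum₄ f
      ≡⟨ sum-cong-≗ {n} (λ a → sum-rev₃ (f a)) ⟩
    sum (λ a → sum (λ d → sum (λ c → sum (λ b → f a b c d))))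
      ≡⟨ ∑-comm {n} {n} _ ⟩
    sum (λ d → sum (λ a → sum (λ c → sum (λ b → f a b c d))))
      ≡⟨ sum-cong-≗ {n} (λ d → ∑-comm {n} {n} _) ⟩
    sum (λ d → sum (λ c → sum (λ a → sum (λ b → f a b c d))))
      ≡⟨ sum-cong-≗ {n} (λ d → sum-cong-≗ {n} (λ c → ∑-comm {n} {n} _)) ⟩
    sum₄ (λ d c b a → f a b c d) ∎
    where open ≡-Reasoning

  occ : Fin n → List (Fin n) → ℕ
  occ z []      = 0
  occ z (x ∷ L) = 𝟙 (eqF z x) + occ z L

  occ-any : ∀ z L → any (eqF z) L ≡ true → 1 ≤ occ z L
  occ-any z (x ∷ L) h with eqF z x
  ... | true  = s≤s z≤n
  ... | false = occ-any z L h

  occ-absent : ∀ z L → any (eqF z) L ≡ false → occ z L ≡ 0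
  occ-absent z []      h = refl
  occ-absent z (x ∷ L) h with eqF z x
  ... | false = occ-absent z L h

  occ-distinct : ∀ z L → distinct L ≡ true → occ z L ≤ 1
  occ-distinct z []      h = z≤n
  occ-distinct z (x ∷ L) h with z F.≟ x | ∧-true {not (any (eqF x) L)} h
  ... | yes refl | h₁ , h₂ rewrite occ-absent x L (not-true h₁) = ≤-refl
  ... | no _     | h₁ , h₂ = occ-distinct z L h₂

  sumOver : (Fin n → ℕ) → List (Fin n) → ℕ
  sumOver f []      = 0
  sumOver f (x ∷ L) = f x + sumOver f L

  sumOver-occ : ∀ f L → sum (λ z → f z * occ z L) ≡ sumOver f L
  sumOver-occ f []      = sum-zero {n} (λ z → *-zeroʳ (f z))
  sumOver-occ f (x ∷ L) = begin
    sum (λ z → f z * (𝟙 (eqF z x) + occ z L))                 ≡⟨ sum-cong-≗ {n} (λ z → *-distribˡ-+ (f z) _ _) ⟩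
    sum (λ z → f z * 𝟙 (eqF z x) + f z * occ z L)             ≡⟨ ∑-distrib-+ {n} _ _ ⟩
    sum (λ z → f z * 𝟙 (eqF z x)) + sum (λ z → f z * occ z L) ≡⟨ cong₂ _+_ point (sumOver-occ f L) ⟩
    f x + sumOver f L                                         ∎
    where
    open ≡-Reasoning
    point : sum (λ z → f z * 𝟙 (eqF z x)) ≡ f x
    point = trans (sum-single {n} _ x (λ z h → trans (cong (λ b → f z * 𝟙 b) (eqF-≢ h)) (*-zeroʳ (f z))))
                  (trans (cong (λ b → f x * 𝟙 b) (eqF-refl x)) (*-identityʳ (f x)))

  sumOver-≤ : ∀ f L → distinct L ≡ true → sumOver f L ≤ sum f
  sumOver-≤ f L h = ≤-trans (≤-reflexive (sym (sumOver-occ f L)))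
    (sum-mono (λ z → ≤-trans (*-monoʳ-≤ (f z) (occ-distinct z L h)) (≤-reflexive (*-identityʳ (f z)))))

  covered-sum : ∀ (p : Fin n → Bool) L → (∀ z → p z ≡ true → any (eqF z) L ≡ true) → sum (𝟙 ∘ p) ≤ length L
  covered-sum p L h = ≤-trans (sum-mono pw) (≤-trans (≤-reflexive (sumOver-occ (λ _ → 1) L)) (≤-reflexive (len L)))
    where
    pw : ∀ z → 𝟙 (p z) ≤ 1 * occ z L
    pw z with p z in eq
    ... | false = z≤n
    ... | true  = ≤-trans (occ-any z L (h z eq)) (≤-reflexive (sym (*-identityˡ _)))
    len : ∀ L → sumOver (λ _ → 1) L ≡ length L
    len []      = refl
    len (x ∷ L) = cong suc (len L)

-- Graphs given by a Boolean adjacency relation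

Rel : ℕ → Set
Rel n = Fin n → Fin n → Bool

degree : ∀ {n} → Rel n → Fin n → ℕ
degree A v = sum (λ z → 𝟙 (A v z))

record Graph (n : ℕ) : Set where
  field
    E       : Rel n
    E-sym   : ∀ {u v} → E u v ≡ true → E v u ≡ true
    E-irrefl : ∀ {u v} → E u v ≡ true → u ≢ v

  deg : Fin n → ℕ
  deg = degree E

  big : ℕ → Fin n → Bool
  big K v = K <ᵇ deg v

  isLeaf : Fin n → Fin n → Bool
  isLeaf x z = E x z ∧ (deg z ≡ᵇ 1)

  leaves : Fin n → ℕ
  leaves x = sum (λ z → 𝟙 (isLeaf x z))

  dbl : ℕ → Fin n → Fin n → Bool
  dbl K x y = E x y ∧ (big K x ∧ big K y)

  -- Consecutive vertices differ by `E-irrefl`, so six inequalities between the others make the five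
  -- vertices distinct.
  P₅-free : Set
  P₅-free = ∀ {a b c d e} → E a b ≡ true → E b c ≡ true → E c d ≡ true → E d e ≡ true →
    a ≢ c → a ≢ d → a ≢ e → b ≢ d → b ≢ e → c ≢ e → ⊥

open Graph using (P₅-free) public

T⇒≡ : ∀ {b} → T b → b ≡ true
T⇒≡ {true} _ = refl

≡⇒T : ∀ {b} → b ≡ true → T b
≡⇒T refl = _

<ᵇ-true : ∀ {m n} → m < n → (m <ᵇ n) ≡ true
<ᵇ-true h = T⇒≡ (<⇒<ᵇ h)

<ᵇ-true⁻ : ∀ {m n} → (m <ᵇ n) ≡ true → m < n
<ᵇ-true⁻ {m} {n} h = <ᵇ⇒< m n (≡⇒T h)

<ᵇ-false⁻ : ∀ {m n} → (m <ᵇ n) ≡ false → n ≤ m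
<ᵇ-false⁻ h = ≮⇒≥ (λ lt → true≢false (<ᵇ-true lt) h)

-- The structure of P₅-free graphs and the count of their paths on four vertices.

module Static {n : ℕ} (G : Graph n) (free : P₅-free G) where
  open Graph G

  -- If all neighbours lay in `L`, the degree would be at most its length. This supplies the loose
  -- ends of the forbidden paths below.
  neighbour-avoiding : ∀ x L → length L < deg x → ∃[ z ] (E x z ≡ true × any (eqF z) L ≡ false)
  neighbour-avoiding x L h with FP.any? (λ z → (E x z ∧ not (any (eqF z) L)) Data.Bool.≟ true)
  ... | yes (z , p) = z , proj₁ (∧-true p) , not-true (proj₂ (∧-true {E x z} p))
  ... | no ¬p = ⊥-elim (<⇒≱ h (covered-sum (E x) L (λ z e → covered z e)))
    where
    covered : ∀ z → E x z ≡ true → any (eqF z) L ≡ true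
    covered z e with any (eqF z) L in eq
    ... | true  = refl
    ... | false = ⊥-elim (¬p (z , (cong₂ _∧_ e (cong not eq))))

  avoiding-1 : ∀ x a → 1 < deg x → ∃[ z ] (E x z ≡ true × z ≢ a)
  avoiding-1 x a h with neighbour-avoiding x (a ∷ []) h
  ... | z , e , f = z , e , eqF-false (proj₁ (∨-false f))

  avoiding-2 : ∀ x a b → 2 < deg x → ∃[ z ] (E x z ≡ true × z ≢ a × z ≢ b)
  avoiding-2 x a b h with neighbour-avoiding x (a ∷ b ∷ []) h
  ... | z , e , f with ∨-false {eqF z a} f
  ... | f₁ , f₂ = z , e , eqF-false f₁ , eqF-false (proj₁ (∨-false f₂))

  avoiding-3 : ∀ x a b c → 3 < deg x → ∃[ z ] (E x z ≡ true × z ≢ a × z ≢ b × z ≢ c)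
  avoiding-3 x a b c h with neighbour-avoiding x (a ∷ b ∷ c ∷ []) h
  ... | z , e , f with ∨-false {eqF z a} f
  ... | f₁ , f₂ with ∨-false {eqF z b} f₂
  ... | f₃ , f₄ = z , e , eqF-false f₁ , eqF-false f₃ , eqF-false (proj₁ (∨-false f₄))

  -- Otherwise x₁ x z y y₁ is a P₅. The threshold 3 comes from `y₁`, which has to avoid `z`, `x` and
  -- `x₁`; it is the origin of the assumption `3 ≤ K`.
  disjoint-neighbourhoods : ∀ {x y z} → 3 < deg x → 3 < deg y → x ≢ y → E x z ≡ true → E y z ≡ true → ⊥
  disjoint-neighbourhoods {x} {y} {z} dx dy x≢y xz yz
    with avoiding-2 x z y (<-trans (n<1+n 2) dx)
  ... | x₁ , xx₁ , x₁≢z , x₁≢y with avoiding-3 y z x x₁ dy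
  ... | y₁ , yy₁ , y₁≢z , y₁≢x , y₁≢x₁ =
    free (E-sym xx₁) xz (E-sym yz) yy₁ x₁≢z x₁≢y (y₁≢x₁ ∘ sym) x≢y (y₁≢x ∘ sym) (y₁≢z ∘ sym)

  big-degree : ∀ {K x} → 3 ≤ K → big K x ≡ true → 3 < deg x
  big-degree h b = ≤-<-trans h (<ᵇ-true⁻ b)

  module _ {K : ℕ} (3≤K : 3 ≤ K) where

    big-neighbour-unique : ∀ {z x y} → big K x ≡ true → big K y ≡ true → E x z ≡ true → E y z ≡ true → x ≡ y
    big-neighbour-unique {z} {x} {y} bx by xz yz with x F.≟ y
    ... | yes p = p
    ... | no ¬p = ⊥-elim (disjoint-neighbourhoods (big-degree 3≤K bx) (big-degree 3≤K by) ¬p xz yz)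

    -- Counted from the other end, every `z` has at most one big neighbour.
    sum-big-degrees : sum (λ x → 𝟙 (big K x) * deg x) ≤ n
    sum-big-degrees = begin
      sum (λ x → 𝟙 (big K x) * deg x)
        ≡⟨ sum-cong-≗ {n} (λ x → trans (*-distribˡ-sum (𝟙 (big K x)) (λ z → 𝟙 (E x z))) (sum-cong-≗ {n} (λ z → sym (𝟙-∧ (big K x) (E x z))))) ⟩
      sum (λ x → sum (λ z → 𝟙 (big K x ∧ E x z)))
        ≡⟨ ∑-comm {n} {n} _ ⟩
      sum (λ z → sum (λ x → 𝟙 (big K x ∧ E x z)))
        ≤⟨ sum-≤-const 1 (λ z → sum-unique (λ x → big K x ∧ E x z) (uniq z)) ⟩
      n * 1
        ≡⟨ *-identityʳ n ⟩
      n ∎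
      where
      open ≤-Reasoning
      uniq : ∀ z x y → big K x ∧ E x z ≡ true → big K y ∧ E y z ≡ true → x ≡ y
      uniq z x y p q with ∧-true {big K x} p | ∧-true {big K y} q
      ... | bx , xz | by , yz = big-neighbour-unique bx by xz yz

  module _ {K : ℕ} (3≤K : 3 ≤ K) where

    -- Bounds the number of pairs that Blocker may have to separate.
    few-big : sum (λ x → 𝟙 (big K x)) * suc K ≤ n
    few-big = begin
      sum (λ x → 𝟙 (big K x)) * suc K    ≡⟨ *-distribʳ-sum (suc K) (λ x → 𝟙 (big K x)) ⟩
      sum (λ x → 𝟙 (big K x) * suc K)    ≤⟨ sum-mono (λ x → 𝟙-guard (big K x) <ᵇ-true⁻) ⟩
      sum (λ x → 𝟙 (big K x) * deg x)    ≤⟨ sum-big-degrees 3≤K ⟩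
      n                                  ∎
      where open ≤-Reasoning

    dbl-parts : ∀ {x y} → dbl K x y ≡ true → E x y ≡ true × big K x ≡ true × big K y ≡ true
    dbl-parts {x} {y} h with ∧-true {E x y} h
    ... | e , h' with ∧-true {big K x} h'
    ... | bx , by = e , bx , by

    dbl-intro : ∀ {x y} → E x y ≡ true → big K x ≡ true → big K y ≡ true → dbl K x y ≡ true
    dbl-intro e bx by rewrite e | bx | by = refl

    dbl-sym : ∀ {x y} → dbl K x y ≡ true → dbl K y x ≡ true
    dbl-sym h with dbl-parts h
    ... | e , bx , by = dbl-intro (E-sym e) by bx

    -- Both `y` and `z` are big neighbours of `x`, and there is only one of those. Hence the pairs
    -- of centres form a matching.
    dbl-unique : ∀ {x y z} → dbl K x y ≡ true → dbl K x z ≡ true → y ≡ z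
    dbl-unique h h' with dbl-parts h | dbl-parts h'
    ... | e , _ , by | e' , _ , bz = big-neighbour-unique 3≤K by bz (E-sym e) (E-sym e')

    -- A second neighbour r of `z` would give the P₅ r z x y w for a suitable neighbour w of `y`.
    -- Apart from its centres, a double star therefore consists of leaves.
    leaf-of-double : ∀ {x y z} → dbl K x y ≡ true → E x z ≡ true → z ≢ y → isLeaf x z ≡ true
    leaf-of-double {x} {y} {z} h xz z≢y with dbl-parts h
    ... | xy , bx , by = cong₂ _∧_ xz (T⇒≡ (≡⇒≡ᵇ (deg z) 1 (≤-antisym (≮⇒≥ one) (≤-trans (≤-reflexive (sym (cong 𝟙 (E-sym xz)))) (sum-term (𝟙 ∘ E z) x)))))
      where
      one : 1 < deg z → ⊥
      one lt with avoiding-1 z x lt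
      ... | r , zr , r≢x with avoiding-3 y x z r (big-degree 3≤K by)
      ... | w , yw , w≢x , w≢z , w≢r =
        free (E-sym zr) (E-sym xz) xy yw r≢x r≢y (w≢r ∘ sym) z≢y (w≢z ∘ sym) (w≢x ∘ sym)
        where
        r≢y : r ≢ y
        r≢y refl = disjoint-neighbourhoods (big-degree 3≤K bx) (big-degree 3≤K by) (E-irrefl xy) xz (E-sym zr)

    -- The two walks must go round a triangle y x₁ x₂. Otherwise one of v₁ x₁ y x₂ v₂, t y x₁ x₂ v₂,
    -- t y x₂ x₁ v₁ and t y x₁ v₁ x₂ is a P₅, where t is a spare neighbour of `y`.
    second-neighbours : ∀ {y x₁ v₁ x₂ v₂} → 3 < deg y →
      E y x₁ ≡ true → E x₁ v₁ ≡ true → v₁ ≢ y → E y x₂ ≡ true → E x₂ v₂ ≡ true → v₂ ≢ y →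
      x₁ ≢ x₂ → v₁ ≡ x₂ × v₂ ≡ x₁
    second-neighbours {y} {x₁} {v₁} {x₂} {v₂} dy yx₁ x₁v₁ v₁≢y yx₂ x₂v₂ v₂≢y x₁≢x₂
      with v₁ F.≟ x₂ | v₂ F.≟ x₁
    ... | yes p    | yes q = p , q
    ... | yes refl | no q with avoiding-3 y x₁ x₂ v₂ dy
    ...   | t , yt , t≢x₁ , t≢x₂ , t≢v₂ =
      ⊥-elim (free (E-sym yt) yx₁ x₁v₁ x₂v₂ t≢x₁ t≢x₂ t≢v₂ (E-irrefl yx₂) (v₂≢y ∘ sym) (q ∘ sym))
    second-neighbours {y} {x₁} {v₁} {x₂} {v₂} dy yx₁ x₁v₁ v₁≢y yx₂ x₂v₂ v₂≢y x₁≢x₂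
        | no p | yes refl with avoiding-3 y x₁ x₂ v₁ dy
    ...   | t , yt , t≢x₁ , t≢x₂ , t≢v₁ =
      ⊥-elim (free (E-sym yt) yx₂ x₂v₂ x₁v₁ t≢x₂ t≢x₁ t≢v₁ (E-irrefl yx₁) (v₁≢y ∘ sym) (p ∘ sym))
    second-neighbours {y} {x₁} {v₁} {x₂} {v₂} dy yx₁ x₁v₁ v₁≢y yx₂ x₂v₂ v₂≢y x₁≢x₂
        | no p | no q with v₁ F.≟ v₂
    ... | no r = ⊥-elim (free (E-sym x₁v₁) (E-sym yx₁) yx₂ x₂v₂ v₁≢y p r x₁≢x₂ (q ∘ sym) (v₂≢y ∘ sym))
    ... | yes refl with avoiding-3 y x₁ x₂ v₁ dy
    ...   | t , yt , t≢x₁ , t≢x₂ , t≢v₁ =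
      ⊥-elim (free (E-sym yt) yx₁ x₁v₁ (E-sym x₂v₂) t≢x₁ t≢v₁ t≢x₂ (v₁≢y ∘ sym) (E-irrefl yx₂) x₁≢x₂)

    -- The part of a P₄ seen from its middle vertex `y` across the other middle vertex `x`, in the
    -- case that `x` is not big.
    tail₂ : Fin n → Fin n → Fin n → Bool
    tail₂ y x v = E y x ∧ (E x v ∧ (not (eqF v y) ∧ not (big K x)))

    tail₂-parts : ∀ {y x v} → tail₂ y x v ≡ true → E y x ≡ true × E x v ≡ true × v ≢ y × deg x ≤ K
    tail₂-parts {y} {x} {v} h with ∧-true {E y x} h
    ... | a , h₁ with ∧-true {E x v} h₁
    ... | b , h₂ with ∧-true {not (eqF v y)} h₂
    ... | c , d = a , b , eqF-false (not-true c) , <ᵇ-false⁻ (not-true d)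

    -- By `second-neighbours` all tails run through the same `x₁`, at most `K` of them, except for
    -- the tail y v₁ x₁ that arises when y x₁ v₁ is a triangle. The bound does not grow with the
    -- degree of `y`.
    few-tails : ∀ y → 3 < deg y → sum (λ x → sum (λ v → 𝟙 (tail₂ y x v))) ≤ suc K
    few-tails y dy with FP.any? (λ x → FP.any? (λ v → tail₂ y x v Data.Bool.≟ true))
    ... | no ¬p = ≤-trans (≤-reflexive (sum-zero {n} (λ x → sum-zero {n} (λ v → cong 𝟙 (¬true⇒false (λ h → ¬p (x , v , h))))))) z≤n
    ... | yes (x₁ , v₁ , h₁) with tail₂-parts h₁
    ...   | yx₁ , x₁v₁ , v₁≢y , dx₁ = begin
      sum (λ x → sum (λ v → 𝟙 (tail₂ y x v)))
        ≤⟨ sum-mono (λ x → sum-mono (pw x)) ⟩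
      sum (λ x → sum (λ v → 𝟙 (E x₁ v) * 𝟙 (eqF x x₁) + 𝟙 (eqF v x₁) * 𝟙 (eqF x v₁)))
        ≡⟨ sum-cong-≗ {n} (λ x → trans (∑-distrib-+ {n} _ _) (cong₂ _+_ (sym (*-distribʳ-sum (𝟙 (eqF x x₁)) (𝟙 ∘ E x₁))) (sym (*-distribʳ-sum (𝟙 (eqF x v₁)) (λ v → 𝟙 (eqF v x₁)))))) ⟩
      sum (λ x → deg x₁ * 𝟙 (eqF x x₁) + sum (λ v → 𝟙 (eqF v x₁)) * 𝟙 (eqF x v₁))
        ≡⟨ ∑-distrib-+ {n} _ _ ⟩
      sum (λ x → deg x₁ * 𝟙 (eqF x x₁)) + sum (λ x → sum (λ v → 𝟙 (eqF v x₁)) * 𝟙 (eqF x v₁))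
        ≡⟨ cong₂ _+_ (sum-point x₁ (deg x₁)) (sum-point v₁ (sum (λ v → 𝟙 (eqF v x₁)))) ⟩
      deg x₁ + sum (λ v → 𝟙 (eqF v x₁))
        ≤⟨ +-mono-≤ dx₁ (sum-unique (λ v → eqF v x₁) (λ i j p q → trans (eqF-≡ p) (sym (eqF-≡ q)))) ⟩
      K + 1
        ≡⟨ +-comm K 1 ⟩
      suc K ∎
      where
      open ≤-Reasoning
      pw : ∀ x v → 𝟙 (tail₂ y x v) ≤ 𝟙 (E x₁ v) * 𝟙 (eqF x x₁) + 𝟙 (eqF v x₁) * 𝟙 (eqF x v₁)
      pw x v with tail₂ y x v in eq
      ... | false = z≤n
      ... | true with tail₂-parts {y} {x} {v} eq
      ...   | yx , xv , v≢y , _ with x F.≟ x₁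
      ...     | yes refl rewrite xv = s≤s z≤n
      ...     | no x≢x₁ with second-neighbours dy yx₁ x₁v₁ v₁≢y yx xv v≢y (x≢x₁ ∘ sym)
      ...       | refl , refl rewrite eqF-refl x₁ | eqF-refl v₁ = m≤n+m 1 _

    -- Both sums run over ordered pairs of adjacent big vertices, so every double star is counted twice.
    doubleStars : ℕ
    doubleStars = sum (λ x → sum (λ y → 𝟙 (dbl K x y) * (leaves x * leaves y)))

    leaves≤deg : ∀ x → leaves x ≤ deg x
    leaves≤deg x = sum-mono (λ z → 𝟙-mono (λ h → proj₁ (∧-true {E x z} h)))

    -- Makes the count independent of the encoding of paths as lists; `x` and `y` are the middle
    -- vertices.
    P₄-shape : (Fin n → Fin n → Fin n → Fin n → Bool) → Set
    P₄-shape q = ∀ {a x y b} → q a x y b ≡ true → E x a ≡ true × E x y ≡ true × E y b ≡ true × a ≢ y × b ≢ x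

    module _ (q : Fin n → Fin n → Fin n → Fin n → Bool) (shape : P₄-shape q) where

      private
        -- Two thresholds are used. Degrees up to 3 give a bounded number of paths per vertex, while
        -- above 3 the tails can be controlled as soon as the other middle vertex is not big. Only
        -- `hi` is quadratic in `n`.
        low mid hi : Fin n → Fin n → Fin n → Fin n → ℕ
        low a x y b = 𝟙 (not (big 3 x)) * (𝟙 (E x a) * (𝟙 (E x y) * (𝟙 (not (big 3 y)) * 𝟙 (E y b))))
        mid a x y b = 𝟙 (tail₂ y x a) * (𝟙 (big 3 y) * 𝟙 (E y b))
        hi  a x y b = 𝟙 (dbl K x y) * (𝟙 (isLeaf x a) * 𝟙 (isLeaf y b))

        tail₂-intro : ∀ {y x v} → E y x ≡ true → E x v ≡ true → v ≢ y → big K x ≡ false → tail₂ y x v ≡ true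
        tail₂-intro {y} {x} {v} a b c d rewrite a | b | eqF-≢ c | d = refl

        big-3 : ∀ {x} → big K x ≡ true → big 3 x ≡ true
        big-3 b = <ᵇ-true (big-degree 3≤K b)

        low-one : ∀ {a x y b} → big 3 x ≡ false → big 3 y ≡ false →
          E x a ≡ true → E x y ≡ true → E y b ≡ true → 1 ≤ low a x y b
        low-one fx fy xa xy yb rewrite fx | fy | xa | xy | yb = ≤-refl

        mid-one : ∀ {a x y b} → E y x ≡ true → E x a ≡ true → E y b ≡ true → a ≢ y →
          big K x ≡ false → big 3 y ≡ true → 1 ≤ mid a x y b
        mid-one {a} {x} {y} {b} yx xa yb a≢y bx fy = begin
          1                                              ≡⟨ cong₂ _*_ (cong 𝟙 (sym (tail₂-intro yx xa a≢y bx))) (cong₂ _*_ (cong 𝟙 (sym fy)) (cong 𝟙 (sym yb))) ⟩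
          𝟙 (tail₂ y x a) * (𝟙 (big 3 y) * 𝟙 (E y b))    ∎
          where open ≤-Reasoning

        hi-one : ∀ {a x y b} → dbl K x y ≡ true → isLeaf x a ≡ true → isLeaf y b ≡ true → 1 ≤ hi a x y b
        hi-one {a} {x} {y} {b} d l l' = begin
          1              ≡⟨ cong₂ _*_ (cong 𝟙 (sym d)) (cong₂ _*_ (cong 𝟙 (sym l)) (cong 𝟙 (sym l'))) ⟩
          hi a x y b     ∎
          where open ≤-Reasoning

        -- `mid` occurs in both directions because either middle vertex may be the one of degree
        -- above 3.
        cover : ∀ a x y b → 𝟙 (q a x y b) ≤ low a x y b + mid a x y b + mid b y x a + hi a x y b
        cover a x y b with q a x y b in eq
        ... | false = z≤n
        ... | true = cases (bool (big K x)) (bool (big K y)) (bool (big 3 x)) (bool (big 3 y))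
          where
          xa = proj₁ (shape eq)
          xy = proj₁ (proj₂ (shape eq))
          yb = proj₁ (proj₂ (proj₂ (shape eq)))
          a≢y = proj₁ (proj₂ (proj₂ (proj₂ (shape eq))))
          b≢x = proj₂ (proj₂ (proj₂ (proj₂ (shape eq))))
          L = low a x y b
          M = mid a x y b
          M' = mid b y x a
          H = hi a x y b
          from-L : 1 ≤ L → 1 ≤ L + M + M' + H
          from-L h = ≤-trans h (≤-trans (m≤m+n L M) (≤-trans (m≤m+n _ M') (m≤m+n _ H)))
          from-M : 1 ≤ M → 1 ≤ L + M + M' + H
          from-M h = ≤-trans h (≤-trans (m≤n+m M L) (≤-trans (m≤m+n _ M') (m≤m+n _ H)))
          from-M' : 1 ≤ M' → 1 ≤ L + M + M' + H
          from-M' h = ≤-trans h (≤-trans (m≤n+m M' _) (m≤m+n _ H))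
          from-H : 1 ≤ H → 1 ≤ L + M + M' + H
          from-H h = ≤-trans h (m≤n+m H _)
          Case : Fin n → ℕ → Set
          Case v k = big k v ≡ true ⊎ big k v ≡ false
          cases : Case x K → Case y K → Case x 3 → Case y 3 → 1 ≤ L + M + M' + H
          cases (inj₁ bx)  (inj₁ by)  _ _ = from-H (hi-one (dbl-intro xy bx by)
            (leaf-of-double (dbl-intro xy bx by) xa a≢y) (leaf-of-double (dbl-intro (E-sym xy) by bx) yb b≢x))
          cases (inj₁ bx)  (inj₂ ¬by) _ _ = from-M' (mid-one xy yb xa b≢x ¬by (big-3 bx))
          cases (inj₂ ¬bx) _          _ (inj₁ fy) = from-M (mid-one (E-sym xy) xa yb a≢y ¬bx fy)
          cases (inj₂ ¬bx) (inj₁ by)  _ (inj₂ ¬fy) = ⊥-elim (true≢false (big-3 by) ¬fy)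
          cases (inj₂ ¬bx) (inj₂ ¬by) (inj₁ fx) (inj₂ ¬fy) = from-M' (mid-one xy yb xa b≢x ¬by fx)
          cases (inj₂ ¬bx) (inj₂ ¬by) (inj₂ ¬fx) (inj₂ ¬fy) = from-L (low-one ¬fx ¬fy xa xy yb)

        -- For each `x` there are at most three choices for each of `a`, `y` and `b`.
        sum-low : sum₄ low ≤ n * 27
        sum-low = begin
          sum₄ low
            ≡⟨ ∑-comm {n} {n} _ ⟩
          sum (λ x → sum (λ a → sum (λ y → sum (λ b → low a x y b))))
            ≡⟨ sum-cong-≗ {n} (λ x → factor x) ⟩
          sum (λ x → 𝟙 (not (big 3 x)) * (deg x * sum (λ y → 𝟙 (E x y) * (𝟙 (not (big 3 y)) * deg y))))
            ≤⟨ sum-≤-const 27 bound ⟩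
          n * 27 ∎
          where
          open ≤-Reasoning
          factor : ∀ x → sum (λ a → sum (λ y → sum (λ b → low a x y b)))
            ≡ 𝟙 (not (big 3 x)) * (deg x * sum (λ y → 𝟙 (E x y) * (𝟙 (not (big 3 y)) * deg y)))
          factor x = let s = 𝟙 (not (big 3 x)) in begin-equality
            sum (λ a → sum (λ y → sum (λ b → low a x y b)))
              ≡⟨ sum-cong-≗ {n} (λ a → sum-cong-≗ {n} (λ y →
                   trans (sym (*-distribˡ-sum s (λ b → 𝟙 (E x a) * (𝟙 (E x y) * (𝟙 (not (big 3 y)) * 𝟙 (E y b))))))
                  (cong (s *_) (trans (sym (*-distribˡ-sum (𝟙 (E x a)) (λ b → 𝟙 (E x y) * (𝟙 (not (big 3 y)) * 𝟙 (E y b)))))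
                  (cong (𝟙 (E x a) *_) (trans (sym (*-distribˡ-sum (𝟙 (E x y)) (λ b → 𝟙 (not (big 3 y)) * 𝟙 (E y b))))
                  (cong (𝟙 (E x y) *_) (sym (*-distribˡ-sum (𝟙 (not (big 3 y))) (λ b → 𝟙 (E y b)))))))) ))) ⟩
            sum (λ a → sum (λ y → s * (𝟙 (E x a) * (𝟙 (E x y) * (𝟙 (not (big 3 y)) * deg y)))))
              ≡⟨ sum-cong-≗ {n} (λ a → trans (sym (*-distribˡ-sum s (λ y → 𝟙 (E x a) * (𝟙 (E x y) * (𝟙 (not (big 3 y)) * deg y)))))
                   (cong (s *_) (sym (*-distribˡ-sum (𝟙 (E x a)) (λ y → 𝟙 (E x y) * (𝟙 (not (big 3 y)) * deg y)))))) ⟩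
            sum (λ a → s * (𝟙 (E x a) * sum (λ y → 𝟙 (E x y) * (𝟙 (not (big 3 y)) * deg y))))
              ≡⟨ trans (sym (*-distribˡ-sum s (λ a → 𝟙 (E x a) * sum (λ y → 𝟙 (E x y) * (𝟙 (not (big 3 y)) * deg y)))))
                   (cong (s *_) (sym (*-distribʳ-sum _ (λ a → 𝟙 (E x a))))) ⟩
            s * (deg x * sum (λ y → 𝟙 (E x y) * (𝟙 (not (big 3 y)) * deg y))) ∎
          small : ∀ y → 𝟙 (not (big 3 y)) * deg y ≤ 3
          small y with big 3 y in eq
          ... | true  = z≤n
          ... | false = ≤-trans (≤-reflexive (*-identityˡ _)) (<ᵇ-false⁻ eq)
          bound : ∀ x → 𝟙 (not (big 3 x)) * (deg x * sum (λ y → 𝟙 (E x y) * (𝟙 (not (big 3 y)) * deg y))) ≤ 27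
          bound x = begin
            𝟙 (not (big 3 x)) * (deg x * sum (λ y → 𝟙 (E x y) * (𝟙 (not (big 3 y)) * deg y)))
              ≡⟨ sym (*-assoc (𝟙 (not (big 3 x))) _ _) ⟩
            𝟙 (not (big 3 x)) * deg x * sum (λ y → 𝟙 (E x y) * (𝟙 (not (big 3 y)) * deg y))
              ≤⟨ *-monoʳ-≤ (𝟙 (not (big 3 x)) * deg x) (sum-mono (λ y → *-monoʳ-≤ (𝟙 (E x y)) (small y))) ⟩
            𝟙 (not (big 3 x)) * deg x * sum (λ y → 𝟙 (E x y) * 3)
              ≡⟨ cong (𝟙 (not (big 3 x)) * deg x *_) (sym (*-distribʳ-sum 3 (𝟙 ∘ E x))) ⟩
            𝟙 (not (big 3 x)) * deg x * (deg x * 3)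
              ≤⟨ sq ⟩
            27 ∎
            where
            sq : 𝟙 (not (big 3 x)) * deg x * (deg x * 3) ≤ 27
            sq with big 3 x in eq
            ... | true  = z≤n
            ... | false = *-mono-≤ {1 * deg x} {3} {deg x * 3} {9} (≤-trans (≤-reflexive (*-identityˡ (deg x))) (<ᵇ-false⁻ {3} {deg x} eq)) (*-monoˡ-≤ 3 (<ᵇ-false⁻ {3} {deg x} eq))

        -- Each `y` has at most `suc K` tails and `deg y` choices of `b`. The degrees above 3 have
        -- sum at most `n`, by `sum-big-degrees` with 3 in place of `K`.
        sum-mid : sum₄ mid ≤ n * suc K
        sum-mid = begin
          sum₄ mid
            ≡⟨ sum-cong-≗ {n} (λ a → sum-cong-≗ {n} (λ x → sum-cong-≗ {n} (λ y →
                 trans (sym (*-distribˡ-sum (𝟙 (tail₂ y x a)) (λ b → 𝟙 (big 3 y) * 𝟙 (E y b))))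
                 (cong (𝟙 (tail₂ y x a) *_) (sym (*-distribˡ-sum (𝟙 (big 3 y)) (𝟙 ∘ E y))))))) ⟩
          sum (λ a → sum (λ x → sum (λ y → 𝟙 (tail₂ y x a) * (𝟙 (big 3 y) * deg y))))
            ≡⟨ sum-rev₃ (λ a x y → 𝟙 (tail₂ y x a) * (𝟙 (big 3 y) * deg y)) ⟩
          sum (λ y → sum (λ x → sum (λ a → 𝟙 (tail₂ y x a) * (𝟙 (big 3 y) * deg y))))
            ≡⟨ sum-cong-≗ {n} (λ y → trans (sum-cong-≗ {n} (λ x → sym (*-distribʳ-sum _ (λ a → 𝟙 (tail₂ y x a)))))
                 (sym (*-distribʳ-sum _ (λ x → sum (λ a → 𝟙 (tail₂ y x a)))))) ⟩
          sum (λ y → sum (λ x → sum (λ a → 𝟙 (tail₂ y x a))) * (𝟙 (big 3 y) * deg y))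
            ≤⟨ sum-mono bound ⟩
          sum (λ y → 𝟙 (big 3 y) * deg y * suc K)
            ≡⟨ sym (*-distribʳ-sum (suc K) (λ y → 𝟙 (big 3 y) * deg y)) ⟩
          sum (λ y → 𝟙 (big 3 y) * deg y) * suc K
            ≤⟨ *-monoˡ-≤ (suc K) fat ⟩
          n * suc K ∎
          where
          open ≤-Reasoning
          fat : sum (λ y → 𝟙 (big 3 y) * deg y) ≤ n
          fat = sum-big-degrees ≤-refl
          bound : ∀ y → sum (λ x → sum (λ a → 𝟙 (tail₂ y x a))) * (𝟙 (big 3 y) * deg y) ≤ 𝟙 (big 3 y) * deg y * suc K
          bound y with big 3 y in eq
          ... | false = ≤-reflexive (*-zeroʳ (sum (λ x → sum (λ a → 𝟙 (tail₂ y x a)))))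
          ... | true  = ≤-trans (≤-reflexive (*-comm _ (1 * deg y))) (*-monoʳ-≤ (1 * deg y) (few-tails y (<ᵇ-true⁻ eq)))

        sum-hi : sum₄ hi ≡ doubleStars
        sum-hi = begin
          sum₄ hi
            ≡⟨ ∑-comm {n} {n} _ ⟩
          sum (λ x → sum (λ a → sum (λ y → sum (λ b → hi a x y b))))
            ≡⟨ sum-cong-≗ {n} (λ x → ∑-comm {n} {n} _) ⟩
          sum (λ x → sum (λ y → sum (λ a → sum (λ b → hi a x y b))))
            ≡⟨ sum-cong-≗ {n} (λ x → sum-cong-≗ {n} (λ y → trans
                 (sum-cong-≗ {n} (λ a → trans (sym (*-distribˡ-sum (𝟙 (dbl K x y)) (λ b → 𝟙 (isLeaf x a) * 𝟙 (isLeaf y b))))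
                   (cong (𝟙 (dbl K x y) *_) (sym (*-distribˡ-sum (𝟙 (isLeaf x a)) (λ b → 𝟙 (isLeaf y b)))))))
                 (trans (sym (*-distribˡ-sum (𝟙 (dbl K x y)) (λ a → 𝟙 (isLeaf x a) * leaves y)))
                   (cong (𝟙 (dbl K x y) *_) (sym (*-distribʳ-sum (leaves y) (λ a → 𝟙 (isLeaf x a)))))))) ⟩
          doubleStars ∎
          where open ≡-Reasoning

      P₄-count : sum₄ (λ a x y b → 𝟙 (q a x y b)) ≤ n * 27 + n * suc K + n * suc K + doubleStars
      P₄-count = begin
        sum₄ (λ a x y b → 𝟙 (q a x y b))
          ≤⟨ sum₄-mono cover ⟩
        sum₄ (λ a x y b → low a x y b + mid a x y b + mid b y x a + hi a x y b)
          ≡⟨ trans (sum₄-+ _ hi) (cong (_+ sum₄ hi) (trans (sum₄-+ _ (λ a x y b → mid b y x a)) (cong (_+ sum₄ (λ a x y b → mid b y x a)) (sum₄-+ low mid)))) ⟩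
        sum₄ low + sum₄ mid + sum₄ (λ a x y b → mid b y x a) + sum₄ hi
          ≤⟨ +-mono-≤ (+-mono-≤ (+-mono-≤ sum-low sum-mid) (≤-trans (≤-reflexive (sym (sum₄-rev mid))) sum-mid)) (≤-reflexive sum-hi) ⟩
        n * 27 + n * suc K + n * suc K + doubleStars ∎
        where open ≤-Reasoning

-- Double stars in P₅-free graphs

two-squares : ∀ u v → 2 * (u * v) ≤ u * u + v * v
two-squares u v with ≤-total u v
... | inj₁ h with m≤n⇒∃[o]m+o≡n h
...   | d , refl = slack (d * d) (solve (u ∷ d ∷ []))
two-squares u v | inj₂ h with m≤n⇒∃[o]m+o≡n h
...   | d , refl = slack (d * d) (solve (v ∷ d ∷ []))

four-product : ∀ u v → 4 * (u * v) ≤ (u + v) * (u + v)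
four-product u v = cert _ _ 0 (two-squares u v) (solve (u ∷ v ∷ []))

-- With 2ρ = a + ε, four times the claim is (11a − 8b)² + 50aε + ε(64b − 7ε) ≥ 0.
star-arith : ∀ {ν} a b R → 6 * a + 4 * b ≤ 4 * ν → 16 * ν < 23 * (a + b) → a + b + R ≤ ν →
  23 * (4 * (a * b) + R * R) ≤ 16 * (ν * ν)
star-arith {ν} a b R h large r with m≤n⇒∃[o]m+o≡n (≤-trans (m≤m+n (a + b) R) r)
... | ρ , refl with m≤n⇒∃[o]m+o≡n a≤2ρ
  where
  -- Here ρ = ν - a - b bounds what lies outside the double star, and 6a + 4b ≤ 4ν becomes a ≤ 2ρ,
  -- with equality in the extremal case 8 : 11 : 4.
  a≤2ρ : a ≤ 2 * ρ
  a≤2ρ = *-cancelˡ-≤ 2 (cert _ _ 0 h (solve (a ∷ b ∷ ρ ∷ [])))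
... | ε , 2ρ≡a+ε = *-cancelˡ-≤ 4 (begin
    4 * (23 * (4 * (a * b) + R * R))
      ≤⟨ *-monoʳ-≤ 4 (*-monoʳ-≤ 23 (+-monoʳ-≤ (4 * (a * b)) (*-mono-≤ R≤ρ R≤ρ))) ⟩
    4 * (23 * (4 * (a * b) + ρ * ρ))
      ≡⟨ solve (a ∷ b ∷ ρ ∷ []) ⟩
    23 * (16 * (a * b) + (2 * ρ) * (2 * ρ))
      ≡⟨ cong (λ t → 23 * (16 * (a * b) + t * t)) (sym 2ρ≡a+ε) ⟩
    23 * (16 * (a * b) + (a + ε) * (a + ε))
      ≤⟨ cert _ _ (50 * (a * ε) + 57 * (b * ε)) (two-squares (11 * a) (8 * b) ⊹ times 7 ε²≤bε) (solve (a ∷ b ∷ ε ∷ [])) ⟩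
    16 * ((2 * a + 2 * b + (a + ε)) * (2 * a + 2 * b + (a + ε)))
      ≡⟨ cong (λ t → 16 * ((2 * a + 2 * b + t) * (2 * a + 2 * b + t))) 2ρ≡a+ε ⟩
    16 * ((2 * a + 2 * b + 2 * ρ) * (2 * a + 2 * b + 2 * ρ))
      ≡⟨ solve (a ∷ b ∷ ρ ∷ []) ⟩
    4 * (16 * ((a + b + ρ) * (a + b + ρ))) ∎)
  where
  open ≤-Reasoning
  R≤ρ : R ≤ ρ
  R≤ρ = +-cancelˡ-≤ (a + b) R ρ r
  twice : 2 * (16 * (a + b + ρ)) ≤ 2 * (23 * (a + b))
  twice = *-monoʳ-≤ 2 (<⇒≤ large)
  twice' : 32 * (a + b) + 16 * (a + ε) ≤ 46 * (a + b)
  twice' = begin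
    32 * (a + b) + 16 * (a + ε) ≡⟨ cong (λ t → 32 * (a + b) + 16 * t) 2ρ≡a+ε ⟩
    32 * (a + b) + 16 * (2 * ρ) ≡⟨ solve (a ∷ b ∷ ρ ∷ []) ⟩
    2 * (16 * (a + b + ρ))      ≤⟨ twice ⟩
    2 * (23 * (a + b))          ≡⟨ solve (a ∷ b ∷ []) ⟩
    46 * (a + b)                ∎
  -- The negative term -7ε² is absorbed by the terms in bε once ε ≤ b. This is where the double star
  -- has to be large: the hypothesis gives 16ε ≤ 14b - 2a.
  ε≤b : ε ≤ b
  ε≤b = *-cancelˡ-≤ 16 (cert _ _ (2 * a + 2 * b) twice' (solve (a ∷ b ∷ ε ∷ [])))
  ε²≤bε : ε * ε ≤ b * ε
  ε²≤bε = *-monoˡ-≤ ε ε≤b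

module DoubleStars {n : ℕ} (G : Graph n) (free : P₅-free G) {K : ℕ} (3≤K : 3 ≤ K) where
  open Graph G
  open Static G free

  private
    ℓ = leaves
    D = dbl K

  sum-dbl-leaves : sum (λ x → sum (λ y → 𝟙 (D x y) * ℓ x)) ≤ n
  sum-dbl-leaves = ≤-trans (sum-mono bound) (sum-big-degrees 3≤K)
    where
    open ≤-Reasoning
    bound : ∀ x → sum (λ y → 𝟙 (D x y) * ℓ x) ≤ 𝟙 (big K x) * deg x
    bound x = begin
      sum (λ y → 𝟙 (D x y) * ℓ x)   ≡⟨ sym (*-distribʳ-sum (ℓ x) (λ y → 𝟙 (D x y))) ⟩
      sum (λ y → 𝟙 (D x y)) * ℓ x   ≤⟨ *-mono-≤ one (leaves≤deg 3≤K x) ⟩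
      𝟙 (big K x) * deg x           ∎
      where
      one : sum (λ y → 𝟙 (D x y)) ≤ 𝟙 (big K x)
      one = by-size (bool (big K x))
        where
        by-size : big K x ≡ true ⊎ big K x ≡ false → sum (λ y → 𝟙 (D x y)) ≤ 𝟙 (big K x)
        by-size (inj₁ eq) = ≤-trans (sum-unique (D x) (λ i j p q → dbl-unique 3≤K {x} {i} {j} p q)) (≤-reflexive (cong 𝟙 (sym eq)))
        by-size (inj₂ eq) = ≤-trans (≤-reflexive (sum-zero {n} (λ y → cong 𝟙 (¬true⇒false (λ d → true≢false (proj₁ (proj₂ (dbl-parts 3≤K {x} {y} d))) eq))))) z≤n

  sum-dbl-sizes : sum (λ x → sum (λ y → 𝟙 (D x y) * (ℓ x + ℓ y))) ≤ 2 * n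
  sum-dbl-sizes = begin
    sum (λ x → sum (λ y → 𝟙 (D x y) * (ℓ x + ℓ y)))
      ≡⟨ sum-cong-≗ {n} (λ x → trans (sum-cong-≗ {n} (λ y → *-distribˡ-+ (𝟙 (D x y)) (ℓ x) (ℓ y))) (∑-distrib-+ {n} _ _)) ⟩
    sum (λ x → sum (λ y → 𝟙 (D x y) * ℓ x) + sum (λ y → 𝟙 (D x y) * ℓ y))
      ≡⟨ ∑-distrib-+ {n} _ _ ⟩
    sum (λ x → sum (λ y → 𝟙 (D x y) * ℓ x)) + sum (λ x → sum (λ y → 𝟙 (D x y) * ℓ y))
      ≤⟨ +-mono-≤ sum-dbl-leaves (≤-trans mirrored sum-dbl-leaves) ⟩
    n + n
      ≡⟨ solve (n ∷ []) ⟩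
    2 * n ∎
    where
    open ≤-Reasoning
    mirrored : sum (λ x → sum (λ y → 𝟙 (D x y) * ℓ y)) ≤ sum (λ x → sum (λ y → 𝟙 (D x y) * ℓ x))
    mirrored = ≤-trans (≤-reflexive (∑-comm {n} {n} (λ x y → 𝟙 (D x y) * ℓ y)))
      (sum-mono (λ y → sum-mono (λ x → *-monoˡ-≤ (ℓ y) (𝟙-mono {D x y} {D y x} (λ d → dbl-sym 3≤K {x} {y} d)))))

  -- The four centres are distinct since partners are unique, and degrees of distinct big vertices
  -- have sum at most `n`.
  two-doubles-disjoint : ∀ {x y x₀ y₀} → D x y ≡ true → D x₀ y₀ ≡ true → x ≢ x₀ → x ≢ y₀ →
    ℓ x₀ + ℓ y₀ + (ℓ x + ℓ y) ≤ n
  two-doubles-disjoint {x} {y} {x₀} {y₀} d d₀ x≢x₀ x≢y₀ = begin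
    ℓ x₀ + ℓ y₀ + (ℓ x + ℓ y)             ≤⟨ (≤f x₀ bx₀ ⊹ ≤f y₀ by₀) ⊹ (≤f x bx ⊹ ≤f y by) ⟩
    f x₀ + f y₀ + (f x + f y)             ≡⟨ reassoc (f x₀) (f y₀) (f x) (f y) ⟩
    sumOver f (x₀ ∷ y₀ ∷ x ∷ y ∷ [])      ≤⟨ sumOver-≤ f (x₀ ∷ y₀ ∷ x ∷ y ∷ []) dist ⟩
    sum f                                 ≤⟨ sum-big-degrees 3≤K ⟩
    n                                     ∎
    where
    open ≤-Reasoning
    f : Fin n → ℕ
    f v = 𝟙 (big K v) * deg v
    ≤f : ∀ v → big K v ≡ true → ℓ v ≤ f v
    ≤f v b rewrite b = ≤-trans (leaves≤deg 3≤K v) (≤-reflexive (sym (*-identityˡ (deg v))))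
    reassoc : ∀ p q r s → p + q + (r + s) ≡ p + (q + (r + (s + 0)))
    reassoc = solve-∀
    bx = proj₁ (proj₂ (dbl-parts 3≤K {x} {y} d))
    by = proj₂ (proj₂ (dbl-parts 3≤K {x} {y} d))
    bx₀ = proj₁ (proj₂ (dbl-parts 3≤K {x₀} {y₀} d₀))
    by₀ = proj₂ (proj₂ (dbl-parts 3≤K {x₀} {y₀} d₀))
    y≢x₀ : x₀ ≢ y
    y≢x₀ refl = x≢y₀ (dbl-unique 3≤K {y} {x} {y₀} (dbl-sym 3≤K {x} {y} d) d₀)
    y≢y₀ : y₀ ≢ y
    y≢y₀ refl = x≢x₀ (dbl-unique 3≤K {y} {x} {x₀} (dbl-sym 3≤K {x} {y} d) (dbl-sym 3≤K {x₀} {y} d₀))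
    dist : distinct (x₀ ∷ y₀ ∷ x ∷ y ∷ []) ≡ true
    dist rewrite eqF-≢ (E-irrefl (proj₁ (dbl-parts 3≤K {x₀} {y₀} d₀))) | eqF-≢ (x≢x₀ ∘ sym) | eqF-≢ y≢x₀
      | eqF-≢ (x≢y₀ ∘ sym) | eqF-≢ y≢y₀ | eqF-≢ (E-irrefl (proj₁ (dbl-parts 3≤K {x} {y} d))) = refl

  -- A double star with s leaves has at most s²/4 ≤ (16ν/23)(s/4) paths, and all the s together are
  -- at most `n`. The cut 16/23 is four times 4/23 for this reason.
  double-stars-without-large : ∀ {ν} → n ≤ ν → (∀ x y → D x y ≡ true → 23 * (ℓ x + ℓ y) ≤ 16 * ν) →
    23 * doubleStars 3≤K ≤ 8 * (ν * ν)
  double-stars-without-large {ν} n≤ν h = *-cancelˡ-≤ 4 (begin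
    4 * (23 * doubleStars 3≤K)
      ≡⟨ sym (*-assoc 4 23 (doubleStars 3≤K)) ⟩
    92 * doubleStars 3≤K
      ≡⟨ trans (*-distribˡ-sum 92 (λ x → sum (λ y → 𝟙 (D x y) * (ℓ x * ℓ y)))) (sum-cong-≗ {n} (λ x → *-distribˡ-sum 92 (λ y → 𝟙 (D x y) * (ℓ x * ℓ y)))) ⟩
    sum (λ x → sum (λ y → 92 * (𝟙 (D x y) * (ℓ x * ℓ y))))
      ≤⟨ sum-mono (λ x → sum-mono (pw x)) ⟩
    sum (λ x → sum (λ y → 16 * ν * (𝟙 (D x y) * (ℓ x + ℓ y))))
      ≡⟨ sym (trans (*-distribˡ-sum (16 * ν) (λ x → sum (λ y → 𝟙 (D x y) * (ℓ x + ℓ y)))) (sum-cong-≗ {n} (λ x → *-distribˡ-sum (16 * ν) (λ y → 𝟙 (D x y) * (ℓ x + ℓ y))))) ⟩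
    16 * ν * sum (λ x → sum (λ y → 𝟙 (D x y) * (ℓ x + ℓ y)))
      ≤⟨ *-monoʳ-≤ (16 * ν) (≤-trans sum-dbl-sizes (*-monoʳ-≤ 2 n≤ν)) ⟩
    16 * ν * (2 * ν)
      ≡⟨ solve (ν ∷ []) ⟩
    4 * (8 * (ν * ν)) ∎)
    where
    open ≤-Reasoning
    point : ∀ a b → 23 * (a + b) ≤ 16 * ν → 92 * (1 * (a * b)) ≤ 16 * ν * (1 * (a + b))
    point a b le = begin
      92 * (1 * (a * b))           ≡⟨ solve (a ∷ b ∷ []) ⟩
      23 * (4 * (a * b))           ≤⟨ *-monoʳ-≤ 23 (four-product a b) ⟩
      23 * ((a + b) * (a + b))     ≡⟨ sym (*-assoc 23 (a + b) (a + b)) ⟩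
      23 * (a + b) * (a + b)       ≤⟨ *-monoˡ-≤ (a + b) le ⟩
      16 * ν * (a + b)             ≡⟨ solve (ν ∷ a ∷ b ∷ []) ⟩
      16 * ν * (1 * (a + b))       ∎
    pw : ∀ x y → 92 * (𝟙 (D x y) * (ℓ x * ℓ y)) ≤ 16 * ν * (𝟙 (D x y) * (ℓ x + ℓ y))
    pw x y with D x y in eq
    ... | false = z≤n
    ... | true  = point (ℓ x) (ℓ y) (h x y eq)

  module LargeDouble {x₀ y₀ : Fin n} (d₀ : D x₀ y₀ ≡ true) {R : ℕ} (size : ℓ x₀ + ℓ y₀ + R ≡ n) where
    private
      s = ℓ x₀ + ℓ y₀
      p = ℓ x₀ * ℓ y₀
      w : Fin n → Fin n → ℕ
      w x y = 𝟙 (eqF x x₀) * 𝟙 (eqF y y₀) + 𝟙 (eqF x y₀) * 𝟙 (eqF y x₀)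

      x₀≢y₀ : x₀ ≢ y₀
      x₀≢y₀ = E-irrefl (proj₁ (dbl-parts 3≤K {x₀} {y₀} d₀))

      -- Every double star other than the one at x₀, y₀ has at most R leaves; the terms in w compensate at x₀, y₀.
      pw : ∀ x y → 4 * (𝟙 (D x y) * (ℓ x * ℓ y)) + R * s * w x y ≤ R * (𝟙 (D x y) * (ℓ x + ℓ y)) + 4 * p * w x y
      pw x y with x F.≟ x₀ | x F.≟ y₀
      ... | yes refl | yes refl = ⊥-elim (x₀≢y₀ refl)
      ... | yes refl | no _ with y F.≟ y₀
      ...   | yes refl rewrite d₀ = ≤-reflexive (eq (ℓ x) (ℓ y))
        where
        eq : ∀ a b → 4 * (1 * (a * b)) + R * (a + b) * 1 ≡ R * (1 * (a + b)) + 4 * (a * b) * 1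
        eq a b = solve (a ∷ b ∷ R ∷ [])
      ...   | no y≢y₀ rewrite ¬true⇒false {D x y} (λ d → y≢y₀ (dbl-unique 3≤K {x} {y} {y₀} d d₀)) | *-zeroʳ (R * s) = z≤n
      pw x y | no _ | yes refl with y F.≟ x₀
      ...   | yes refl rewrite dbl-sym 3≤K {y} {x} d₀ = ≤-reflexive (eq (ℓ x) (ℓ y))
        where
        eq : ∀ a b → 4 * (1 * (a * b)) + R * (b + a) * 1 ≡ R * (1 * (a + b)) + 4 * (b * a) * 1
        eq a b = solve (a ∷ b ∷ R ∷ [])
      ...   | no y≢x₀ rewrite ¬true⇒false {D x y} (λ d → y≢x₀ (dbl-unique 3≤K {x} {y} {x₀} d (dbl-sym 3≤K {x₀} {x} d₀))) | *-zeroʳ (R * s) = z≤n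
      pw x y | no x≢x₀ | no x≢y₀ with D x y in eq
      ...   | false rewrite *-zeroʳ (R * s) = z≤n
      ...   | true = point (ℓ x) (ℓ y) (+-cancelˡ-≤ s (ℓ x + ℓ y) R (≤-trans (two-doubles-disjoint eq d₀ x≢x₀ x≢y₀) (≤-reflexive (sym size))))
        where
        open ≤-Reasoning
        point : ∀ a b → a + b ≤ R → 4 * (1 * (a * b)) + R * s * 0 ≤ R * (1 * (a + b)) + 4 * p * 0
        point a b le = begin
          4 * (1 * (a * b)) + R * s * 0    ≡⟨ cong₂ _+_ (cong (4 *_) (*-identityˡ (a * b))) (*-zeroʳ (R * s)) ⟩
          4 * (a * b) + 0                  ≡⟨ +-identityʳ _ ⟩
          4 * (a * b)                      ≤⟨ four-product a b ⟩
          (a + b) * (a + b)                ≤⟨ *-monoˡ-≤ (a + b) le ⟩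
          R * (a + b)                      ≡⟨ cong (R *_) (sym (*-identityˡ (a + b))) ⟩
          R * (1 * (a + b))                ≤⟨ m≤m+n _ _ ⟩
          R * (1 * (a + b)) + 4 * p * 0    ∎

      sum-w : ∀ c → sum (λ x → sum (λ y → c * w x y)) ≡ c * 2
      sum-w c = begin
        sum (λ x → sum (λ y → c * w x y))
          ≡⟨ sym (trans (*-distribˡ-sum c (λ x → sum (w x))) (sum-cong-≗ {n} (λ x → *-distribˡ-sum c (w x)))) ⟩
        c * sum (λ x → sum (w x))
          ≡⟨ cong (c *_) (trans (sum-cong-≗ {n} (λ x → trans (∑-distrib-+ {n} _ _) (cong₂ _+_ (sum-point y₀ (𝟙 (eqF x x₀))) (sum-point x₀ (𝟙 (eqF x y₀))))))
               (trans (∑-distrib-+ {n} _ _) (cong₂ _+_ (pt x₀) (pt y₀)))) ⟩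
        c * 2 ∎
        where
        open ≡-Reasoning
        pt : ∀ v → sum (λ x → 𝟙 (eqF x v)) ≡ 1
        pt v = trans (sum-cong-≗ {n} (λ x → sym (*-identityˡ (𝟙 (eqF x v))))) (sum-point v 1)

      sum₂-+ : ∀ (f g : Fin n → Fin n → ℕ) → sum (λ x → sum (λ y → f x y + g x y)) ≡ sum (λ x → sum (f x)) + sum (λ x → sum (g x))
      sum₂-+ f g = trans (sum-cong-≗ {n} (λ x → ∑-distrib-+ {n} _ _)) (∑-distrib-+ {n} _ _)

      sum₂-* : ∀ c (f : Fin n → Fin n → ℕ) → sum (λ x → sum (λ y → c * f x y)) ≡ c * sum (λ x → sum (f x))
      sum₂-* c f = sym (trans (*-distribˡ-sum c (λ x → sum (f x))) (sum-cong-≗ {n} (λ x → *-distribˡ-sum c (f x))))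

    -- Summing `pw` bounds everything by 2R(s + R), where s = ℓ x₀ + ℓ y₀. The share 2Rs of the
    -- large double star cancels, and 2R² remains for the others.
    large-double-bound : 4 * doubleStars 3≤K ≤ 2 * (4 * (ℓ x₀ * ℓ y₀) + R * R)
    large-double-bound = cert _ _ 0 summed (arith (doubleStars 3≤K) p R s)
      where
      open ≤-Reasoning
      arith : ∀ L p R s → 4 * L + (R * (2 * (s + R)) + 4 * p * 2) + 0 ≡ 2 * (4 * p + R * R) + (4 * L + R * s * 2)
      arith = solve-∀
      summed : 4 * doubleStars 3≤K + R * s * 2 ≤ R * (2 * (s + R)) + 4 * p * 2
      summed = begin
        4 * doubleStars 3≤K + R * s * 2
          ≡⟨ cong₂ _+_ (sym (sum₂-* 4 (λ x y → 𝟙 (D x y) * (ℓ x * ℓ y)))) (sym (sum-w (R * s))) ⟩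
        sum (λ x → sum (λ y → 4 * (𝟙 (D x y) * (ℓ x * ℓ y)))) + sum (λ x → sum (λ y → R * s * w x y))
          ≡⟨ sym (sum₂-+ (λ x y → 4 * (𝟙 (D x y) * (ℓ x * ℓ y))) (λ x y → R * s * w x y)) ⟩
        sum (λ x → sum (λ y → 4 * (𝟙 (D x y) * (ℓ x * ℓ y)) + R * s * w x y))
          ≤⟨ sum-mono (λ x → sum-mono (pw x)) ⟩
        sum (λ x → sum (λ y → R * (𝟙 (D x y) * (ℓ x + ℓ y)) + 4 * p * w x y))
          ≡⟨ sum₂-+ (λ x y → R * (𝟙 (D x y) * (ℓ x + ℓ y))) (λ x y → 4 * p * w x y) ⟩
        sum (λ x → sum (λ y → R * (𝟙 (D x y) * (ℓ x + ℓ y)))) + sum (λ x → sum (λ y → 4 * p * w x y))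
          ≡⟨ cong₂ _+_ (sum₂-* R (λ x y → 𝟙 (D x y) * (ℓ x + ℓ y))) (sum-w (4 * p)) ⟩
        R * sum (λ x → sum (λ y → 𝟙 (D x y) * (ℓ x + ℓ y))) + 4 * p * 2
          ≤⟨ +-monoˡ-≤ (4 * p * 2) (*-monoʳ-≤ R (≤-trans sum-dbl-sizes (≤-reflexive (cong (2 *_) (sym size))))) ⟩
        R * (2 * (s + R)) + 4 * p * 2 ∎

  double-size : ∀ {x y} → D x y ≡ true → ℓ x + ℓ y ≤ n
  double-size {x} {y} d = *-cancelˡ-≤ 2 (begin
    2 * (ℓ x + ℓ y)                                       ≡⟨ two (ℓ x) (ℓ y) ⟩
    1 * (ℓ x + ℓ y) + (1 * (ℓ y + ℓ x) + 0)               ≡⟨ cong₂ (λ b c → 𝟙 b * (ℓ x + ℓ y) + (𝟙 c * (ℓ y + ℓ x) + 0)) (sym d) (sym d') ⟩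
    h x y + (h y x + 0)                                   ≤⟨ +-mono-≤ (sum-term (h x) y) (+-monoˡ-≤ 0 (sum-term (h y) x)) ⟩
    sumOver (λ v → sum (h v)) (x ∷ y ∷ [])                ≤⟨ sumOver-≤ (λ v → sum (h v)) (x ∷ y ∷ []) dist ⟩
    sum (λ v → sum (h v))                                 ≤⟨ sum-dbl-sizes ⟩
    2 * n                                                 ∎)
    where
    open ≤-Reasoning
    h : Fin n → Fin n → ℕ
    h x y = 𝟙 (D x y) * (ℓ x + ℓ y)
    d' = dbl-sym 3≤K {x} {y} d
    two : ∀ a b → 2 * (a + b) ≡ 1 * (a + b) + (1 * (b + a) + 0)
    two = solve-∀
    dist : distinct (x ∷ y ∷ []) ≡ true
    dist rewrite eqF-≢ (E-irrefl (proj₁ (dbl-parts 3≤K {x} {y} d))) = refl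

  double-stars-bound : ∀ {ν} → n ≤ ν →
    (∀ x y → D x y ≡ true → 6 * ℓ x + 4 * ℓ y ≤ 4 * ν ⊎ 6 * ℓ y + 4 * ℓ x ≤ 4 * ν) →
    23 * doubleStars 3≤K ≤ 8 * (ν * ν)
  double-stars-bound {ν} n≤ν h with FP.any? (λ x → FP.any? (λ y → (D x y Data.Bool.≟ true) ×-dec (16 * ν <? 23 * (ℓ x + ℓ y))))
  ... | no ¬p = double-stars-without-large n≤ν (λ x y d → ≮⇒≥ (λ lt → ¬p (x , y , d , lt)))
  ... | yes (x , y , d , lt) with m≤n⇒∃[o]m+o≡n (double-size {x} {y} d)
  ...   | R , size = *-cancelˡ-≤ 4 (begin
      4 * (23 * doubleStars 3≤K)                        ≡⟨ comm (doubleStars 3≤K) ⟩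
      23 * (4 * doubleStars 3≤K)                        ≤⟨ *-monoʳ-≤ 23 (LargeDouble.large-double-bound {x} {y} d size) ⟩
      23 * (2 * (4 * (ℓ x * ℓ y) + R * R))              ≡⟨ comm₂ (4 * (ℓ x * ℓ y) + R * R) ⟩
      2 * (23 * (4 * (ℓ x * ℓ y) + R * R))              ≤⟨ *-monoʳ-≤ 2 (star (h x y d)) ⟩
      2 * (16 * (ν * ν))                                ≡⟨ comm₃ (ν * ν) ⟩
      4 * (8 * (ν * ν))                                 ∎)
    where
    open ≤-Reasoning
    comm : ∀ L → 4 * (23 * L) ≡ 23 * (4 * L)
    comm = solve-∀
    comm₂ : ∀ L → 23 * (2 * L) ≡ 2 * (23 * L)
    comm₂ = solve-∀
    comm₃ : ∀ L → 2 * (16 * L) ≡ 4 * (8 * L)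
    comm₃ = solve-∀
    fit : ℓ x + ℓ y + R ≤ ν
    fit = ≤-trans (≤-reflexive size) n≤ν
    star : 6 * ℓ x + 4 * ℓ y ≤ 4 * ν ⊎ 6 * ℓ y + 4 * ℓ x ≤ 4 * ν → 23 * (4 * (ℓ x * ℓ y) + R * R) ≤ 16 * (ν * ν)
    star (inj₁ k) = star-arith (ℓ x) (ℓ y) R k lt fit
    star (inj₂ k) = ≤-trans (≤-reflexive (cong (λ t → 23 * (4 * t + R * R)) (*-comm (ℓ x) (ℓ y))))
      (star-arith (ℓ y) (ℓ x) R k (subst (λ t → 16 * ν < 23 * t) (+-comm (ℓ x) (ℓ y)) lt) (subst (λ t → t + R ≤ ν) (+-comm (ℓ x) (ℓ y)) fit))

-- Adding one edge to a relation

-- Describes a claim by adjacency alone: `allEdges` lists an edge in one orientation, whereas the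
-- strategies name it by centre and leaf.
record Ext {n : ℕ} (A A' : Rel n) (s t : Fin n) : Set where
  field
    old  : ∀ {u v} → A u v ≡ true → A' u v ≡ true
    new  : A' s t ≡ true
    new' : A' t s ≡ true
    inv  : ∀ {u v} → A' u v ≡ true → A u v ≡ true ⊎ (u ≡ s × v ≡ t) ⊎ (u ≡ t × v ≡ s)

Ext-swap : ∀ {n} {A A' : Rel n} {s t} → Ext A A' s t → Ext A A' t s
Ext-swap {A = A} {A'} {s} {t} X = record { old = Ext.old X ; new = Ext.new' X ; new' = Ext.new X ; inv = inv' }
  where
  inv' : ∀ {u v} → A' u v ≡ true → A u v ≡ true ⊎ (u ≡ t × v ≡ s) ⊎ (u ≡ s × v ≡ t)
  inv' h with Ext.inv X h
  ... | inj₁ p = inj₁ p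
  ... | inj₂ (inj₁ p) = inj₂ (inj₂ p)
  ... | inj₂ (inj₂ p) = inj₂ (inj₁ p)

module _ {n : ℕ} where

  sameEdge-sym : ∀ u v (e : Edge n) → sameEdge (u , v) e ≡ sameEdge (v , u) e
  sameEdge-sym u v (c , d) = trans (∨-comm (eqF u c ∧ eqF v d) _) (cong₂ _∨_ (∧-comm (eqF u d) _) (∧-comm (eqF u c) _))

  sameEdge-refl : ∀ u v → sameEdge {n} (u , v) (u , v) ≡ true
  sameEdge-refl u v rewrite eqF-refl u | eqF-refl v = refl

  sameEdge-cases : ∀ {u v s t : Fin n} → sameEdge (u , v) (s , t) ≡ true → (u ≡ s × v ≡ t) ⊎ (u ≡ t × v ≡ s)
  sameEdge-cases {u} {v} {s} {t} h with ∨-true {eqF u s ∧ eqF v t} h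
  ... | inj₁ p with ∧-true {eqF u s} p
  ...   | a , b = inj₁ (eqF-≡ a , eqF-≡ b)
  sameEdge-cases {u} {v} {s} {t} h | inj₂ p with ∧-true {eqF u t} p
  ...   | a , b = inj₂ (eqF-≡ a , eqF-≡ b)

  adj-comm : ∀ (es : List (Edge n)) u v → adj es u v ≡ adj es v u
  adj-comm []       u v = refl
  adj-comm (e ∷ es) u v = cong₂ _∨_ (sameEdge-sym u v e) (adj-comm es u v)

  adj-sym : ∀ (es : List (Edge n)) {u v} → adj es u v ≡ true → adj es v u ≡ true
  adj-sym es {u} {v} h = trans (adj-comm es v u) h

  adj-symᶠ : ∀ (es : List (Edge n)) {u v} → adj es u v ≡ false → adj es v u ≡ false
  adj-symᶠ es {u} {v} h = trans (adj-comm es v u) h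

  cons-Ext : ∀ (es : List (Edge n)) s t → Ext (adj es) (adj ((s , t) ∷ es)) s t
  cons-Ext es s t = record
    { old  = λ {u} {v} h → trans (cong (sameEdge (u , v) (s , t) ∨_) h) (∨-zeroʳ _)
    ; new  = cong (_∨ adj es s t) (sameEdge-refl s t)
    ; new' = cong (_∨ adj es t s) (trans (sameEdge-sym t s (s , t)) (sameEdge-refl s t))
    ; inv  = λ {u} {v} → inv {u} {v} }
    where
    inv : ∀ {u v} → adj ((s , t) ∷ es) u v ≡ true → adj es u v ≡ true ⊎ (u ≡ s × v ≡ t) ⊎ (u ≡ t × v ≡ s)
    inv {u} {v} h with ∨-true {sameEdge (u , v) (s , t)} h
    ... | inj₁ p = inj₂ (sameEdge-cases p)
    ... | inj₂ p = inj₁ p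

  Loopless : List (Edge n) → Set
  Loopless es = ∀ {u v} → adj es u v ≡ true → u ≢ v

  loopless-∷ : ∀ {es s t} → Loopless es → s ≢ t → Loopless ((s , t) ∷ es)
  loopless-∷ {es} {s} {t} l s≢t {u} {v} h with Ext.inv (cons-Ext es s t) {u} {v} h
  ... | inj₁ p = l p
  ... | inj₂ (inj₁ (refl , refl)) = s≢t
  ... | inj₂ (inj₂ (refl , refl)) = s≢t ∘ sym

  graph : ∀ es → Loopless es → Graph n
  graph es l = record { E = adj es ; E-sym = λ {u} {v} → adj-sym es {u} {v} ; E-irrefl = λ {u} {v} → l {u} {v} }

  -- Free edges of a position.

  allEdges-intro : ∀ {i j : Fin n} → toℕ i < toℕ j → (i , j) ∈ allEdges n
  allEdges-intro {i} {j} h = ∈-concatMap⁺ (λ i → map (i ,_) (filterᵇ (λ j → toℕ i <ᵇ toℕ j) (allFin n)))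
    (lose (∈-allFin i) (∈-map⁺ (i ,_) (∈-filter⁺ (λ j → Data.Bool.T? (toℕ i <ᵇ toℕ j)) (∈-allFin j) (<⇒<ᵇ h))))

  allEdges-elim : ∀ {s t : Fin n} → (s , t) ∈ allEdges n → s ≢ t
  allEdges-elim {s} {t} h with find (∈-concatMap⁻ (λ i → map (i ,_) (filterᵇ (λ j → toℕ i <ᵇ toℕ j) (allFin n))) {xs = allFin n} h)
  ... | i , _ , h₁ with ∈-map⁻ (i ,_) h₁
  ...   | j , h₂ , refl with ∈-filter⁻ (λ j → Data.Bool.T? (toℕ i <ᵇ toℕ j)) {xs = allFin n} h₂
  ...     | _ , lt = λ { refl → <-irrefl refl (<ᵇ⇒< (toℕ i) (toℕ i) lt) }

  isFree : List (Edge n) → List (Edge n) → Edge n → Bool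
  isFree C B e = not (edgeIn e C ∨ edgeIn e B)

  free-elim : ∀ {C B s t} → (s , t) ∈ freeEdges C B → s ≢ t × adj C s t ≡ false × adj B s t ≡ false
  free-elim {C} {B} {s} {t} h with ∈-filter⁻ (λ e → Data.Bool.T? (isFree C B e)) {xs = allEdges n} h
  ... | h₁ , h₂ = allEdges-elim h₁ , ∨-false (not-true (T⇒≡ h₂))

  -- The pair `e` may be either orientation of uv. `ext` is stated for every list, so that it serves
  -- the player who claims the edge, whoever that is.
  record FreeEdge (C B : List (Edge n)) (u v : Fin n) : Set where
    field
      e      : Edge n
      isfree : e ∈ freeEdges C B
      ext    : ∀ es → Ext (adj es) (adj (e ∷ es)) u v

  free-intro : ∀ C B {u v : Fin n} → u ≢ v → adj C u v ≡ false → adj B u v ≡ false → FreeEdge C B u v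
  free-intro C B {u} {v} u≢v c b with <-cmp (toℕ u) (toℕ v)
  ... | tri< lt _ _ = record
    { e = u , v
    ; isfree = ∈-filter⁺ (λ e → Data.Bool.T? (isFree C B e)) (allEdges-intro lt) (≡⇒T (cong not (cong₂ _∨_ c b)))
    ; ext = λ es → cons-Ext es u v }
  ... | tri≈ _ eq _ = ⊥-elim (u≢v (FP.toℕ-injective eq))
  ... | tri> _ _ gt = record
    { e = v , u
    ; isfree = ∈-filter⁺ (λ e → Data.Bool.T? (isFree C B e)) (allEdges-intro gt) (≡⇒T (cong not (cong₂ _∨_ (adj-symᶠ C {u} {v} c) (adj-symᶠ B {u} {v} b))))
    ; ext = λ es → Ext-swap (cons-Ext es v u) }

  count-strict : ∀ {A : Set} {p q : A → Bool} {e} xs → (∀ x → p x ≡ true → q x ≡ true) → e ∈ xs → p e ≡ false → q e ≡ true →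
    count p xs < count q xs
  count-strict {p = p} {q} (x ∷ xs) h (here refl) pe qe rewrite count-∷ p x xs | count-∷ q x xs | pe | qe = s≤s (count-mono xs h)
  count-strict {p = p} {q} (x ∷ xs) h (there m) pe qe rewrite count-∷ p x xs | count-∷ q x xs =
    +-mono-≤-< (𝟙-mono (h x)) (count-strict xs h m pe qe)

  -- Allows the number of free edges to bound the fuel that is needed, so that play does not stop
  -- early.
  free-shrink-C : ∀ C B {e} → e ∈ freeEdges C B → length (freeEdges (e ∷ C) B) < length (freeEdges C B)
  free-shrink-C C B {e} m with ∈-filter⁻ (λ e → Data.Bool.T? (isFree C B e)) {xs = allEdges n} m
  ... | m₁ , fr = count-strict {p = isFree (e ∷ C) B} {q = isFree C B} (allEdges n) weaker m₁
      (cong (λ b → not ((b ∨ edgeIn e C) ∨ edgeIn e B)) (sameEdge-refl (proj₁ e) (proj₂ e))) (T⇒≡ fr)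
    where
    weaker : ∀ x → isFree (e ∷ C) B x ≡ true → isFree C B x ≡ true
    weaker x h with ∨-false {edgeIn x (e ∷ C)} (not-true h)
    ... | a , b with ∨-false {sameEdge x e} a
    ...   | _ , c = cong not (cong₂ _∨_ c b)

  free-shrink-B : ∀ C B {e} → e ∈ freeEdges C B → length (freeEdges C (e ∷ B)) < length (freeEdges C B)
  free-shrink-B C B {e} m with ∈-filter⁻ (λ e → Data.Bool.T? (isFree C B e)) {xs = allEdges n} m
  ... | m₁ , fr = count-strict {p = isFree C (e ∷ B)} {q = isFree C B} (allEdges n) weaker m₁
      (trans (cong (λ b → not (edgeIn e C ∨ (b ∨ edgeIn e B))) (sameEdge-refl (proj₁ e) (proj₂ e))) (cong not (∨-zeroʳ (edgeIn e C)))) (T⇒≡ fr)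
    where
    weaker : ∀ x → isFree C (e ∷ B) x ≡ true → isFree C B x ≡ true
    weaker x h with ∨-false {edgeIn x C} (not-true h)
    ... | a , b with ∨-false {sameEdge x e} b
    ...   | _ , c = cong not (cong₂ _∨_ a c)

-- Paths

module _ {n : ℕ} where

  open import Data.List.Relation.Unary.All using (All; []; _∷_)
  open import Data.List.Relation.Unary.AllPairs using (AllPairs; []; _∷_)
  open import Data.List.Relation.Unary.Linked using (Linked; []; [-]; _∷_)

  any-eqF-false : ∀ {x : Fin n} {xs} → All (x ≢_) xs → any (eqF x) xs ≡ false
  any-eqF-false []      = refl
  any-eqF-false (p ∷ q) = cong₂ _∨_ (eqF-≢ p) (any-eqF-false q)

  any-eqF-false⁻ : ∀ {x : Fin n} xs → any (eqF x) xs ≡ false → All (x ≢_) xs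
  any-eqF-false⁻ []       h = []
  any-eqF-false⁻ {x} (y ∷ ys) h with ∨-false {eqF x y} h
  ... | a , b = eqF-false a ∷ any-eqF-false⁻ ys b

  distinct-true : ∀ {l : List (Fin n)} → AllPairs _≢_ l → distinct l ≡ true
  distinct-true []      = refl
  distinct-true (p ∷ q) = cong₂ _∧_ (cong not (any-eqF-false p)) (distinct-true q)

  distinct-true⁻ : ∀ (l : List (Fin n)) → distinct l ≡ true → AllPairs _≢_ l
  distinct-true⁻ []      h = []
  distinct-true⁻ (x ∷ l) h with ∧-true {not (any (eqF x) l)} h
  ... | a , b = any-eqF-false⁻ l (not-true a) ∷ distinct-true⁻ l b

  Joined : List (Edge n) → Fin n → Fin n → Set
  Joined C u v = adj C u v ≡ true

  consec-true : ∀ {C l} → Linked (Joined C) l → consecAdj C l ≡ true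
  consec-true []      = refl
  consec-true [-]     = refl
  consec-true (p ∷ q) = cong₂ _∧_ p (consec-true q)

  consec-true⁻ : ∀ C l → consecAdj C l ≡ true → Linked (Joined C) l
  consec-true⁻ C []          h = []
  consec-true⁻ C (x ∷ [])    h = [-]
  consec-true⁻ C (x ∷ y ∷ l) h =
    proj₁ (∧-true {adj C x y} h) ∷ consec-true⁻ C (y ∷ l) (proj₂ (∧-true {adj C x y} h))

  path-true : ∀ {C l} → AllPairs _≢_ l → Linked (Joined C) l → isPath C l ≡ true
  path-true {C} {l} d c = cong₂ _∧_ (distinct-true d) (consec-true {C} {l} c)

  path-true⁻ : ∀ C l → isPath C l ≡ true → AllPairs _≢_ l × Linked (Joined C) l
  path-true⁻ C l h with ∧-true {distinct l} h
  ... | a , b = distinct-true⁻ l a , consec-true⁻ C l b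

  consec-mono : ∀ {C C' : List (Edge n)} → (∀ {u v} → adj C u v ≡ true → adj C' u v ≡ true) → ∀ l →
    consecAdj C l ≡ true → consecAdj C' l ≡ true
  consec-mono h [] c = refl
  consec-mono h (x ∷ []) c = refl
  consec-mono {C} h (x ∷ y ∷ l) c = cong₂ _∧_ (h {x} {y} (proj₁ (∧-true {adj C x y} c)))
    (consec-mono (λ {u} {v} → h {u} {v}) (y ∷ l) (proj₂ (∧-true {adj C x y} c)))

  path-mono : ∀ {C C' : List (Edge n)} → (∀ {u v} → adj C u v ≡ true → adj C' u v ≡ true) → ∀ l →
    isPath C l ≡ true → isPath C' l ≡ true
  path-mono h l p = cong₂ _∧_ (proj₁ (∧-true {distinct l} p))
    (consec-mono (λ {u} {v} → h {u} {v}) l (proj₂ (∧-true {distinct l} p)))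

  copies-mono : ∀ h (C : List (Edge n)) e → pathCopies h C ≤ pathCopies h (e ∷ C)
  copies-mono h C (s , t) = count-mono (tuples h) step
    where
    step : ∀ l → isPath C l ∧ firstLtLast l ≡ true → isPath ((s , t) ∷ C) l ∧ firstLtLast l ≡ true
    step l p with ∧-true {isPath C l} p
    ... | a , b = cong₂ _∧_ (path-mono (λ {u} {v} → Ext.old (cons-Ext C s t) {u} {v}) l a) b

  tuples-≥ : ∀ (p : List (Fin n) → Bool) l → 𝟙 (p l) ≤ count p (tuples (length l))
  tuples-≥ p []      = ≤-reflexive (sym (count-tuples-0 p))
  tuples-≥ p (x ∷ l) = ≤-trans (tuples-≥ (λ l → p (x ∷ l)) l)
    (≤-trans (sum-term (λ v → count (λ l → p (v ∷ l)) (tuples (length l))) x) (≤-reflexive (sym (count-tuples (length l) p))))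

  tuples-∃ : ∀ r (p : List (Fin n) → Bool) → 0 < count p (tuples r) → ∃[ l ] (length l ≡ r × p l ≡ true)
  tuples-∃ zero p h = [] , refl , pos (≤-trans h (≤-reflexive (count-tuples-0 p)))
    where
    pos : ∀ {b} → 0 < 𝟙 b → b ≡ true
    pos {true} _ = refl
  tuples-∃ (suc r) p h with sum-positive (λ v → count (λ l → p (v ∷ l)) (tuples r)) (≤-trans h (≤-reflexive (count-tuples r p)))
  ... | v , hv with tuples-∃ r (λ l → p (v ∷ l)) hv
  ...   | l , len , pl = v ∷ l , cong suc len , pl

  path₄ : List (Edge n) → Fin n → Fin n → Fin n → Fin n → Bool
  path₄ C a b c d = isPath C (a ∷ b ∷ c ∷ d ∷ [])

  path₄-parts : ∀ C {a b c d} → path₄ C a b c d ≡ true →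
    adj C a b ≡ true × adj C b c ≡ true × adj C c d ≡ true × a ≢ c × a ≢ d × b ≢ d
  path₄-parts C {a} {b} {c} {d} h with path-true⁻ C (a ∷ b ∷ c ∷ d ∷ []) h
  ... | (_ ∷ ac ∷ ad ∷ []) ∷ (_ ∷ bd ∷ []) ∷ _ , ab ∷ bc ∷ cd ∷ [-] = ab , bc , cd , ac , ad , bd

  path₄-intro : ∀ C {a b c d} → Loopless C → adj C a b ≡ true → adj C b c ≡ true → adj C c d ≡ true →
    a ≢ c → a ≢ d → b ≢ d → path₄ C a b c d ≡ true
  path₄-intro C {a} {b} {c} {d} l ab bc cd a≢c a≢d b≢d = path-true {C} {a ∷ b ∷ c ∷ d ∷ []}
    ((l {a} {b} ab ∷ a≢c ∷ a≢d ∷ []) ∷ (l {b} {c} bc ∷ b≢d ∷ []) ∷ (l {c} {d} cd ∷ []) ∷ [] ∷ [])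
    (ab ∷ bc ∷ cd ∷ [-])

  path₄-rev : ∀ C → Loopless C → ∀ {a b c d} → path₄ C a b c d ≡ true → path₄ C d c b a ≡ true
  path₄-rev C l {a} {b} {c} {d} h with path₄-parts C {a} {b} {c} {d} h
  ... | ab , bc , cd , a≢c , a≢d , b≢d =
    path₄-intro C l (adj-sym C {c} cd) (adj-sym C {b} bc) (adj-sym C {a} ab) (b≢d ∘ sym) (a≢d ∘ sym) (a≢c ∘ sym)

  -- Reversal exchanges the paths with a < d and those with d < a, and the ends differ. Ordered
  -- quadruples are what iterated sums can count.
  twice-copies : ∀ C → Loopless C → 2 * pathCopies 4 C ≡ sum₄ (λ a b c d → 𝟙 (path₄ C a b c d))
  twice-copies C l = begin
    2 * P                                                                 ≡⟨ cong (P +_) (+-identityʳ P) ⟩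
    P + P                                                                 ≡⟨ cong₂ _+_ forward (trans forward backward) ⟩
    sum₄ (λ a b c d → 𝟙 (q a b c d ∧ lt a d)) + sum₄ (λ a b c d → 𝟙 (q a b c d ∧ lt d a))
                                                                          ≡⟨ sym (sum₄-+ (λ a b c d → 𝟙 (q a b c d ∧ lt a d)) (λ a b c d → 𝟙 (q a b c d ∧ lt d a))) ⟩
    sum₄ (λ a b c d → 𝟙 (q a b c d ∧ lt a d) + 𝟙 (q a b c d ∧ lt d a))    ≡⟨ sum₄-cong either ⟩
    sum₄ (λ a b c d → 𝟙 (q a b c d))                                      ∎
    where
    open ≡-Reasoning
    P = pathCopies 4 C
    q = path₄ C
    lt : Fin n → Fin n → Bool
    lt a d = toℕ a <ᵇ toℕ d
    r : List (Fin n) → Bool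
    r l = isPath C l ∧ firstLtLast l
    forward : P ≡ sum₄ (λ a b c d → 𝟙 (q a b c d ∧ lt a d))
    forward = trans (count-tuples 3 r) (sum-cong-≗ {n} (λ a → trans (count-tuples 2 (λ l → r (a ∷ l)))
      (sum-cong-≗ {n} (λ b → trans (count-tuples 1 (λ l → r (a ∷ b ∷ l)))
      (sum-cong-≗ {n} (λ c → trans (count-tuples 0 (λ l → r (a ∷ b ∷ c ∷ l)))
      (sum-cong-≗ {n} (λ d → count-tuples-0 (λ l → r (a ∷ b ∷ c ∷ d ∷ l))))))))))
    reversed : ∀ a b c d → q a b c d ≡ q d c b a
    reversed a b c d with bool (q a b c d) | bool (q d c b a)
    ... | inj₁ h | _      = trans h (sym (path₄-rev C l {a} {b} {c} {d} h))
    ... | inj₂ h | inj₂ k = trans h (sym k)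
    ... | inj₂ h | inj₁ k = ⊥-elim (true≢false (path₄-rev C l {d} {c} {b} {a} k) h)
    backward : sum₄ (λ a b c d → 𝟙 (q a b c d ∧ lt a d)) ≡ sum₄ (λ a b c d → 𝟙 (q a b c d ∧ lt d a))
    backward = trans (sum₄-rev (λ a b c d → 𝟙 (q a b c d ∧ lt a d))) (sum₄-cong (λ a b c d → cong (λ x → 𝟙 (x ∧ lt d a)) (reversed d c b a)))
    either : ∀ a b c d → 𝟙 (q a b c d ∧ lt a d) + 𝟙 (q a b c d ∧ lt d a) ≡ 𝟙 (q a b c d)
    either a b c d with q a b c d in eq
    ... | false = refl
    ... | true with <-cmp (toℕ a) (toℕ d)
    ...   | tri≈ _ e _ = ⊥-elim (proj₁ (proj₂ (proj₂ (proj₂ (proj₂ (path₄-parts C {a} {b} {c} {d} eq))))) (FP.toℕ-injective e))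
    ...   | tri< a<d _ ¬d<a rewrite <ᵇ-true a<d | ¬true⇒false {toℕ d <ᵇ toℕ a} (¬d<a ∘ <ᵇ-true⁻) = refl
    ...   | tri> ¬a<d _ d<a rewrite <ᵇ-true d<a | ¬true⇒false {toℕ a <ᵇ toℕ d} (¬a<d ∘ <ᵇ-true⁻) = refl

  containsPath-intro : ∀ r (C : List (Edge n)) l → length l ≡ r → isPath C l ≡ true → containsPath r C ≡ true
  containsPath-intro r C l refl h =
    any-true (isPath C) (tuples r) (≤-trans (≤-reflexive (cong 𝟙 (sym h))) (tuples-≥ (isPath C) l))

  containsPath-elim : ∀ r (C : List (Edge n)) → containsPath r C ≡ true → ∃[ l ] (length l ≡ r × isPath C l ≡ true)
  containsPath-elim r C h = tuples-∃ r (isPath C) (any-true⁻ (isPath C) (tuples r) h)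

  free-of-containsPath : ∀ {C : List (Edge n)} (l : Loopless C) → containsPath 5 C ≡ false → P₅-free (graph C l)
  free-of-containsPath {C} l h {a} {b} {c} {d} {e} ab bc cd de a≢c a≢d a≢e b≢d b≢e c≢e =
    true≢false (containsPath-intro 5 C (a ∷ b ∷ c ∷ d ∷ e ∷ []) refl (path-true {C} {a ∷ b ∷ c ∷ d ∷ e ∷ []}
      ((l {a} {b} ab ∷ a≢c ∷ a≢d ∷ a≢e ∷ []) ∷ (l {b} {c} bc ∷ b≢d ∷ b≢e ∷ []) ∷ (l {c} {d} cd ∷ c≢e ∷ []) ∷ (l {d} {e} de ∷ []) ∷ [] ∷ [])
      (ab ∷ bc ∷ cd ∷ de ∷ [-]))) h

  containsPath-of-free : ∀ {C : List (Edge n)} (l : Loopless C) → P₅-free (graph C l) → containsPath 5 C ≡ false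
  containsPath-of-free {C} l free = ¬true⇒false (λ h → absurd (containsPath-elim 5 C h))
    where
    absurd : ∃[ l ] (length l ≡ 5 × isPath C l ≡ true) → ⊥
    absurd (a ∷ b ∷ c ∷ d ∷ e ∷ [] , _ , h) with path-true⁻ C (a ∷ b ∷ c ∷ d ∷ e ∷ []) h
    ... | (_ ∷ ac ∷ ad ∷ ae ∷ []) ∷ (_ ∷ bd ∷ be ∷ []) ∷ (_ ∷ ce ∷ []) ∷ _ , ab ∷ bc ∷ cd ∷ de ∷ [-] =
      free ab bc cd de ac ad ae bd be ce

-- Minimax

module _ {A : Set} (f : A → ℕ) where

  max-≥ : ∀ e es {x V} → x ∈ e ∷ es → V ≤ f x → V ≤ foldr (λ x acc → f x ⊔ acc) (f e) es
  max-≥ e []        (here refl)         h = h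
  max-≥ e (e' ∷ es) (here refl)         h = ≤-trans (max-≥ e es (here refl) h) (m≤n⊔m (f e') _)
  max-≥ e (e' ∷ es) (there (here refl)) h = ≤-trans h (m≤m⊔n (f e') _)
  max-≥ e (e' ∷ es) (there (there m))   h = ≤-trans (max-≥ e es (there m) h) (m≤n⊔m (f e') _)

  max-≤ : ∀ e es {V} → (∀ {x} → x ∈ e ∷ es → f x ≤ V) → foldr (λ x acc → f x ⊔ acc) (f e) es ≤ V
  max-≤ e []        h = h (here refl)
  max-≤ e (e' ∷ es) h = ⊔-lub (h (there (here refl))) (max-≤ e es λ { (here p) → h (here p) ; (there m) → h (there (there m)) })

  min-≤ : ∀ e es {x V} → x ∈ e ∷ es → f x ≤ V → foldr (λ x acc → f x ⊓ acc) (f e) es ≤ V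
  min-≤ e []        (here refl)         h = h
  min-≤ e (e' ∷ es) (here refl)         h = ≤-trans (m⊓n≤n (f e') _) (min-≤ e es (here refl) h)
  min-≤ e (e' ∷ es) (there (here refl)) h = ≤-trans (m⊓n≤m (f e') _) h
  min-≤ e (e' ∷ es) (there (there m))   h = ≤-trans (m⊓n≤n (f e') _) (min-≤ e es (there m) h)

  min-≥ : ∀ e es {V} → (∀ {x} → x ∈ e ∷ es → V ≤ f x) → V ≤ foldr (λ x acc → f x ⊓ acc) (f e) es
  min-≥ e []        h = h (here refl)
  min-≥ e (e' ∷ es) h = ⊓-glb (h (there (here refl))) (min-≥ e es λ { (here p) → h (here p) ; (there m) → h (there (there m)) })

module _ {n : ℕ} (h f : ℕ) where

  private
    legal : List (Edge n) → Edge n → Bool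
    legal C e = not (containsPath f (e ∷ C))

    legal-elim : ∀ {C B e} → e ∈ filterᵇ (legal C) (freeEdges C B) → e ∈ freeEdges C B × containsPath f (e ∷ C) ≡ false
    legal-elim {C} {B} m with ∈-filter⁻ (λ e → Data.Bool.T? (legal C e)) {xs = freeEdges C B} m
    ... | m₁ , p = m₁ , not-true (T⇒≡ p)

  Constructor-≥ : ∀ {V} m (C B : List (Edge n)) {e} → e ∈ freeEdges C B → containsPath f (e ∷ C) ≡ false →
    V ≤ gameValue h f m false (e ∷ C) B → V ≤ gameValue h f (suc m) true C B
  Constructor-≥ m C B {e} fr le v with filterᵇ (legal C) (freeEdges C B)
    | ∈-filter⁺ (λ e → Data.Bool.T? (legal C e)) fr (≡⇒T (cong not le))
  ... | e₀ ∷ es | mem = max-≥ (λ e' → gameValue h f m false (e' ∷ C) B) e₀ es mem v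

  Constructor-≤ : ∀ {V} m (C B : List (Edge n)) → pathCopies h C ≤ V →
    (∀ {e} → e ∈ freeEdges C B → containsPath f (e ∷ C) ≡ false → gameValue h f m false (e ∷ C) B ≤ V) →
    gameValue h f (suc m) true C B ≤ V
  Constructor-≤ {V} m C B p v with filterᵇ (legal C) (freeEdges C B) | (λ {e} → legal-elim {C} {B} {e})
  ... | []      | _  = p
  ... | e₀ ∷ es | el = max-≤ (λ e' → gameValue h f m false (e' ∷ C) B) e₀ es (λ m → v (proj₁ (el m)) (proj₂ (el m)))

  Blocker-≥ : ∀ {V} m (C B : List (Edge n)) → (freeEdges C B ≡ [] → V ≤ pathCopies h C) →
    (∀ {e} → e ∈ freeEdges C B → V ≤ gameValue h f m true C (e ∷ B)) → V ≤ gameValue h f (suc m) false C B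
  Blocker-≥ m C B p v with freeEdges C B
  ... | []      = p refl
  ... | e₀ ∷ es = min-≥ (λ e' → gameValue h f m true C (e' ∷ B)) e₀ es v

  -- The reply receives some free edge as a default, because Blocker has to move even when no move
  -- helps him.
  Blocker-≤ : ∀ {V} m (C B : List (Edge n)) → pathCopies h C ≤ V →
    (∀ {e} → e ∈ freeEdges C B → ∃[ e' ] (e' ∈ freeEdges C B × gameValue h f m true C (e' ∷ B) ≤ V)) →
    gameValue h f (suc m) false C B ≤ V
  Blocker-≤ m C B p v with freeEdges C B
  ... | []      = p
  ... | e₀ ∷ es with v {e₀} (here refl)
  ...   | e' , m' , le = min-≤ (λ e' → gameValue h f m true C (e' ∷ B)) e₀ es m' le

  -- Constructor's graph only grows. Once he has enough paths, the rest of the game is of no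
  -- concern.
  value-≥-copies : ∀ m turn (C B : List (Edge n)) → pathCopies h C ≤ gameValue h f m turn C B
  value-≥-copies zero    turn  C B = ≤-refl
  value-≥-copies (suc m) true  C B with filterᵇ (legal C) (freeEdges C B)
  ... | []      = ≤-refl
  ... | e₀ ∷ es = max-≥ (λ e' → gameValue h f m false (e' ∷ C) B) e₀ es (here refl)
                    (≤-trans (copies-mono h C e₀) (value-≥-copies m false (e₀ ∷ C) B))
  value-≥-copies (suc m) false C B = Blocker-≥ m C B (λ _ → ≤-refl) (λ {e} _ → value-≥-copies m true C (e ∷ B))

-- Adjacency and degrees after one claim.

Ext-same : ∀ {n} {A A' : Rel n} {s t u v} → Ext A A' s t → ¬ (u ≡ s × v ≡ t) → ¬ (u ≡ t × v ≡ s) → A' u v ≡ A u v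
Ext-same {A = A} {A'} {s} {t} {u} {v} X p q with bool (A u v) | bool (A' u v)
... | inj₁ h | _ = trans (Ext.old X h) (sym h)
... | inj₂ h | inj₂ k = trans k (sym h)
... | inj₂ h | inj₁ k with Ext.inv X k
...   | inj₁ a = ⊥-elim (true≢false a h)
...   | inj₂ (inj₁ a) = ⊥-elim (p a)
...   | inj₂ (inj₂ a) = ⊥-elim (q a)

Ext-degree : ∀ {n} {A A' : Rel n} {s t} → Ext A A' s t → A s t ≡ false → s ≢ t → degree A' s ≡ suc (degree A s)
Ext-degree {n} {A} {A'} {s} {t} X st s≢t = trans (≤-antisym upper lower) (+-comm (degree A s) 1)
  where
  upper : degree A' s ≤ degree A s + 1
  upper = sum-mono-except t 1
    (λ z z≢t → ≤-reflexive (cong 𝟙 (Ext-same X (z≢t ∘ proj₂) (s≢t ∘ proj₁))))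
    (≤-trans (𝟙≤1 (A' s t)) (m≤n+m 1 _))
  lower : degree A s + 1 ≤ degree A' s
  lower = sum-mono-gain t 1 (λ z → 𝟙-mono (Ext.old X))
    (≤-reflexive (trans (cong (λ b → 𝟙 b + 1) st) (cong 𝟙 (sym (Ext.new X)))))

Ext-degree-other : ∀ {n} {A A' : Rel n} {s t v} → Ext A A' s t → v ≢ s → v ≢ t → degree A' v ≡ degree A v
Ext-degree-other {n} X v≢s v≢t = sum-cong-≗ {n} (λ z → cong 𝟙 (Ext-same X (v≢s ∘ proj₁) (v≢t ∘ proj₁)))

-- Constructor's strategy

-- By `touch` and `apart`, a vertex other than the centres has at most one edge, and this edge goes
-- to a centre.
record DoubleStar {n : ℕ} (C : List (Edge n)) (x y : Fin n) : Set where
  field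
    loopless : Loopless C
    centre   : adj C x y ≡ true
    touch    : ∀ u v → adj C u v ≡ true → (u ≡ x ⊎ u ≡ y) ⊎ (v ≡ x ⊎ v ≡ y)
    apart    : ∀ z → adj C x z ≡ true → adj C y z ≡ true → ⊥

  x≢y : x ≢ y
  x≢y = loopless centre

Quad : Set
Quad = Bool × Bool × Bool × Bool

-- Twice the number of leaves that the vertex is still worth to a player who answers every block at once.
worth : Quad → ℕ
worth (true  , _     , _     , _)     = 2
worth (false , true  , _     , _)     = 2
worth (false , false , true  , true)  = 0
worth (false , false , true  , false) = 1
worth (false , false , false , true)  = 1
worth (false , false , false , false) = 2

worth-comm : ∀ a b c d → worth (a , b , c , d) ≡ worth (b , a , d , c)
worth-comm true  true  c d = refl
worth-comm true  false c d = refl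
worth-comm false true  c d = refl
worth-comm false false true  true  = refl
worth-comm false false true  false = refl
worth-comm false false false true  = refl
worth-comm false false false false = refl

worth-block-x : ∀ a b c c' d → worth (a , b , c , d) ≤ worth (a , b , c' , d) + 1
worth-block-x true  b     c     c' d     = m≤m+n 2 1
worth-block-x false true  c     c' d     = m≤m+n 2 1
worth-block-x false false true  c' true  = z≤n
worth-block-x false false true  c' false = m≤n+m 1 _
worth-block-x false false false c' true  = m≤n+m 1 _
worth-block-x false false false true  false = ≤-refl
worth-block-x false false false false false = m≤m+n 2 1

worth-block-y : ∀ a b c d d' → worth (a , b , c , d) ≤ worth (a , b , c , d') + 1
worth-block-y a b c d d' = subst₂ (λ p q → p ≤ q + 1) (worth-comm b a d c) (worth-comm b a d' c) (worth-block-x b a d d' c)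

module _ {n : ℕ} where

  swap-star : ∀ {C : List (Edge n)} {x y} → DoubleStar C x y → DoubleStar C y x
  swap-star {C} {x} {y} D = record
    { loopless = λ {u} {v} → DoubleStar.loopless D {u} {v}
    ; centre   = adj-sym C {x} {y} (DoubleStar.centre D)
    ; touch    = λ u v h → flip₂ (DoubleStar.touch D u v h)
    ; apart    = λ z p q → DoubleStar.apart D z q p }
    where
    flip₁ : ∀ {A B : Set} → A ⊎ B → B ⊎ A
    flip₁ (inj₁ a) = inj₂ a
    flip₁ (inj₂ b) = inj₁ b
    flip₂ : ∀ {A B A' B' : Set} → (A ⊎ B) ⊎ (A' ⊎ B') → (B ⊎ A) ⊎ (B' ⊎ A')
    flip₂ (inj₁ p) = inj₁ (flip₁ p)
    flip₂ (inj₂ p) = inj₂ (flip₁ p)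

  -- Every edge contains a centre. If `c` is a centre, then ab and de contain two further ones,
  -- which is one too many. Otherwise `b` and `d` are the two centres and `c` is a common neighbour.
  star-P₅-free : ∀ {C : List (Edge n)} {x y} (D : DoubleStar C x y) → P₅-free (graph C (DoubleStar.loopless D))
  star-P₅-free {C} {x} {y} D {a} {b} {c} {d} {e} ab bc cd de a≢c a≢d a≢e b≢d b≢e c≢e = go (c F.≟ x) (c F.≟ y)
    where
    open DoubleStar D
    In : Fin n → Set
    In v = v ≡ x ⊎ v ≡ y
    three : ∀ {u v w} → In u → In v → In w → u ≢ v → u ≢ w → v ≢ w → ⊥
    three (inj₁ refl) (inj₁ refl) _           p _ _ = p refl
    three (inj₁ refl) (inj₂ refl) (inj₁ refl) _ q _ = q refl
    three (inj₁ refl) (inj₂ refl) (inj₂ refl) _ _ r = r refl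
    three (inj₂ refl) (inj₂ refl) _           p _ _ = p refl
    three (inj₂ refl) (inj₁ refl) (inj₂ refl) _ q _ = q refl
    three (inj₂ refl) (inj₁ refl) (inj₁ refl) _ _ r = r refl
    middle : In c → ⊥
    middle ic with touch a b ab | touch d e de
    ... | inj₁ ia | inj₁ id = three ia ic id a≢c a≢d (loopless {c} {d} cd)
    ... | inj₁ ia | inj₂ ie = three ia ic ie a≢c a≢e c≢e
    ... | inj₂ ib | inj₁ id = three ib ic id (loopless {b} {c} bc) b≢d (loopless {c} {d} cd)
    ... | inj₂ ib | inj₂ ie = three ib ic ie (loopless {b} {c} bc) b≢e c≢e
    sides : In b → In d → ⊥
    sides (inj₁ refl) (inj₁ refl) = b≢d refl
    sides (inj₂ refl) (inj₂ refl) = b≢d refl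
    sides (inj₁ refl) (inj₂ refl) = apart c bc (adj-sym C {c} {d} cd)
    sides (inj₂ refl) (inj₁ refl) = apart c (adj-sym C {c} {d} cd) bc
    go : Dec (c ≡ x) → Dec (c ≡ y) → ⊥
    go (yes p) _ = middle (inj₁ p)
    go (no _) (yes q) = middle (inj₂ q)
    go (no p) (no q) with touch b c bc | touch c d cd
    ... | inj₁ ib | inj₂ id = sides ib id
    ... | inj₂ (inj₁ r) | _ = p r
    ... | inj₂ (inj₂ r) | _ = q r
    ... | inj₁ _ | inj₁ (inj₁ r) = p r
    ... | inj₁ _ | inj₁ (inj₂ r) = q r

  -- The degree of a centre includes the edge to the other centre, hence `∸ 1`. Both directions of
  -- the middle edge are counted, to match `twice-copies`.
  star-copies : ∀ {C : List (Edge n)} {x y} → DoubleStar C x y →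
    (degree (adj C) x ∸ 1) * (degree (adj C) y ∸ 1) ≤ pathCopies 4 C
  star-copies {C} {x} {y} D = *-cancelˡ-≤ 2 (begin
    2 * (dx * dy)                               ≤⟨ *-monoʳ-≤ 2 (*-mono-≤ (∸-monoˡ-≤ 1 (drop x y)) (∸-monoˡ-≤ 1 (drop y x))) ⟩
    2 * ((r x y + 1 ∸ 1) * (r y x + 1 ∸ 1))     ≡⟨ cong₂ (λ p q → 2 * (p * q)) (m+n∸n≡m (r x y) 1) (m+n∸n≡m (r y x) 1) ⟩
    2 * (r x y * r y x)                         ≡⟨ two (r x y) (r y x) ⟩
    r x y * r y x + (r y x * r x y + 0)         ≤⟨ +-mono-≤ (inner D) (+-monoˡ-≤ 0 (inner (swap-star D))) ⟩
    w x y + (w y x + 0)                         ≤⟨ +-mono-≤ (sum-term (w x) y) (+-monoˡ-≤ 0 (sum-term (w y) x)) ⟩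
    sumOver (λ u → sum (w u)) (x ∷ y ∷ [])      ≤⟨ sumOver-≤ (λ u → sum (w u)) (x ∷ y ∷ []) (cong (λ b → not (b ∨ false) ∧ true) (eqF-≢ (DoubleStar.x≢y D))) ⟩
    sum (λ u → sum (w u))                       ≡⟨ sym regroup ⟩
    sum₄ (λ a u v d → 𝟙 (path₄ C a u v d))      ≡⟨ sym (twice-copies C (DoubleStar.loopless D)) ⟩
    2 * pathCopies 4 C                          ∎)
    where
    open ≤-Reasoning
    dx = degree (adj C) x ∸ 1
    dy = degree (adj C) y ∸ 1
    side : Fin n → Fin n → Fin n → Bool
    side u v a = adj C u a ∧ not (eqF a v)
    r : Fin n → Fin n → ℕ
    r u v = sum (λ a → 𝟙 (side u v a))
    w : Fin n → Fin n → ℕ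
    w u v = sum (λ a → sum (λ d → 𝟙 (path₄ C a u v d)))
    two : ∀ p q → 2 * (p * q) ≡ p * q + (q * p + 0)
    two = solve-∀
    drop : ∀ u v → degree (adj C) u ≤ r u v + 1
    drop u v = sum-mono-except v 1 (λ a a≢v → 𝟙-mono (λ h → cong₂ _∧_ h (cong not (eqF-≢ a≢v))))
      (≤-trans (𝟙≤1 (adj C u v)) (m≤n+m 1 _))
    regroup : sum₄ (λ a u v d → 𝟙 (path₄ C a u v d)) ≡ sum (λ u → sum (w u))
    regroup = trans (∑-comm {n} {n} (λ a u → sum (λ v → sum (λ d → 𝟙 (path₄ C a u v d)))))
      (sum-cong-≗ {n} (λ u → ∑-comm {n} {n} (λ a v → sum (λ d → 𝟙 (path₄ C a u v d)))))
    inner : ∀ {u v} → DoubleStar C u v → r u v * r v u ≤ w u v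
    inner {u} {v} D' = begin
      r u v * r v u
        ≡⟨ trans (*-distribʳ-sum (r v u) (λ a → 𝟙 (side u v a))) (sum-cong-≗ {n} (λ a → *-distribˡ-sum (𝟙 (side u v a)) (λ d → 𝟙 (side v u d)))) ⟩
      sum (λ a → sum (λ d → 𝟙 (side u v a) * 𝟙 (side v u d)))
        ≤⟨ sum-mono (λ a → sum-mono (λ d → ≤-trans (≤-reflexive (sym (𝟙-∧ (side u v a) (side v u d)))) (𝟙-mono (onPath a d)))) ⟩
      w u v ∎
      where
      onPath : ∀ a d → side u v a ∧ side v u d ≡ true → path₄ C a u v d ≡ true
      onPath a d h with ∧-true {side u v a} h
      ... | p , q with ∧-true {adj C u a} p | ∧-true {adj C v d} q
      ...   | ua , a≢v | vd , d≢u = path₄-intro C {a} {u} {v} {d} (DoubleStar.loopless D') (adj-sym C {u} {a} ua) (DoubleStar.centre D') vd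
              (eqF-false (not-true a≢v)) (λ { refl → DoubleStar.apart D' a ua vd }) (eqF-false (not-true d≢u) ∘ sym)

  quad : (C B : List (Edge n)) → Fin n → Fin n → Fin n → Quad
  quad C B x y z = adj C x z , adj C y z , adj B x z , adj B y z

  total : (C B : List (Edge n)) → Fin n → Fin n → ℕ
  total C B x y = sum (λ z → worth (quad C B x y z))

  total-comm : ∀ C B x y → total C B x y ≡ total C B y x
  total-comm C B x y = sum-cong-≗ {n} (λ z → worth-comm (adj C x z) (adj C y z) (adj B x z) (adj B y z))

  module _ {C : List (Edge n)} {x y : Fin n} (D : DoubleStar C x y) where
    open DoubleStar D

    not-centre : ∀ {z} → adj C x z ≡ false → adj C y z ≡ false → z ≢ x × z ≢ y
    not-centre xz yz = (λ { refl → true≢false (adj-sym C {x} {y} centre) yz }) , (λ { refl → true≢false centre xz })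

    -- Only one vertex can lose worth, the end of the new edge away from the centres, and it loses
    -- nothing if it is already attached.
    total-block : ∀ {B B' : List (Edge n)} {s t} → Ext (adj B) (adj B') s t → total C B x y ≤ total C B' x y + 1
    total-block {B} {B'} {s} {t} X = go (s F.≟ x) (s F.≟ y)
      where
      Attached : Fin n → Set
      Attached z = worth (quad C B x y z) ≡ 2 × worth (quad C B' x y z) ≡ 2
      -- The centres belong to the first case, being attached to each other.
      split : ∀ z → Attached z ⊎ (z ≢ x × z ≢ y)
      split z with bool (adj C x z) | bool (adj C y z)
      ... | inj₁ h | _ rewrite h = inj₁ (refl , refl)
      ... | inj₂ h | inj₁ k rewrite h | k = inj₁ (refl , refl)
      ... | inj₂ h | inj₂ k = inj₂ (not-centre h k)
      same : ∀ z → adj B' x z ≡ adj B x z → adj B' y z ≡ adj B y z → worth (quad C B x y z) ≤ worth (quad C B' x y z)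
      same z p q = ≤-reflexive (cong₂ (λ b c → worth (adj C x z , adj C y z , b , c)) (sym p) (sym q))
      by-x : ∀ z → adj B' y z ≡ adj B y z → worth (quad C B x y z) ≤ worth (quad C B' x y z) + 1
      by-x z q = ≤-trans (worth-block-x (adj C x z) (adj C y z) (adj B x z) (adj B' x z) (adj B y z))
        (≤-reflexive (cong (λ c → worth (adj C x z , adj C y z , adj B' x z , c) + 1) (sym q)))
      by-y : ∀ z → adj B' x z ≡ adj B x z → worth (quad C B x y z) ≤ worth (quad C B' x y z) + 1
      by-y z p = ≤-trans (worth-block-y (adj C x z) (adj C y z) (adj B x z) (adj B y z) (adj B' y z))
        (≤-reflexive (cong (λ b → worth (adj C x z , adj C y z , b , adj B' y z) + 1) (sym p)))
      attached-≤ : ∀ {z} → Attached z → worth (quad C B x y z) ≤ worth (quad C B' x y z)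
      attached-≤ (p , q) = ≤-reflexive (trans p (sym q))
      around : ∀ v → (∀ z → z ≢ x → z ≢ y → z ≢ v → ∀ c → c ≡ x ⊎ c ≡ y → adj B' c z ≡ adj B c z) →
        (v ≢ x → v ≢ y → (adj B' y v ≡ adj B y v) ⊎ (adj B' x v ≡ adj B x v)) → total C B x y ≤ total C B' x y + 1
      around v off at = sum-mono-except v 1 away here'
        where
        away : ∀ z → z ≢ v → worth (quad C B x y z) ≤ worth (quad C B' x y z)
        away z z≢v with split z
        ... | inj₁ p = attached-≤ p
        ... | inj₂ (p , q) = same z (off z p q z≢v x (inj₁ refl)) (off z p q z≢v y (inj₂ refl))
        here' : worth (quad C B x y v) ≤ worth (quad C B' x y v) + 1
        here' with split v
        ... | inj₁ p = ≤-trans (attached-≤ p) (m≤m+n _ 1)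
        ... | inj₂ (p , q) with at p q
        ...   | inj₁ r = by-x v r
        ...   | inj₂ r = by-y v r
      go : Dec (s ≡ x) → Dec (s ≡ y) → total C B x y ≤ total C B' x y + 1
      go (yes refl) _ = around t
        (λ { z z≢x z≢y z≢t c _ → Ext-same {u = c} {v = z} X (z≢t ∘ proj₂) (z≢x ∘ proj₂) })
        (λ t≢x t≢y → inj₁ (Ext-same X (x≢y ∘ sym ∘ proj₁) (t≢x ∘ proj₂)))
      go (no _) (yes refl) = around t
        (λ { z z≢x z≢y z≢t c _ → Ext-same {u = c} {v = z} X (z≢t ∘ proj₂) (z≢y ∘ proj₂) })
        (λ t≢x t≢y → inj₂ (Ext-same X (x≢y ∘ proj₁) (t≢y ∘ proj₂)))
      go (no s≢x) (no s≢y) = around s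
        (λ { z z≢x z≢y z≢s c (inj₁ refl) → Ext-same X (s≢x ∘ sym ∘ proj₁) (z≢s ∘ proj₂)
           ; z z≢x z≢y z≢s c (inj₂ refl) → Ext-same X (s≢y ∘ sym ∘ proj₁) (z≢s ∘ proj₂) })
        (λ _ _ → at (t F.≟ x))
        where
        at : Dec (t ≡ x) → (adj B' y s ≡ adj B y s) ⊎ (adj B' x s ≡ adj B x s)
        at (yes refl) = inj₁ (Ext-same X (s≢y ∘ sym ∘ proj₁) (x≢y ∘ sym ∘ proj₁))
        at (no t≢x)   = inj₂ (Ext-same X (s≢x ∘ sym ∘ proj₁) (t≢x ∘ sym ∘ proj₁))

    record Attached (B : List (Edge n)) (gain : ℕ) : Set where
      field
        e      : Edge n
        isfree : e ∈ freeEdges C B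
        legal  : containsPath 5 (e ∷ C) ≡ false
        star   : DoubleStar (e ∷ C) x y
        deg-x  : degree (adj (e ∷ C)) x ≡ suc (degree (adj C) x)
        deg-y  : degree (adj (e ∷ C)) y ≡ degree (adj C) y
        worth≥ : total C B x y + gain ≤ total (e ∷ C) B x y

    -- A vertex blocked towards `y` has worth 1 and becomes a leaf of worth 2. This gain makes up
    -- for one move of Blocker; attaching an untouched vertex gains nothing.
    attach : ∀ {B z} → adj C x z ≡ false → adj C y z ≡ false → adj B x z ≡ false → Attached B (𝟙 (adj B y z))
    attach {B} {z} xz yz bxz = record
      { e = e ; isfree = FreeEdge.isfree fe ; legal = containsPath-of-free (DoubleStar.loopless star) (star-P₅-free star) ; star = star
      ; deg-x = Ext-degree X xz x≢z
      ; deg-y = Ext-degree-other X (x≢y ∘ sym) (z≢y ∘ sym)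
      ; worth≥ = sum-mono-gain z (𝟙 (adj B y z)) grow gain }
      where
      z≢x = proj₁ (not-centre xz yz)
      z≢y = proj₂ (not-centre xz yz)
      x≢z : x ≢ z
      x≢z = z≢x ∘ sym
      fe : FreeEdge C B x z
      fe = free-intro C B x≢z xz bxz
      e = FreeEdge.e fe
      C' = e ∷ C
      X : Ext (adj C) (adj C') x z
      X = FreeEdge.ext fe C
      isolated : ∀ v → adj C z v ≡ true → ⊥
      isolated v zv with touch z v zv
      ... | inj₁ (inj₁ p) = z≢x p
      ... | inj₁ (inj₂ p) = z≢y p
      ... | inj₂ (inj₁ refl) = true≢false (adj-sym C {z} {v} zv) xz
      ... | inj₂ (inj₂ refl) = true≢false (adj-sym C {z} {v} zv) yz
      star : DoubleStar C' x y
      star = record { loopless = λ {u} {v} → ll {u} {v} ; centre = Ext.old X {x} {y} centre ; touch = touch' ; apart = apart' }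
        where
        ll : Loopless C'
        ll {u} {v} h with Ext.inv X {u} {v} h
        ... | inj₁ p = loopless {u} {v} p
        ... | inj₂ (inj₁ (refl , refl)) = x≢z
        ... | inj₂ (inj₂ (refl , refl)) = z≢x
        touch' : ∀ u v → adj C' u v ≡ true → (u ≡ x ⊎ u ≡ y) ⊎ (v ≡ x ⊎ v ≡ y)
        touch' u v h with Ext.inv X {u} {v} h
        ... | inj₁ p = touch u v p
        ... | inj₂ (inj₁ (p , _)) = inj₁ (inj₁ p)
        ... | inj₂ (inj₂ (_ , p)) = inj₂ (inj₁ p)
        apart' : ∀ v → adj C' x v ≡ true → adj C' y v ≡ true → ⊥
        apart' v h k with Ext.inv X {x} {v} h | Ext.inv X {y} {v} k
        ... | inj₁ p | inj₁ q = apart v p q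
        ... | _ | inj₂ (inj₁ (y≡x , _)) = x≢y (sym y≡x)
        ... | _ | inj₂ (inj₂ (y≡z , _)) = z≢y (sym y≡z)
        ... | inj₂ (inj₁ (_ , refl)) | inj₁ q = true≢false q yz
        ... | inj₂ (inj₂ (x≡z , _)) | inj₁ q = x≢z x≡z
      worth-top : ∀ a b c d → worth (a , b , c , d) ≤ 2
      worth-top true  b     c     d     = ≤-refl
      worth-top false true  c     d     = ≤-refl
      worth-top false false true  true  = z≤n
      worth-top false false true  false = s≤s z≤n
      worth-top false false false true  = s≤s z≤n
      worth-top false false false false = ≤-refl
      attached : ∀ {a b c d} → a ≡ true ⊎ b ≡ true → 2 ≤ worth (a , b , c , d)
      attached (inj₁ refl) = ≤-refl
      attached {true} (inj₂ refl) = ≤-refl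
      attached {false} (inj₂ refl) = ≤-refl
      grow : ∀ v → worth (quad C B x y v) ≤ worth (quad C' B x y v)
      grow v with bool (adj C' x v) | bool (adj C' y v)
      ... | inj₁ h | _ = ≤-trans (worth-top (adj C x v) (adj C y v) (adj B x v) (adj B y v)) (attached {adj C' x v} {adj C' y v} {adj B x v} {adj B y v} (inj₁ h))
      ... | inj₂ _ | inj₁ h = ≤-trans (worth-top (adj C x v) (adj C y v) (adj B x v) (adj B y v)) (attached {adj C' x v} {adj C' y v} {adj B x v} {adj B y v} (inj₂ h))
      ... | inj₂ h | inj₂ k = ≤-reflexive (cong₂ (λ a b → worth (a , b , adj B x v , adj B y v)) (trans (back x h) (sym h)) (trans (back y k) (sym k)))
        where
        back : ∀ u → adj C' u v ≡ false → adj C u v ≡ false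
        back u h = ¬true⇒false (λ p → true≢false (Ext.old X {u} {v} p) h)
      gain : worth (quad C B x y z) + 𝟙 (adj B y z) ≤ worth (quad C' B x y z)
      gain = ≤-trans (before (adj B y z)) (attached {adj C' x z} {adj C' y z} {adj B x z} {adj B y z} (inj₁ (Ext.new X)))
        where
        before : ∀ b → worth (adj C x z , adj C y z , adj B x z , b) + 𝟙 b ≤ 2
        before b rewrite xz | yz | bxz with b
        ... | true  = ≤-refl
        ... | false = ≤-refl

  quad? : ∀ (C B : List (Edge n)) x y (t : Quad) → Dec (∃[ z ] quad C B x y z ≡ t)
  quad? C B x y t = FP.any? (λ z → ≡-dec Data.Bool._≟_ (≡-dec Data.Bool._≟_ (≡-dec Data.Bool._≟_ Data.Bool._≟_)) (quad C B x y z) t)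

  quad-parts : ∀ (C B : List (Edge n)) x y z {a b c d} → quad C B x y z ≡ (a , b , c , d) →
    adj C x z ≡ a × adj C y z ≡ b × adj B x z ≡ c × adj B y z ≡ d
  quad-parts C B x y z h =
    cong proj₁ h , cong (proj₁ ∘ proj₂) h , cong (proj₁ ∘ proj₂ ∘ proj₂) h , cong (proj₂ ∘ proj₂ ∘ proj₂) h

2*≤⇒≤ : ∀ {a b} → 2 * a ≤ 2 * b + 1 → a ≤ b
2*≤⇒≤ {a} {b} h with a ≤? b
... | yes p = p
... | no ¬p = ⊥-elim (<-irrefl refl (≤-trans (cert (suc (2 * b + 1)) (2 * a) 0 (times 2 (≰⇒> ¬p)) (arith a b)) h))
  where
  arith : ∀ a b → suc (2 * b + 1) + 2 * a + 0 ≡ 2 * a + 2 * suc b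
  arith = solve-∀

-- Constructor's moves and the phases of his play.

module Constructor {n : ℕ} {V : ℕ} where

  private
    deg : List (Edge n) → Fin n → ℕ
    deg C = degree (adj C)

  -- `P` is the invariant before Constructor's move, `Q` the one before Blocker's. Without free
  -- edges `step` can only return the bound for the score, so final positions need no separate
  -- treatment; `weaken` covers those in which Blocker should move.
  play-≥ : (P Q : List (Edge n) → List (Edge n) → Set) →
    (∀ C B → P C B → (∃[ e ] (e ∈ freeEdges C B × containsPath 5 (e ∷ C) ≡ false × Q (e ∷ C) B)) ⊎ V ≤ pathCopies 4 C) →
    (∀ {C B} → Q C B → P C B) →
    (∀ {C B e} → e ∈ freeEdges C B → Q C B → P C (e ∷ B)) →
    ∀ fuel C B → length (freeEdges C B) ≤ fuel → P C B → V ≤ gameValue 4 5 fuel true C B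
  play-≥ P Q step weaken reply = turnC
    where
    terminal : ∀ C B → length (freeEdges C B) ≤ 0 → P C B → V ≤ pathCopies 4 C
    terminal C B len i with step C B i
    ... | inj₂ v = v
    ... | inj₁ (e , m , _) = ⊥-elim (<⇒≱ (free-shrink-C C B m) (≤-trans len z≤n))
    turnC : ∀ fuel C B → length (freeEdges C B) ≤ fuel → P C B → V ≤ gameValue 4 5 fuel true C B
    turnB : ∀ fuel C B → length (freeEdges C B) ≤ fuel → Q C B → V ≤ gameValue 4 5 fuel false C B
    turnC zero       C B len i = terminal C B len i
    turnC (suc fuel) C B len i with step C B i
    ... | inj₂ v = ≤-trans v (value-≥-copies 4 5 (suc fuel) true C B)
    ... | inj₁ (e , m , legal , j) = Constructor-≥ 4 5 fuel C B m legal
            (turnB fuel (e ∷ C) B (≤-pred (≤-trans (free-shrink-C C B m) len)) j)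
    turnB zero       C B len j = terminal C B len (weaken j)
    turnB (suc fuel) C B len j = Blocker-≥ 4 5 fuel C B
      (λ none → terminal C B (≤-reflexive (cong length none)) (weaken j))
      (λ {e} m → turnC fuel C (e ∷ B) (≤-pred (≤-trans (free-shrink-B C B m) len)) (reply m j))

  record Found (C B : List (Edge n)) (x y : Fin n) (K : ℕ) : Set where
    field
      e      : Edge n
      isfree : e ∈ freeEdges C B
      legal  : containsPath 5 (e ∷ C) ≡ false
      star   : DoubleStar (e ∷ C) x y
      grown  : (deg (e ∷ C) x ≡ suc (deg C x) × deg (e ∷ C) y ≡ deg C y)
             ⊎ (deg (e ∷ C) x ≡ deg C x × deg (e ∷ C) y ≡ suc (deg C y))
      worth≥ : 2 * K ≤ total (e ∷ C) B x y

  -- If no vertex is half-blocked, the total is even, so that the slack of 1 in the hypothesis is lost nowhere.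
  answer : ∀ {C B x y} K → DoubleStar C x y → 2 * K ≤ total C B x y + 1 → Found C B x y K ⊎ K ≤ deg C x + deg C y
  answer {C} {B} {x} {y} K D h
    with quad? C B x y (false , false , false , true) | quad? C B x y (false , false , true , false) | quad? C B x y (false , false , false , false)
  ... | yes (z , q) | _ | _ with quad-parts C B x y z q
  ...   | xz , yz , bx , by = inj₁ (record { e = Attached.e a ; isfree = Attached.isfree a ; legal = Attached.legal a ; star = Attached.star a
        ; grown = inj₁ (Attached.deg-x a , Attached.deg-y a)
        ; worth≥ = ≤-trans h (subst (λ b → total C B x y + 𝟙 b ≤ total (Attached.e a ∷ C) B x y) by (Attached.worth≥ a)) })
    where a = attach D {B} {z} xz yz bx
  answer {C} {B} {x} {y} K D h | no _ | yes (z , q) | _ with quad-parts C B x y z q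
  ...   | xz , yz , bx , by = inj₁ (record { e = Attached.e a ; isfree = Attached.isfree a ; legal = Attached.legal a ; star = swap-star (Attached.star a)
        ; grown = inj₂ (Attached.deg-y a , Attached.deg-x a)
        ; worth≥ = ≤-trans h (subst₂ (λ s t → s + 1 ≤ t) (total-comm C B y x) (total-comm (Attached.e a ∷ C) B y x)
            (subst (λ b → total C B y x + 𝟙 b ≤ total (Attached.e a ∷ C) B y x) bx (Attached.worth≥ a))) })
    where a = attach (swap-star D) {B} {z} yz xz by
  answer {C} {B} {x} {y} K D h | no ¬p₁ | no ¬p₂ | p₃ = last p₃
    where
    half : Quad → ℕ
    half (a , b , c , d) = if a ∨ b then 1 else (if c ∨ d then 0 else 1)
    even : ∀ {q} → q ≢ (false , false , false , true) → q ≢ (false , false , true , false) → worth q ≡ 2 * half q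
    even {true  , b     , c     , d}     _ _ = refl
    even {false , true  , c     , d}     _ _ = refl
    even {false , false , true  , true}  _ _ = refl
    even {false , false , true  , false} _ k = ⊥-elim (k refl)
    even {false , false , false , true}  k _ = ⊥-elim (k refl)
    even {false , false , false , false} _ _ = refl
    W = sum (λ z → half (quad C B x y z))
    total-even : total C B x y ≡ 2 * W
    total-even = trans (sum-cong-≗ {n} (λ z → even {quad C B x y z} (λ q → ¬p₁ (z , q)) (λ q → ¬p₂ (z , q))))
      (sym (*-distribˡ-sum 2 (λ z → half (quad C B x y z))))
    K≤W : K ≤ W
    K≤W = 2*≤⇒≤ (subst (λ t → 2 * K ≤ t + 1) total-even h)
    half-≤ : ∀ {q} → q ≢ (false , false , false , false) → q ≢ (false , false , false , true) → half q ≤ 𝟙 (proj₁ q) + 𝟙 (proj₁ (proj₂ q))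
    half-≤ {true  , b     , c     , d}     _ _ = s≤s z≤n
    half-≤ {false , true  , c     , d}     _ _ = s≤s z≤n
    half-≤ {false , false , true  , d}     _ _ = z≤n
    half-≤ {false , false , false , true}  _ k = ⊥-elim (k refl)
    half-≤ {false , false , false , false} k _ = ⊥-elim (k refl)
    last : Dec (∃[ z ] quad C B x y z ≡ (false , false , false , false)) → Found C B x y K ⊎ K ≤ deg C x + deg C y
    last (yes (z , q)) with quad-parts C B x y z q
    ... | xz , yz , bx , by = inj₁ (record { e = Attached.e a ; isfree = Attached.isfree a ; legal = Attached.legal a ; star = Attached.star a
        ; grown = inj₁ (Attached.deg-x a , Attached.deg-y a)
        ; worth≥ = ≤-trans (*-monoʳ-≤ 2 K≤W) (≤-trans (≤-reflexive (sym total-even)) (≤-trans (m≤m+n _ _) (Attached.worth≥ a))) })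
      where a = attach D {B} {z} xz yz bx
    -- Nothing can be attached any more, so every vertex that still counts is already adjacent to a
    -- centre.
    last (no ¬p₃) = inj₂ (≤-trans K≤W (≤-trans (sum-mono (λ z → half-≤ {quad C B x y z} (λ q → ¬p₃ (z , q)) (λ q → ¬p₁ (z , q)))) (≤-reflexive (∑-distrib-+ {n} _ _))))

  record FoundY (C B : List (Edge n)) (x y : Fin n) : Set where
    field
      e      : Edge n
      isfree : e ∈ freeEdges C B
      legal  : containsPath 5 (e ∷ C) ≡ false
      star   : DoubleStar (e ∷ C) x y
      deg-x  : deg (e ∷ C) x ≡ deg C x
      deg-y  : deg (e ∷ C) y ≡ suc (deg C y)
      worth≥ : total C B x y ≤ total (e ∷ C) B x y

  -- If nothing can be attached to `y`, each unattached vertex has lost its edge to `y` and is worth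
  -- at most 1, which makes the total small.
  extend-y : ∀ {C B x y} → DoubleStar C x y → FoundY C B x y ⊎ total C B x y ≤ deg C x + deg C y + n
  extend-y {C} {B} {x} {y} D = by-cases (quad? C B x y (false , false , true , false)) (quad? C B x y (false , false , false , false))
    where
    found : ∀ z → adj C x z ≡ false → adj C y z ≡ false → adj B y z ≡ false → FoundY C B x y
    found z xz yz by = record { e = Attached.e a ; isfree = Attached.isfree a ; legal = Attached.legal a ; star = swap-star (Attached.star a)
      ; deg-x = Attached.deg-y a ; deg-y = Attached.deg-x a
      ; worth≥ = subst₂ _≤_ (total-comm C B y x) (total-comm (Attached.e a ∷ C) B y x) (≤-trans (m≤m+n _ _) (Attached.worth≥ a)) }
      where a = attach (swap-star D) {B} {z} yz xz by
    low : ∀ {q} → q ≢ (false , false , true , false) → q ≢ (false , false , false , false) → worth q ≤ 𝟙 (proj₁ q) + 𝟙 (proj₁ (proj₂ q)) + 1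
    low {true  , b     , c     , d}     _ _ = s≤s (m≤n+m 1 _)
    low {false , true  , c     , d}     _ _ = ≤-refl
    low {false , false , true  , true}  _ _ = z≤n
    low {false , false , true  , false} k _ = ⊥-elim (k refl)
    low {false , false , false , true}  _ _ = ≤-refl
    low {false , false , false , false} _ k = ⊥-elim (k refl)
    by-cases : Dec (∃[ z ] quad C B x y z ≡ (false , false , true , false)) → Dec (∃[ z ] quad C B x y z ≡ (false , false , false , false)) →
      FoundY C B x y ⊎ total C B x y ≤ deg C x + deg C y + n
    by-cases (yes (z , q)) _ with quad-parts C B x y z q
    ... | xz , yz , _ , by = inj₁ (found z xz yz by)
    by-cases (no _) (yes (z , q)) with quad-parts C B x y z q
    ... | xz , yz , _ , by = inj₁ (found z xz yz by)
    by-cases (no ¬p) (no ¬q) = inj₂ (begin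
      sum (λ z → worth (quad C B x y z))                         ≤⟨ sum-mono (λ z → low {quad C B x y z} (λ q → ¬p (z , q)) (λ q → ¬q (z , q))) ⟩
      sum (λ z → 𝟙 (adj C x z) + 𝟙 (adj C y z) + 1)              ≡⟨ ∑-distrib-+ {n} (λ z → 𝟙 (adj C x z) + 𝟙 (adj C y z)) (λ _ → 1) ⟩
      sum (λ z → 𝟙 (adj C x z) + 𝟙 (adj C y z)) + sum {n} (λ _ → 1)  ≡⟨ cong₂ _+_ (∑-distrib-+ {n} (λ z → 𝟙 (adj C x z)) (λ z → 𝟙 (adj C y z))) (trans (sum-const n 1) (*-identityʳ n)) ⟩
      deg C x + deg C y + n                                      ∎)
      where open ≤-Reasoning

  -- `m` is the degree that each centre is to reach, and `K` the final sum of the two degrees. By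
  -- `target` the initial total 2n may drop by `m` and still be worth `K` edges; by `room` a centre
  -- of degree below `m` can always be served.
  module Strategy (m K : ℕ) (1≤m : 1 ≤ m) (target : 2 * K + m ≤ 2 * n) (room : 3 * m ≤ n)
    (product : ∀ a b → m ≤ a → m ≤ b → K ≤ a + b → V ≤ (a ∸ 1) * (b ∸ 1)) where

    -- The slack r is 1 when Constructor is to move and 0 when Blocker is.
    data Phase (r : ℕ) (C B : List (Edge n)) (x y : Fin n) : Set where
      both : 2 * n ≤ total C B x y + r → deg C x ≤ m → deg C y ≤ m → Phase r C B x y
      -- Blocker's move costs at most 1 of the total and Constructor's adds 1 to the degree of `y`.
      -- So at most `m` of the total is lost when `y` reaches degree `m`.
      one  : deg C x ≡ m → deg C y ≤ m → 2 * n ≤ total C B x y + deg C y + r → Phase r C B x y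
      pair : m ≤ deg C x → m ≤ deg C y → 2 * K ≤ total C B x y + r → Phase r C B x y

    data ToMove (C B : List (Edge n)) : Set where
      start  : C ≡ [] → B ≡ [] → ToMove C B
      inPlay : ∀ {x y} → DoubleStar C x y → Phase 1 C B x y → ToMove C B

    data Replied (C B : List (Edge n)) : Set where
      inPlay : ∀ {x y} → DoubleStar C x y → Phase 0 C B x y → Replied C B

    Move : List (Edge n) → List (Edge n) → Set
    Move C B = (∃[ e ] (e ∈ freeEdges C B × containsPath 5 (e ∷ C) ≡ false × Replied (e ∷ C) B)) ⊎ V ≤ pathCopies 4 C

    weaken : ∀ {C B} → Replied C B → ToMove C B
    weaken (inPlay D (both s a b)) = inPlay D (both (≤-trans s (+-monoʳ-≤ _ z≤n)) a b)
    weaken (inPlay D (one a b s))  = inPlay D (one a b (≤-trans s (+-monoʳ-≤ _ z≤n)))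
    weaken (inPlay D (pair a b s)) = inPlay D (pair a b (≤-trans s (+-monoʳ-≤ _ z≤n)))

    reply : ∀ {C B e} → e ∈ freeEdges C B → Replied C B → ToMove C (e ∷ B)
    reply {C} {B} {s , t} m (inPlay {x} {y} D ph) = inPlay D (lower ph)
      where
      drop : total C B x y ≤ total C ((s , t) ∷ B) x y + 1
      drop = total-block D {B} {(s , t) ∷ B} (cons-Ext B s t)
      lower : Phase 0 C B x y → Phase 1 C ((s , t) ∷ B) x y
      lower (both h a b) = both (≤-trans h (≤-trans (≤-reflexive (+-identityʳ _)) drop)) a b
      lower (one a b h)  = one a b (≤-trans h (cert _ _ 0 drop (arith (total C B x y) (total C ((s , t) ∷ B) x y) (deg C y))))
        where
        arith : ∀ p q d → p + d + 0 + (q + 1) + 0 ≡ q + d + 1 + p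
        arith = solve-∀
      lower (pair a b h) = pair a b (≤-trans h (≤-trans (≤-reflexive (+-identityʳ _)) drop))

    pairing : ∀ {C B x y} → DoubleStar C x y → m ≤ deg C x → m ≤ deg C y → 2 * K ≤ total C B x y + 1 → Move C B
    pairing {C} {B} {x} {y} D a b h with answer {B = B} K D h
    ... | inj₂ big  = inj₂ (≤-trans (product _ _ a b big) (star-copies D))
    ... | inj₁ f = inj₁ (Found.e f , Found.isfree f , Found.legal f , inPlay (Found.star f)
            (pair (proj₁ bounds) (proj₂ bounds) (≤-trans (Found.worth≥ f) (m≤m+n _ 0))))
      where
      bounds : m ≤ deg (Found.e f ∷ C) x × m ≤ deg (Found.e f ∷ C) y
      bounds with Found.grown f
      ... | inj₁ (p , q) rewrite p | q = m≤n⇒m≤1+n a , b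
      ... | inj₂ (p , q) rewrite p | q = a , m≤n⇒m≤1+n b

    second : ∀ {C B x y} → DoubleStar C x y → deg C x ≡ m → deg C y ≤ m → 2 * n ≤ total C B x y + deg C y + 1 → Move C B
    second {C} {B} {x} {y} D a b h with deg C y ≟ m
    ... | yes refl = pairing D (≤-reflexive (sym a)) ≤-refl
            (cert _ _ 0 (h ⊹ target) (arith K (total C B x y) (deg C y) n))
      where
      arith : ∀ K t d n → 2 * K + (t + d + 1 + 2 * n) + 0 ≡ t + 1 + (2 * n + (2 * K + d))
      arith = solve-∀
    ... | no b≢m with extend-y {B = B} D
    ...   | inj₁ f = inj₁ (FoundY.e f , FoundY.isfree f , FoundY.legal f , inPlay (FoundY.star f)
              (one (trans (FoundY.deg-x f) a) (≤-trans (≤-reflexive (FoundY.deg-y f)) (≤∧≢⇒< b b≢m))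
                (≤-trans h (≤-trans (+-monoˡ-≤ 1 (+-monoˡ-≤ (deg C y) (FoundY.worth≥ f)))
                  (≤-reflexive (trans (arith (total (FoundY.e f ∷ C) B x y) (deg C y)) (cong (λ d → total (FoundY.e f ∷ C) B x y + d + 0) (sym (FoundY.deg-y f)))))))))
      where
      arith : ∀ t d → t + d + 1 ≡ t + suc d + 0
      arith = solve-∀
    -- Here 2n ≤ total + deg y + 1 ≤ m + 2 deg y + n + 1, which is less than 3m + n since deg y < m,
    -- against `room`.
    ...   | inj₂ few = ⊥-elim (<-irrefl refl (≤-trans (cert (suc n) n 0
              (h ⊹ few ⊹ ≤-reflexive a ⊹ times 2 (≤∧≢⇒< b b≢m) ⊹ room) (arith n (total C B x y) (deg C x) (deg C y) m)) ≤-refl))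
      where
      arith : ∀ n t p q m → suc n + (t + q + 1 + (p + q + n) + m + 2 * m + n) + 0 ≡ n + (2 * n + t + p + 2 * suc q + 3 * m)
      arith = solve-∀

    first : ∀ {C B x y} → DoubleStar C x y → 2 * n ≤ total C B x y + 1 → deg C x ≤ m → deg C y ≤ m → Move C B
    first {C} {B} {x} {y} D h a b with deg C x ≟ m | deg C y ≟ m
    ... | yes p | _ = second D p b (≤-trans h (+-monoˡ-≤ 1 (m≤m+n _ _)))
    ... | no _ | yes q = second (swap-star D) q a
            (≤-trans h (+-monoˡ-≤ 1 (≤-trans (≤-reflexive (total-comm C B x y)) (m≤m+n _ _))))
    -- With `n` in place of `K` nothing of the total is given up. The second outcome would require
    -- degrees of sum `n`, but both are below `m`.
    ... | no p | no q with answer {B = B} n D h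
    ...   | inj₁ f = inj₁ (Found.e f , Found.isfree f , Found.legal f , inPlay (Found.star f)
              (both (≤-trans (Found.worth≥ f) (m≤m+n _ 0)) (proj₁ bounds) (proj₂ bounds)))
      where
      bounds : deg (Found.e f ∷ C) x ≤ m × deg (Found.e f ∷ C) y ≤ m
      bounds with Found.grown f
      ... | inj₁ (r , s) rewrite r | s = ≤∧≢⇒< a p , b
      ... | inj₂ (r , s) rewrite r | s = a , ≤∧≢⇒< b q
    ...   | inj₂ large = ⊥-elim (<-irrefl refl (≤-trans (cert (suc n) n (m + 1) (large ⊹ ≤∧≢⇒< a p ⊹ ≤∧≢⇒< b q ⊹ room)
              (arith n (deg C x) (deg C y) m)) ≤-refl))
      where
      arith : ∀ n p q m → suc n + (p + q + m + m + n) + (m + 1) ≡ n + (n + suc p + suc q + 3 * m)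
      arith = solve-∀

    opening : ∀ {u v : Fin n} → u ≢ v → Move [] []
    opening {u} {v} u≢v = inj₁ (e , FreeEdge.isfree fe , containsPath-of-free (DoubleStar.loopless star) (star-P₅-free star)
        , inPlay star (both full (≤-trans (≤-reflexive deg-u) 1≤m) (≤-trans (≤-reflexive deg-v) 1≤m)))
      where
      fe : FreeEdge [] [] u v
      fe = free-intro [] [] u≢v refl refl
      e = FreeEdge.e fe
      X : Ext (adj []) (adj (e ∷ [])) u v
      X = FreeEdge.ext fe []
      ends : ∀ s t → adj (e ∷ []) s t ≡ true → (s ≡ u × t ≡ v) ⊎ (s ≡ v × t ≡ u)
      ends s t h with Ext.inv X {s} {t} h
      ... | inj₂ p = p
      star : DoubleStar (e ∷ []) u v
      star = record { loopless = λ {s} {t} → ll {s} {t} ; centre = Ext.new X ; touch = touch ; apart = apart }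
        where
        ll : Loopless (e ∷ [])
        ll {s} {t} h with ends s t h
        ... | inj₁ (refl , refl) = u≢v
        ... | inj₂ (refl , refl) = u≢v ∘ sym
        touch : ∀ s t → adj (e ∷ []) s t ≡ true → (s ≡ u ⊎ s ≡ v) ⊎ (t ≡ u ⊎ t ≡ v)
        touch s t h with ends s t h
        ... | inj₁ (p , _) = inj₁ (inj₁ p)
        ... | inj₂ (p , _) = inj₁ (inj₂ p)
        apart : ∀ z → adj (e ∷ []) u z ≡ true → adj (e ∷ []) v z ≡ true → ⊥
        apart z p q with ends u z p | ends v z q
        ... | inj₂ (u≡v , _) | _ = u≢v u≡v
        ... | _ | inj₁ (v≡u , _) = u≢v (sym v≡u)
        ... | inj₁ (_ , z≡v) | inj₂ (_ , z≡u) = u≢v (trans (sym z≡u) z≡v)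
      none : degree {n} (adj []) u ≡ 0
      none = sum-zero {n} (λ _ → refl)
      deg-u : deg (e ∷ []) u ≡ 1
      deg-u = trans (Ext-degree X refl u≢v) (cong suc none)
      deg-v : deg (e ∷ []) v ≡ 1
      deg-v = trans (Ext-degree (Ext-swap X) refl (u≢v ∘ sym)) (cong suc (sum-zero {n} (λ _ → refl)))
      full : 2 * n ≤ total (e ∷ []) [] u v + 0
      full = ≤-reflexive (sym (trans (+-identityʳ _) (trans (sum-cong-≗ {n} unblocked) (trans (sum-const n 2) (*-comm n 2)))))
        where
        unblocked : ∀ z → worth (quad (e ∷ []) [] u v z) ≡ 2
        unblocked z with adj (e ∷ []) u z | adj (e ∷ []) v z
        ... | true  | _     = refl
        ... | false | true  = refl
        ... | false | false = refl

    step : ∀ {u v : Fin n} → u ≢ v → ∀ C B → ToMove C B → Move C B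
    step u≢v C B (start refl refl) = opening u≢v
    step u≢v C B (inPlay D (both s a b)) = first D s a b
    step u≢v C B (inPlay D (one a b s))  = second D a b s
    step u≢v C B (inPlay D (pair a b s)) = pairing D a b s

    guarantee : ∀ {u v : Fin n} → u ≢ v → V ≤ gPath n 4 5
    guarantee u≢v = play-≥ ToMove Replied (step u≢v) weaken reply (length (allEdges n)) [] []
      (length-filter (λ e → Data.Bool.T? (isFree [] [] e)) (allEdges n)) (start refl refl)

-- The lower bound in numbers.

-- For n = 7(i + 1) + r the choice is m = 2(i + 1) and K = 6(i + 1) + r, so that 2K + m = 2n
-- exactly. `V` is the product for degrees m and 2m.
lower-bound-mod : ∀ k i r → r ≤ 6 → let n = 7 + (r + i * 7) in
  3 * k ≤ n → 8 * k * (n * n) ≤ 49 * k * gPath n 4 5 + 49 * (n * n)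
lower-bound-mod k i r r≤6 3k≤n = conclude (7 + (r + i * 7)) V (gPath (7 + (r + i * 7)) 4 5) quadratic guarantee 3k≤n
  where
  V = suc (2 * i) * (4 * i + 3)
  product : ∀ a b → 2 * suc i ≤ a → 2 * suc i ≤ b → 6 * suc i + r ≤ a + b → V ≤ (a ∸ 1) * (b ∸ 1)
  product a b ha hb hab with m≤n⇒∃[o]m+o≡n ha | m≤n⇒∃[o]m+o≡n hb
  -- For a given sum the product is least when one degree is as small as allowed; pq is the excess.
  ... | p , refl | q , refl = begin
    suc (2 * i) * (4 * i + 3)                            ≤⟨ cert _ _ (suc (2 * i) * r + p * q) (times (suc (2 * i)) hab) (solve (i ∷ p ∷ q ∷ r ∷ [])) ⟩
    (suc (2 * i) + p) * (suc (2 * i) + q)                ≡⟨ cong₂ _*_ (shift p) (shift q) ⟩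
    (2 * suc i + p ∸ 1) * (2 * suc i + q ∸ 1)            ∎
    where
    open ≤-Reasoning
    shift : ∀ t → suc (2 * i) + t ≡ 2 * suc i + t ∸ 1
    shift t = cong (_∸ 1) {suc (suc (2 * i) + t)} {2 * suc i + t} (solve (i ∷ t ∷ []))
  guarantee : V ≤ gPath (7 + (r + i * 7)) 4 5
  guarantee = Constructor.Strategy.guarantee {7 + (r + i * 7)} {V} (2 * suc i) (6 * suc i + r) (s≤s z≤n)
    (≤-reflexive (solve (i ∷ r ∷ []))) (slack (suc i + r) (solve (i ∷ r ∷ []))) product {zero} {suc zero} (λ ())
  quadratic : 8 * ((7 + (r + i * 7)) * (7 + (r + i * 7))) ≤ 49 * (suc (2 * i) * (4 * i + 3)) + 138 * (7 + (r + i * 7))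
  quadratic = cert _ _ (385 + 34 * r) (times (112 * i) r≤6 ⊹ times (8 * (7 + r)) r≤6) (solve (i ∷ r ∷ []))
  conclude : ∀ n V g → 8 * (n * n) ≤ 49 * V + 138 * n → V ≤ g → 3 * k ≤ n → 8 * k * (n * n) ≤ 49 * k * g + 49 * (n * n)
  -- The linear error becomes 138kn ≤ 147kn ≤ 49n² by 3k ≤ n.
  conclude n V g q h l = cert _ _ (9 * (k * n)) (times k q ⊹ times (49 * k) h ⊹ times (49 * n) l) (solve (n ∷ V ∷ g ∷ k ∷ []))

lower-bound : ∀ k n → 7 ≤ n → 3 * k ≤ n → 8 * k * (n * n) ≤ 49 * k * gPath n 4 5 + 49 * (n * n)
lower-bound k n 7≤n 3k≤n with m≤n⇒∃[o]m+o≡n {7} 7≤n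
... | n' , refl = subst (λ t → 3 * k ≤ 7 + t → 8 * k * ((7 + t) * (7 + t)) ≤ 49 * k * gPath (7 + t) 4 5 + 49 * ((7 + t) * (7 + t)))
  (sym (m≡m%n+[m/n]*n n' 7)) (lower-bound-mod k (n' / 7) (n' % 7) (≤-pred (m%n<n n' 7))) 3k≤n

-- Blocker's strategy

Ext-degree-≥ : ∀ {n} {A A' : Rel n} {s t} v → Ext A A' s t → degree A v ≤ degree A' v
Ext-degree-≥ {A = A} {A'} v X = sum-mono (λ z → 𝟙-mono {A v z} {A' v z} (Ext.old X))

Ext-degree-≤ : ∀ {n} {A A' : Rel n} {s t} v → Ext A A' s t → A s t ≡ false → A t s ≡ false → s ≢ t → degree A' v ≤ suc (degree A v)
Ext-degree-≤ {s = s} {t} v X st ts s≢t with v F.≟ s | v F.≟ t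
... | yes refl | _        = ≤-reflexive (Ext-degree X st s≢t)
... | no _     | yes refl = ≤-reflexive (Ext-degree (Ext-swap X) ts (s≢t ∘ sym))
... | no p     | no q     = ≤-trans (≤-reflexive (Ext-degree-other X p q)) (n≤1+n _)

isolated : ∀ {n} (A : Rel n) {z} → degree A z ≡ 0 → ∀ v → A z v ≡ false
isolated A {z} d v = ¬true⇒false (λ h → <-irrefl (sym d) (≤-trans (≤-reflexive (cong 𝟙 (sym h))) (sum-term (𝟙 ∘ A z) v)))

-- The weight of a vertex z for the double star with centres x and y, from the degree of z and from
-- whether Constructor owns xz, yz and Blocker owns xz, yz.
weight : ℕ → Bool → Bool → Bool → Bool → ℕ
weight 0             _     _     false _     = 4
weight 0             _     _     true  false = 2
weight 0             _     _     true  true  = 0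
weight 1             true  _     _     _     = 6
weight 1             false true  _     _     = 4
weight 1             false false _     _     = 0
weight (suc (suc _)) _     _     _     _     = 0

-- Further edges of Blocker never raise a weight, so a reply in one unit does no harm in another.
weight-block : ∀ d a b {c c' e e'} → (c ≡ true → c' ≡ true) → (e ≡ true → e' ≡ true) → weight d a b c' e' ≤ weight d a b c e
weight-block 0 a b {true}  {c'}    {true}  p q rewrite p refl | q refl = ≤-refl
weight-block 0 a b {true}  {c'}    {false} {true}  p q rewrite p refl = z≤n
weight-block 0 a b {true}  {c'}    {false} {false} p q rewrite p refl = ≤-refl
weight-block 0 a b {false} {true}  {e} {true}  p q = z≤n
weight-block 0 a b {false} {true}  {e} {false} p q = s≤s (s≤s z≤n)
weight-block 0 a b {false} {false} p q = ≤-refl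
weight-block 1 true  b     p q = ≤-refl
weight-block 1 false true  p q = ≤-refl
weight-block 1 false false p q = ≤-refl
weight-block (suc (suc d)) a b p q = ≤-refl

-- The second centre is missing as long as x is the centre of a mere star.
module _ {n : ℕ} where

  row : Maybe (Fin n) → Rel n → Fin n → Bool
  row nothing  A z = false
  row (just y) A z = A y z

  Φ : Rel n → Rel n → Fin n → Maybe (Fin n) → ℕ
  Φ A B x my = sum (λ z → weight (degree A z) (A x z) (row my A z) (B x z) (row my B z))

  -- Without a second centre there is no second edge to take, and `⊥ → ⊥` is the trivial condition.
  Closed : Rel n → Maybe (Fin n) → Fin n → Set
  Closed B nothing  z = ⊥ → ⊥
  Closed B (just y) z = B y z ≡ true

  Dead : Rel n → Rel n → Fin n → Maybe (Fin n) → Set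
  Dead A B x my = ∀ z → degree A z ≡ 0 → B x z ≡ true × Closed B my z

  -- In a dead unit Blocker can no longer lower the potential, but Constructor cannot raise it
  -- either. The excess 2 from Constructor's last leaf is then tolerated for good.
  Good : Rel n → Rel n → Fin n → Maybe (Fin n) → ℕ → Set
  Good A B x my b = Φ A B x my ≤ b ⊎ (Dead A B x my × Φ A B x my ≤ b + 2)

  Good-≤ : ∀ {A B x my b} → Good A B x my b → Φ A B x my ≤ b + 2
  Good-≤ (inj₁ p)       = ≤-trans p (m≤m+n _ 2)
  Good-≤ (inj₂ (_ , p)) = p

  Good-weaken : ∀ {A B x my b b'} → b ≤ b' → Good A B x my b → Good A B x my b'
  Good-weaken le (inj₁ p)       = inj₁ (≤-trans p le)
  Good-weaken le (inj₂ (d , p)) = inj₂ (d , ≤-trans p (+-monoˡ-≤ 2 le))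

  data InUnit (v x : Fin n) : Maybe (Fin n) → Set where
    first  : ∀ {my} → v ≡ x → InUnit v x my
    second : InUnit v x (just v)

  -- Keeps the centres apart from the isolated vertices that are still fought for.
  Crowded : Rel n → Fin n → Maybe (Fin n) → Set
  Crowded A x my = ∀ v → InUnit v x my → degree A v ≢ 0

  -- Constructor claims vw. Only w can gain weight, by 2, and only if it becomes a leaf of v.
  module _ {A A' B : Rel n} {v w : Fin n} (X : Ext A A' v w) (vw : A v w ≡ false) (wv : A w v ≡ false)
    (bvw : B v w ≡ false) (bwv : B w v ≡ false) (v≢w : v ≢ w) (order : degree A v ≡ 0 → degree A w ≡ 0)
    {x : Fin n} {my : Maybe (Fin n)} (crowded : Crowded A x my) where

    private
      W W' : Fin n → ℕ
      W z  = weight (degree A z) (A x z) (row my A z) (B x z) (row my B z)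
      W' z = weight (degree A' z) (A' x z) (row my A' z) (B x z) (row my B z)

      Gain : Fin n → Set
      Gain z = z ≡ w × InUnit v x my × degree A z ≡ 0 × (B x z ≡ true → Closed B my z → ⊥) × W' z ≤ W z + 2

      new-edge : ∀ {c z} → InUnit c x my → degree A z ≡ 0 → A c z ≡ false → A' c z ≡ true → z ≡ w × c ≡ v × B c z ≡ false
      new-edge {c} {z} ic dz old h with Ext.inv X {c} {z} h
      ... | inj₁ p = ⊥-elim (true≢false p old)
      ... | inj₂ (inj₁ (refl , refl)) = refl , refl , bvw
      -- Here `w` would be the centre, and `order` would make it isolated together with `v`.
      ... | inj₂ (inj₂ (refl , refl)) = ⊥-elim (crowded w ic (order dz))

      row-same : ∀ z my → z ≢ v → z ≢ w → row my A' z ≡ row my A z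
      row-same z nothing  p q = refl
      row-same z (just y) p q = Ext-same X (q ∘ proj₂) (p ∘ proj₂)

      -- The claimed edge was free. A leaf of x therefore had weight 4 before it got 6, and a leaf
      -- of y had weight at least 2 before it got 4.
      weight-gain-x : ∀ {c} → c ≡ false → ∀ a b b' e → weight 1 true b' c e ≤ weight 0 a b c e + 2
      weight-gain-x refl a b b' e = ≤-refl

      weight-gain-y : ∀ {e} → e ≡ false → ∀ a b b' c → weight 1 false b' c e ≤ weight 0 a b c e + 2
      weight-gain-y refl a b true  true  = ≤-refl
      weight-gain-y refl a b true  false = m≤m+n 4 2
      weight-gain-y refl a b false c     = z≤n

      unchanged : ∀ z → z ≢ v → z ≢ w → W' z ≤ W z
      unchanged z p q = ≤-reflexive (trans
        (cong (λ d → weight d (A' x z) (row my A' z) (B x z) (row my B z)) (Ext-degree-other X p q))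
        (cong₂ (λ a b → weight (degree A z) a b (B x z) (row my B z)) (Ext-same X (q ∘ proj₂) (p ∘ proj₂)) (row-same z my p q)))

      raised : ∀ z → degree A' z ≡ suc (degree A z) → (∀ c → A c z ≡ true → A z c ≡ true) → W' z ≤ W z ⊎ Gain z
      raised z d sm with degree A z in eq
      -- A vertex that already had an edge now has degree at least 2 and weight 0.
      ... | suc k rewrite d = inj₁ z≤n
      ... | zero with bool (A' x z)
      ...   | inj₁ h with new-edge (first refl) eq (¬true⇒false (λ p → true≢false (sm x p) (isolated A eq x))) h
      ...     | z≡w , x≡v , bx = inj₂ (z≡w , first (sym x≡v) , refl , (λ b _ → true≢false b bx) ,
                  subst₂ (λ k a → weight k a (row my A' z) (B x z) (row my B z) ≤ weight 0 (A x z) (row my A z) (B x z) (row my B z) + 2)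
                    (sym d) (sym h) (weight-gain-x bx (A x z) (row my A z) (row my A' z) (row my B z)))
      raised z d sm | zero | inj₂ h = by-second my refl
        where
        by-second : ∀ m → my ≡ m → W' z ≤ weight 0 (A x z) (row my A z) (B x z) (row my B z)
          ⊎ (z ≡ w × InUnit v x my × 0 ≡ 0 × (B x z ≡ true → Closed B my z → ⊥) × W' z ≤ weight 0 (A x z) (row my A z) (B x z) (row my B z) + 2)
        by-second nothing refl rewrite d | h = inj₁ z≤n
        by-second (just y) refl with bool (A' y z)
        ... | inj₂ k rewrite d | h | k = inj₁ z≤n
        ... | inj₁ k with new-edge second eq (¬true⇒false (λ p → true≢false (sm y p) (isolated A eq y))) k
        ...   | z≡w , refl , by = inj₂ (z≡w , second , refl , (λ _ c → true≢false c by) ,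
                  subst₂ (λ i a → weight i a (A' y z) (B x z) (B y z) ≤ weight 0 (A x z) (A y z) (B x z) (B y z) + 2)
                    (sym d) (sym h) (weight-gain-y by (A x z) (A y z) (A' y z) (B x z)))

    module _ (A-sym : ∀ {s t} → A s t ≡ true → A t s ≡ true) where

      private
        pointwise : ∀ z → W' z ≤ W z ⊎ Gain z
        pointwise z with z F.≟ v | z F.≟ w
        ... | yes refl | _        = raised v (Ext-degree X vw v≢w) (λ c → A-sym)
        ... | no _     | yes refl = raised w (Ext-degree (Ext-swap X) wv (v≢w ∘ sym)) (λ c → A-sym)
        ... | no p     | no q     = inj₁ (unchanged z p q)

      claim-≤ : Φ A' B x my ≤ Φ A B x my + 2
      claim-≤ = sum-mono-except w 2 off at
        where
        off : ∀ z → z ≢ w → W' z ≤ W z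
        off z z≢w with pointwise z
        ... | inj₁ p = p
        ... | inj₂ (z≡w , _) = ⊥-elim (z≢w z≡w)
        at : W' w ≤ W w + 2
        at with pointwise w
        ... | inj₁ p = ≤-trans p (m≤m+n _ 2)
        ... | inj₂ (_ , _ , _ , _ , p) = p

      claim-elsewhere : (InUnit v x my → ⊥) → Φ A' B x my ≤ Φ A B x my
      claim-elsewhere out = sum-mono pw
        where
        pw : ∀ z → W' z ≤ W z
        pw z with pointwise z
        ... | inj₁ p = p
        ... | inj₂ (_ , i , _) = ⊥-elim (out i)

      claim-dead : Dead A B x my → Φ A' B x my ≤ Φ A B x my
      claim-dead dead = sum-mono pw
        where
        pw : ∀ z → W' z ≤ W z
        pw z with pointwise z
        ... | inj₁ p = p
        ... | inj₂ (_ , _ , dz , alive , _) with dead z dz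
        ...   | p , q = ⊥-elim (alive p q)

      dead-persists : Dead A B x my → Dead A' B x my
      dead-persists dead z dz = dead z (n≤0⇒n≡0 (≤-trans (Ext-degree-≥ z X) (≤-reflexive dz)))

      Good-claim : ∀ {b} → Good A B x my b → Φ A' B x my ≤ b + 2
      Good-claim (inj₁ p)       = ≤-trans claim-≤ (+-monoˡ-≤ 2 p)
      Good-claim (inj₂ (d , p)) = ≤-trans (claim-dead d) p

      Good-elsewhere : ∀ {b} → (InUnit v x my → ⊥) → Good A B x my b → Good A' B x my b
      Good-elsewhere out (inj₁ p)       = inj₁ (≤-trans (claim-elsewhere out) p)
      Good-elsewhere out (inj₂ (d , p)) = inj₂ (dead-persists d , ≤-trans (claim-dead d) p)

  module _ {A B B' : Rel n} {s t : Fin n} (X : Ext B B' s t) where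

    private
      row-mono : ∀ my {z} → row my B z ≡ true → row my B' z ≡ true
      row-mono (just y) h = Ext.old X h

    block-≤ : ∀ x my → Φ A B' x my ≤ Φ A B x my
    block-≤ x my = sum-mono (λ z → weight-block (degree A z) (A x z) (row my A z) (Ext.old X) (row-mono my))

    dead-block : ∀ {x my} → Dead A B x my → Dead A B' x my
    dead-block {x} {my} d z dz = Ext.old X (proj₁ (d z dz)) , closed my (proj₂ (d z dz))
      where
      closed : ∀ my → Closed B my z → Closed B' my z
      closed nothing  c = c
      closed (just y) c = Ext.old X c

    Good-block : ∀ {x my b} → Good A B x my b → Good A B' x my b
    Good-block {x} {my} (inj₁ p)       = inj₁ (≤-trans (block-≤ x my) p)
    Good-block {x} {my} (inj₂ (d , p)) = inj₂ (dead-block {x} {my} d , ≤-trans (block-≤ x my) p)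

    block-x : ∀ {x my} {z : Fin n} → s ≡ x → t ≡ z → degree A z ≡ 0 → B x z ≡ false → Φ A B' x my + 2 ≤ Φ A B x my
    block-x {x} {my} {z} refl refl dz bxz = sum-mono-gain z 2
      (λ u → weight-block (degree A u) (A x u) (row my A u) (Ext.old X) (row-mono my)) gain
      where
      gain : weight (degree A z) (A x z) (row my A z) (B' x z) (row my B' z) + 2 ≤ weight (degree A z) (A x z) (row my A z) (B x z) (row my B z)
      gain rewrite dz | bxz | Ext.new X with row my B' z
      ... | true  = s≤s (s≤s z≤n)
      ... | false = ≤-refl

    -- The edge yz pays only after xz: the weight stays 4 while xz is free and drops from 2 to 0
    -- afterwards.
    block-y : ∀ {x y} {z : Fin n} → s ≡ y → t ≡ z → degree A z ≡ 0 → B x z ≡ true → B y z ≡ false → Φ A B' x (just y) + 2 ≤ Φ A B x (just y)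
    block-y {x} {y} {z} refl refl dz bxz byz = sum-mono-gain z 2
      (λ u → weight-block (degree A u) (A x u) (A y u) (Ext.old X) (row-mono (just y))) gain
      where
      gain : weight (degree A z) (A x z) (A y z) (B' x z) (B' y z) + 2 ≤ weight (degree A z) (A x z) (A y z) (B x z) (B y z)
      gain rewrite dz | bxz | byz | Ext.new X | Ext.old X bxz = ≤-refl

  weight-single-≤ : ∀ d a c → weight d a false c false ≤ 4 + 6 * 𝟙 a
  weight-single-≤ 0 a     false = m≤m+n 4 _
  weight-single-≤ 0 a     true  = ≤-trans (s≤s (s≤s z≤n)) (m≤m+n 4 _)
  weight-single-≤ 1 true  c     = m≤n+m 6 4
  weight-single-≤ 1 false c     = z≤n
  weight-single-≤ (suc (suc d)) a c = z≤n

  weight-pair-≤ : ∀ d a b c e → weight d a b c e ≤ weight d a false c false + 4 * 𝟙 b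
  weight-pair-≤ 0 a b false e     = m≤m+n 4 _
  weight-pair-≤ 0 a b true  false = m≤m+n 2 _
  weight-pair-≤ 0 a b true  true  = z≤n
  weight-pair-≤ 1 true  b     c e = m≤m+n 6 _
  weight-pair-≤ 1 false true  c e = ≤-refl
  weight-pair-≤ 1 false false c e = z≤n
  weight-pair-≤ (suc (suc d)) a b c e = z≤n

  Φ-single-≤ : ∀ A B x → Φ A B x nothing ≤ 4 * n + 6 * degree A x
  Φ-single-≤ A B x = begin
    Φ A B x nothing                             ≤⟨ sum-mono (λ z → weight-single-≤ (degree A z) (A x z) (B x z)) ⟩
    sum (λ z → 4 + 6 * 𝟙 (A x z))               ≡⟨ ∑-distrib-+ {n} (λ _ → 4) (λ z → 6 * 𝟙 (A x z)) ⟩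
    sum {n} (λ _ → 4) + sum (λ z → 6 * 𝟙 (A x z)) ≡⟨ cong₂ _+_ (trans (sum-const n 4) (*-comm n 4)) (sym (*-distribˡ-sum 6 (λ z → 𝟙 (A x z)))) ⟩
    4 * n + 6 * degree A x                      ∎
    where open ≤-Reasoning

  -- The price of a second centre: a leaf of `y` weighs 0 for the star at `x` and 4 for the double
  -- star. It is affordable only if the star at `y` is small.
  Φ-pair-≤ : ∀ A B x y → Φ A B x (just y) ≤ Φ A B x nothing + 4 * degree A y
  Φ-pair-≤ A B x y = begin
    Φ A B x (just y)
      ≤⟨ sum-mono (λ z → weight-pair-≤ (degree A z) (A x z) (A y z) (B x z) (B y z)) ⟩
    sum (λ z → weight (degree A z) (A x z) false (B x z) false + 4 * 𝟙 (A y z))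
      ≡⟨ trans (∑-distrib-+ {n} _ _) (cong (Φ A B x nothing +_) (sym (*-distribˡ-sum 4 (λ z → 𝟙 (A y z))))) ⟩
    Φ A B x nothing + 4 * degree A y ∎
    where open ≤-Reasoning

-- Blocker's invariant and his replies.

module Blocker {n K R : ℕ} (3≤K : 3 ≤ K) (few : n < suc R * suc K) where

  -- Bounds for the potential of a star and of a double star. The difference pays for a star of at most
  -- 2 + K + R * R vertices that is absorbed when the double star arises.
  b₁ b₂ : ℕ
  b₁ = 4 * n + 6 * suc K
  b₂ = b₁ + (4 * (2 + K) + 4 * (R * R) + 4)

  private
    deg : List (Edge n) → Fin n → ℕ
    deg C = degree (adj C)

    bigIn : List (Edge n) → Fin n → Bool
    bigIn C x = K <ᵇ deg C x

    not-isolated : ∀ C {x} → bigIn C x ≡ true → deg C x ≢ 0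
    not-isolated C {x} b z = <⇒≱ (<ᵇ-true⁻ {K} {deg C x} b) (≤-trans (≤-reflexive z) z≤n)

    crowded₁ : ∀ {C x} → bigIn C x ≡ true → Crowded (adj C) x nothing
    crowded₁ {C} b u (first refl) = not-isolated C {u} b

    crowded₂ : ∀ {C x y} → bigIn C x ≡ true → bigIn C y ≡ true → Crowded (adj C) x (just y)
    crowded₂ {C} bx by u (first refl) = not-isolated C {u} bx
    crowded₂ {C} bx by u second       = not-isolated C {u} by

  -- A clock that advances whenever Blocker spends a move on separating two big vertices instead of answering locally.
  separated : List (Edge n) → List (Edge n) → ℕ
  separated C B = sum (λ x → sum (λ y → 𝟙 (bigIn C x ∧ (bigIn C y ∧ adj B x y))))

  -- `few` leaves room for at most `R` big vertices.
  separated-≤ : ∀ {C B} (l : Loopless C) → P₅-free (graph C l) → separated C B ≤ R * R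
  separated-≤ {C} {B} l free = begin
    sum (λ x → sum (λ y → 𝟙 (bigIn C x ∧ (bigIn C y ∧ adj B x y))))
      ≤⟨ sum-mono (λ x → sum-mono (λ y → bound (bigIn C x) (bigIn C y) (adj B x y))) ⟩
    sum (λ x → sum (λ y → 𝟙 (bigIn C x) * 𝟙 (bigIn C y)))
      ≡⟨ trans (sum-cong-≗ {n} (λ x → sym (*-distribˡ-sum (𝟙 (bigIn C x)) (λ y → 𝟙 (bigIn C y))))) (sym (*-distribʳ-sum N (λ x → 𝟙 (bigIn C x)))) ⟩
    N * N
      ≤⟨ *-mono-≤ N≤R N≤R ⟩
    R * R ∎
    where
    open ≤-Reasoning
    N = sum (λ x → 𝟙 (bigIn C x))
    bound : ∀ a b c → 𝟙 (a ∧ (b ∧ c)) ≤ 𝟙 a * 𝟙 b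
    bound true  true  c = 𝟙≤1 c
    bound true  false c = z≤n
    bound false b     c = z≤n
    N≤R : N ≤ R
    N≤R = ≤-pred (*-cancelʳ-< (suc K) N (suc R) (≤-<-trans (Static.few-big (graph C l) free 3≤K) few))

  -- The state between Constructor's move and the answer: only a unit with centre `v` may have an
  -- excess that Blocker has yet to remove.
  Ok : List (Edge n) → List (Edge n) → Fin n → Fin n → Maybe (Fin n) → ℕ → Set
  Ok C B v x my b = Good (adj C) (adj B) x my b ⊎ (InUnit v x my × Φ (adj C) (adj B) x my ≤ b + 2)

  Ok-≤ : ∀ {C B v x my b} → Ok C B v x my b → Φ (adj C) (adj B) x my ≤ b + 2
  Ok-≤ {C} {B} {v} {x} {my} (inj₁ g) = Good-≤ {A = adj C} {B = adj B} {x} {my} g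
  Ok-≤ (inj₂ (_ , p)) = p

  -- While Blocker separates, potentials rise by 2 and degrees by 1 per turn without an answer,
  -- hence the terms in `separated`. `apart` says that of two big vertices which can still be
  -- joined, one became big recently. `double` leaves open which centre plays x, since this is
  -- decided when the double star arises.
  record ToMove (C B : List (Edge n)) : Set where
    field
      loopless : Loopless C
      free     : P₅-free (graph C loopless)
      apart    : ∀ x y → bigIn C x ≡ true → bigIn C y ≡ true → x ≢ y → adj C x y ≡ false → adj B x y ≡ false →
                 deg C x ≤ 1 + K + separated C B ⊎ deg C y ≤ 1 + K + separated C B
      single   : ∀ x → bigIn C x ≡ true → (∀ y → adj C x y ≡ true → bigIn C y ≡ false) →
                 Good (adj C) (adj B) x nothing (b₁ + 2 * separated C B)
      double   : ∀ x y → adj C x y ≡ true → bigIn C x ≡ true → bigIn C y ≡ true →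
                 Good (adj C) (adj B) x (just y) (b₂ + 2 * separated C B) ⊎ Good (adj C) (adj B) y (just x) (b₂ + 2 * separated C B)

  -- Constructor has just added a leaf at v, if anywhere.
  record ToReply (C B : List (Edge n)) (v : Fin n) : Set where
    field
      loopless : Loopless C
      free     : P₅-free (graph C loopless)
      apart    : ∀ x y → bigIn C x ≡ true → bigIn C y ≡ true → x ≢ y → adj C x y ≡ false → adj B x y ≡ false →
                 deg C x ≤ 2 + K + separated C B ⊎ deg C y ≤ 2 + K + separated C B
      single   : ∀ x → bigIn C x ≡ true → (∀ y → adj C x y ≡ true → bigIn C y ≡ false) →
                 Ok C B v x nothing (b₁ + 2 * separated C B)
      double   : ∀ x y → adj C x y ≡ true → bigIn C x ≡ true → bigIn C y ≡ true →
                 Ok C B v x (just y) (b₂ + 2 * separated C B) ⊎ Ok C B v y (just x) (b₂ + 2 * separated C B)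

  start : ToMove [] []
  start = record
    { loopless = λ ()
    ; free     = λ ()
    ; apart    = λ x y bx → ⊥-elim (small x bx)
    ; single   = λ x bx → ⊥-elim (small x bx)
    ; double   = λ x y () }
    where
    small : ∀ x → bigIn [] x ≡ true → ⊥
    small x bx = <⇒≱ (<ᵇ-true⁻ {K} {deg [] x} bx) (≤-trans (≤-reflexive (sum-zero {n} (λ _ → refl))) z≤n)

  merge-arith : ∀ {f d s s'} → f ≤ b₁ + 2 * s + 2 → d ≤ 2 + K + s → s ≤ R * R → s ≤ s' → f + 4 * d ≤ b₂ + 2 * s'
  merge-arith {f} {d} {s} {s'} hf hd hs hs' =
    cert _ _ 2 (hf ⊹ times 4 hd ⊹ times 4 hs ⊹ times 2 hs') (arith b₁ K (R * R) f d s s')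
    where
    arith : ∀ b K r f d s s' → f + 4 * d + (b + 2 * s + 2 + 4 * (2 + K + s) + 4 * r + 2 * s') + 2
      ≡ b + (4 * (2 + K) + 4 * r + 4) + 2 * s' + (f + 4 * d + 4 * s + 2 * s)
    arith = solve-∀

  fresh-arith : ∀ {f d d'} s → f ≤ 4 * n + 6 * d → d ≤ suc K → d' ≤ suc K → f + 4 * d' ≤ b₂ + 2 * s
  fresh-arith {f} {d} {d'} s hf hd hd' =
    cert _ _ (4 * (R * R) + 8 + 2 * s) (hf ⊹ times 6 hd ⊹ times 4 hd') (arith n K (R * R) f d d' s)
    where
    arith : ∀ n K r f d d' s → f + 4 * d' + (4 * n + 6 * d + 6 * suc K + 4 * suc K) + (4 * r + 8 + 2 * s)
      ≡ 4 * n + 6 * suc K + (4 * (2 + K) + 4 * r + 4) + 2 * s + (f + 6 * d + 4 * d')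
    arith = solve-∀

  module Claim {C B : List (Edge n)} (inv : ToMove C B) {e : Edge n} (legal : containsPath 5 (e ∷ C) ≡ false)
    {v w : Fin n} (X : Ext (adj C) (adj (e ∷ C)) v w) (loopless' : Loopless (e ∷ C)) (v≢w : v ≢ w)
    (vw : adj C v w ≡ false) (bvw : adj B v w ≡ false) (order : deg C v ≡ 0 → deg C w ≡ 0) where

    open ToMove inv

    private
      C' = e ∷ C
      wv = adj-symᶠ C {v} {w} vw
      bwv = adj-symᶠ B {v} {w} bvw
      S = separated C B
      S' = separated C' B

      free' : P₅-free (graph C' loopless')
      free' = free-of-containsPath loopless' legal

      unique : ∀ {z x y} → bigIn C' x ≡ true → bigIn C' y ≡ true → adj C' x z ≡ true → adj C' y z ≡ true → x ≡ y
      unique = Static.big-neighbour-unique (graph C' loopless') free' 3≤K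

      deg-≤ : ∀ x → deg C' x ≤ suc (deg C x)
      deg-≤ x = Ext-degree-≤ x X vw wv v≢w

      still-big : ∀ x → bigIn C x ≡ true → bigIn C' x ≡ true
      still-big x b = <ᵇ-true (<-≤-trans (<ᵇ-true⁻ {K} b) (Ext-degree-≥ x X))

      newly-big : ∀ x → bigIn C x ≡ false → deg C' x ≤ suc K
      newly-big x b = ≤-trans (deg-≤ x) (s≤s (<ᵇ-false⁻ {K} b))

      S≤S' : S ≤ S'
      S≤S' = sum-mono (λ x → sum-mono (λ y → 𝟙-mono (pairs x y)))
        where
        pairs : ∀ x y → bigIn C x ∧ (bigIn C y ∧ adj B x y) ≡ true → bigIn C' x ∧ (bigIn C' y ∧ adj B x y) ≡ true
        pairs x y h with ∧-true {bigIn C x} h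
        ... | bx , h' with ∧-true {bigIn C y} h'
        ...   | by , bxy = cong₂ _∧_ (still-big x bx) (cong₂ _∧_ (still-big y by) bxy)

      S≤R² : S ≤ R * R
      S≤R² = separated-≤ {C} {B} loopless free

      inUnit? : ∀ x my → Dec (InUnit v x my)
      inUnit? x my with v F.≟ x
      ... | yes p = yes (first p)
      inUnit? x nothing  | no p = no λ { (first q) → p q }
      inUnit? x (just y) | no p with v F.≟ y
      ... | yes refl = yes second
      ... | no q = no λ { (first r) → p r ; second → q refl }

      b-mono : ∀ b → b + 2 * S ≤ b + 2 * S'
      b-mono b = +-monoʳ-≤ b (*-monoʳ-≤ 2 S≤S')

      lift : ∀ {x my} b → Crowded (adj C) x my → Good (adj C) (adj B) x my (b + 2 * S) → Ok C' B v x my (b + 2 * S')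
      lift {x} {my} b cr g with inUnit? x my
      ... | yes i = inj₂ (i , ≤-trans (Good-claim {A = adj C} {A' = adj C'} {B = adj B} X vw wv bvw bwv v≢w order {x} {my} cr (λ {s} {t} → adj-sym C {s} {t}) g) (+-monoˡ-≤ 2 (b-mono b)))
      ... | no ¬i = inj₁ (Good-weaken {A = adj C'} {B = adj B} {x} {my} (b-mono b) (Good-elsewhere {A = adj C} {A' = adj C'} {B = adj B} X vw wv bvw bwv v≢w order {x} {my} cr (λ {s} {t} → adj-sym C {s} {t}) ¬i g))

      -- A big neighbour of `x` in `C` would coincide with `y` by uniqueness, so `x` was the centre
      -- of a mere star whose bound applies. Each edge at `y` then adds at most 4.
      merge : ∀ x y → bigIn C x ≡ true → adj C' x y ≡ true → bigIn C' y ≡ true →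
        adj C x y ≡ false ⊎ bigIn C y ≡ false → deg C' y ≤ 2 + K + S → Φ (adj C') (adj B) x (just y) ≤ b₂ + 2 * S'
      merge x y bx xy by' new dy = ≤-trans (Φ-pair-≤ (adj C') (adj B) x y) (merge-arith {s = S} single-≤ dy S≤R² S≤S')
        where
        lone : ∀ u → adj C x u ≡ true → bigIn C u ≡ false
        lone u xu = ¬true⇒false (λ bu → clash new (unique {x} {u} {y} (still-big u bu) by' (adj-sym C' {x} {u} (Ext.old X {x} {u} xu)) (adj-sym C' {x} {y} xy)) bu)
          where
          clash : adj C x y ≡ false ⊎ bigIn C y ≡ false → u ≡ y → bigIn C u ≡ true → ⊥
          clash (inj₁ p) refl _  = true≢false xu p
          clash (inj₂ p) refl bu = true≢false bu p
        single-≤ : Φ (adj C') (adj B) x nothing ≤ b₁ + 2 * S + 2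
        single-≤ = Good-claim {A = adj C} {A' = adj C'} {B = adj B} X vw wv bvw bwv v≢w order {x} {nothing} (crowded₁ {C} {x} bx) (λ {s} {t} → adj-sym C {s} {t}) (single x bx lone)

      became-big-≤ : ∀ {y} → bigIn C y ≡ false → deg C' y ≤ 2 + K + S
      became-big-≤ {y} ¬b = ≤-trans (newly-big y ¬b) (≤-trans (n≤1+n _) (m≤m+n _ S))

      new-edge : ∀ {x y} → adj C x y ≡ false → adj C' x y ≡ true → x ≢ y × adj B x y ≡ false
      new-edge {x} {y} o h with Ext.inv X {x} {y} h
      ... | inj₁ p = ⊥-elim (true≢false p o)
      ... | inj₂ (inj₁ (refl , refl)) = v≢w , bvw
      ... | inj₂ (inj₂ (refl , refl)) = v≢w ∘ sym , bwv

      double' : ∀ x y → adj C' x y ≡ true → bigIn C' x ≡ true → bigIn C' y ≡ true →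
        Ok C' B v x (just y) (b₂ + 2 * S') ⊎ Ok C' B v y (just x) (b₂ + 2 * S')
      double' x y xy bx' by' with bool (bigIn C x) | bool (bigIn C y)
      -- Both centres became big with this claim, so the bound by degrees suffices.
      ... | inj₂ ¬bx | inj₂ ¬by = inj₁ (inj₁ (inj₁ (≤-trans (Φ-pair-≤ (adj C') (adj B) x y)
              (fresh-arith S' (Φ-single-≤ (adj C') (adj B) x) (newly-big x ¬bx) (newly-big y ¬by)))))
      ... | inj₁ bx | inj₂ ¬by = inj₁ (inj₁ (inj₁ (merge x y bx xy by' (inj₂ ¬by) (became-big-≤ {y} ¬by))))
      ... | inj₂ ¬bx | inj₁ by = inj₂ (inj₁ (inj₁ (merge y x by (adj-sym C' {x} {y} xy) bx' (inj₂ ¬bx) (became-big-≤ {x} ¬bx))))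
      ... | inj₁ bx | inj₁ by with bool (adj C x y)
      ...   | inj₁ old = old-pair (double x y old bx by)
        where
        old-pair : Good (adj C) (adj B) x (just y) (b₂ + 2 * S) ⊎ Good (adj C) (adj B) y (just x) (b₂ + 2 * S) →
          Ok C' B v x (just y) (b₂ + 2 * S') ⊎ Ok C' B v y (just x) (b₂ + 2 * S')
        old-pair (inj₁ g) = inj₁ (lift {x} {just y} b₂ (crowded₂ {C} {x} {y} bx by) g)
        old-pair (inj₂ g) = inj₂ (lift {y} {just x} b₂ (crowded₂ {C} {y} {x} by bx) g)
      -- The centre whose degree is known to be small is absorbed as y; the other keeps its star
      -- potential and becomes x.
      ...   | inj₂ new = joined (apart x y bx by (proj₁ (new-edge {x} {y} new xy)) new (proj₂ (new-edge {x} {y} new xy)))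
        where
        joined : deg C x ≤ 1 + K + S ⊎ deg C y ≤ 1 + K + S →
          Ok C' B v x (just y) (b₂ + 2 * S') ⊎ Ok C' B v y (just x) (b₂ + 2 * S')
        joined (inj₂ dy) = inj₁ (inj₁ (inj₁ (merge x y bx xy by' (inj₁ new) (≤-trans (deg-≤ y) (s≤s dy)))))
        joined (inj₁ dx) = inj₂ (inj₁ (inj₁ (merge y x by (adj-sym C' {x} {y} xy) bx' (inj₁ (adj-symᶠ C {x} {y} new)) (≤-trans (deg-≤ x) (s≤s dx)))))

    after-claim : ToReply C' B v
    after-claim = record { loopless = λ {x} {y} → loopless' {x} {y} ; free = free' ; apart = apart' ; single = single' ; double = double' }
      where
      apart' : ∀ x y → bigIn C' x ≡ true → bigIn C' y ≡ true → x ≢ y → adj C' x y ≡ false → adj B x y ≡ false →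
        deg C' x ≤ 2 + K + S' ⊎ deg C' y ≤ 2 + K + S'
      apart' x y bx' by' x≢y xy bxy with bool (bigIn C x) | bool (bigIn C y)
      ... | inj₂ ¬bx | _ = inj₁ (≤-trans (newly-big x ¬bx) (≤-trans (n≤1+n _) (m≤m+n _ S')))
      ... | inj₁ _ | inj₂ ¬by = inj₂ (≤-trans (newly-big y ¬by) (≤-trans (n≤1+n _) (m≤m+n _ S')))
      ... | inj₁ bx | inj₁ by with apart x y bx by x≢y (¬true⇒false (λ p → true≢false (Ext.old X {x} {y} p) xy)) bxy
      ...   | inj₁ d = inj₁ (≤-trans (deg-≤ x) (s≤s (≤-trans d (+-monoʳ-≤ (1 + K) S≤S'))))
      ...   | inj₂ d = inj₂ (≤-trans (deg-≤ y) (s≤s (≤-trans d (+-monoʳ-≤ (1 + K) S≤S'))))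
      single' : ∀ x → bigIn C' x ≡ true → (∀ y → adj C' x y ≡ true → bigIn C' y ≡ false) → Ok C' B v x nothing (b₁ + 2 * S')
      single' x bx' lone with bool (bigIn C x)
      ... | inj₁ bx = lift {x} {nothing} b₁ (crowded₁ {C} {x} bx) (single x bx (λ y xy → ¬true⇒false (λ by → true≢false (still-big y by) (lone y (Ext.old X {x} {y} xy)))))
      ... | inj₂ ¬bx = inj₁ (inj₁ (≤-trans (Φ-single-≤ (adj C') (adj B) x)
              (≤-trans (+-monoʳ-≤ (4 * n) (*-monoʳ-≤ 6 (newly-big x ¬bx))) (m≤m+n _ _))))

  -- The ends are named so that `w` is isolated if either end is. Only such an end can become a
  -- leaf, and `v` is then the centre that Blocker has to watch.
  claim : ∀ {C B e} → ToMove C B → e ∈ freeEdges C B → containsPath 5 (e ∷ C) ≡ false → ∃[ v ] ToReply (e ∷ C) B v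
  claim {C} {B} {s , t} inv m legal with free-elim {C = C} {B} m | deg C t ≟ 0
  ... | s≢t , st , bst | yes dt = s , Claim.after-claim inv legal (cons-Ext C s t) (loopless-∷ {es = C} (ToMove.loopless inv) s≢t) s≢t st bst (λ _ → dt)
  ... | s≢t , st , bst | no ¬dt = t , Claim.after-claim inv legal (Ext-swap (cons-Ext C s t)) (loopless-∷ {es = C} (ToMove.loopless inv) s≢t) (s≢t ∘ sym)
          (adj-symᶠ C {s} {t} st) (adj-symᶠ B {s} {t} bst) (λ dt → ⊥-elim (¬dt dt))

  module _ {C B : List (Edge n)} where

    reply-in-unit : ∀ {e₀ x my b} → e₀ ∈ freeEdges C B → Crowded (adj C) x my → Φ (adj C) (adj B) x my ≤ b + 2 →
      ∃[ e ] (e ∈ freeEdges C B × Good (adj C) (adj (e ∷ B)) x my b)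
    reply-in-unit {s₀ , t₀} {x} {my} {b} m₀ crowded h = answer (FP.any? (open? x))
      where
      open? : ∀ c z → Dec (deg C z ≡ 0 × adj B c z ≡ false)
      open? c z = (deg C z ≟ 0) ×-dec (adj B c z Data.Bool.≟ false)
      edge : ∀ {c z} → InUnit c x my → deg C z ≡ 0 → adj B c z ≡ false → FreeEdge C B c z
      edge {c} {z} ic dz bcz = free-intro C B (λ { refl → crowded c ic dz }) (adj-symᶠ C {z} {c} (isolated (adj C) {z} dz c)) bcz
      -- No useful block is left, and the default edge is played.
      dead : Dead (adj C) (adj B) x my → ∃[ e ] (e ∈ freeEdges C B × Good (adj C) (adj (e ∷ B)) x my b)
      dead d = (s₀ , t₀) , m₀ , Good-block {A = adj C} {B = adj B} (cons-Ext B s₀ t₀) {x} {my} (inj₂ (d , h))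
      lowered : ∀ {Φ'} → Φ' + 2 ≤ Φ (adj C) (adj B) x my → Φ' ≤ b
      lowered {Φ'} g = +-cancelʳ-≤ 2 Φ' b (≤-trans g h)
      closed-x : ¬ (∃[ z ] (deg C z ≡ 0 × adj B x z ≡ false)) → ∀ z → deg C z ≡ 0 → adj B x z ≡ true
      closed-x none z dz with bool (adj B x z)
      ... | inj₁ p = p
      ... | inj₂ p = ⊥-elim (none (z , dz , p))
      answer : Dec (∃[ z ] (deg C z ≡ 0 × adj B x z ≡ false)) → ∃[ e ] (e ∈ freeEdges C B × Good (adj C) (adj (e ∷ B)) x my b)
      answer (yes (z , dz , bxz)) = FreeEdge.e fe , FreeEdge.isfree fe ,
          inj₁ (lowered (block-x {A = adj C} {B = adj B} (FreeEdge.ext fe B) {x} {my} {z} refl refl dz bxz))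
        where fe = edge (first refl) dz bxz
      answer (no none) = by-second my refl
        where
        by-second : ∀ m → my ≡ m → ∃[ e ] (e ∈ freeEdges C B × Good (adj C) (adj (e ∷ B)) x my b)
        by-second nothing refl = dead (λ z dz → closed-x none z dz , (λ ()))
        by-second (just y) refl with FP.any? (open? y)
        ... | yes (z , dz , byz) = FreeEdge.e fe , FreeEdge.isfree fe ,
                inj₁ (lowered (block-y {A = adj C} {B = adj B} (FreeEdge.ext fe B) {x} {y} {z} refl refl dz (closed-x none z dz) byz))
          where fe = edge second dz byz
        ... | no none' = dead (λ z dz → closed-x none z dz , closed-y z dz)
          where
          closed-y : ∀ z → deg C z ≡ 0 → adj B y z ≡ true
          closed-y z dz with bool (adj B y z)
          ... | inj₁ p = p
          ... | inj₂ p = ⊥-elim (none' (z , dz , p))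

    module Reply {v : Fin n} (inv : ToReply C B v) where

      open ToReply inv

      private
        S = separated C B

        unique : ∀ {z x y} → bigIn C x ≡ true → bigIn C y ≡ true → adj C x z ≡ true → adj C y z ≡ true → x ≡ y
        unique = Static.big-neighbour-unique (graph C loopless) free 3≤K

        S-mono : ∀ e → S ≤ separated C (e ∷ B)
        S-mono (s , t) = sum-mono (λ x → sum-mono (λ y → 𝟙-mono (pairs x y)))
          where
          pairs : ∀ x y → bigIn C x ∧ (bigIn C y ∧ adj B x y) ≡ true → bigIn C x ∧ (bigIn C y ∧ adj ((s , t) ∷ B) x y) ≡ true
          pairs x y h with ∧-true {bigIn C x} h
          ... | bx , h' with ∧-true {bigIn C y} h'
          ...   | by , bxy = cong₂ _∧_ bx (cong₂ _∧_ by (Ext.old (cons-Ext B s t) {x} {y} bxy))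

        keep : ∀ {x my} b e → Good (adj C) (adj B) x my (b + 2 * S) → Good (adj C) (adj (e ∷ B)) x my (b + 2 * separated C (e ∷ B))
        keep {x} {my} b (s , t) g = Good-weaken {A = adj C} {B = adj ((s , t) ∷ B)} {x} {my} (+-monoʳ-≤ b (*-monoʳ-≤ 2 (S-mono (s , t))))
          (Good-block {A = adj C} {B = adj B} (cons-Ext B s t) {x} {my} g)

        raise : ∀ {x my} b e → Good (adj C) (adj (e ∷ B)) x my (b + 2 * S) → Good (adj C) (adj (e ∷ B)) x my (b + 2 * separated C (e ∷ B))
        raise {x} {my} b e = Good-weaken {A = adj C} {B = adj (e ∷ B)} {x} {my} (+-monoʳ-≤ b (*-monoʳ-≤ 2 (S-mono e)))

        Result : Set
        Result = ∃[ e ] (e ∈ freeEdges C B × ToMove C (e ∷ B))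

      -- The clock advances and lifts every bound by at least 2, which covers the excess of
      -- Constructor's last leaf. No local answer is owed.
      separate : ∀ {x y} → bigIn C x ≡ true → bigIn C y ≡ true → x ≢ y → adj C x y ≡ false → adj B x y ≡ false → Result
      separate {x} {y} bx by x≢y xy bxy = e , FreeEdge.isfree fe , record
        { loopless = λ {u} {w} → loopless {u} {w} ; free = free ; apart = apart' ; single = λ u bu lone → upgrade b₁ (single u bu lone) ; double = double' }
        where
        fe = free-intro C B x≢y xy bxy
        e = FreeEdge.e fe
        X : Ext (adj B) (adj (e ∷ B)) x y
        X = FreeEdge.ext fe B
        S' = separated C (e ∷ B)
        mono : ∀ u w → bigIn C u ∧ (bigIn C w ∧ adj B u w) ≡ true → bigIn C u ∧ (bigIn C w ∧ adj (e ∷ B) u w) ≡ true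
        mono u w h with ∧-true {bigIn C u} h
        ... | bu , h' with ∧-true {bigIn C w} h'
        ...   | bw , buw = cong₂ _∧_ bu (cong₂ _∧_ bw (Ext.old X {u} {w} buw))
        S+1≤S' : S + 1 ≤ S'
        S+1≤S' = sum-mono-gain x 1 (λ u → sum-mono (λ w → 𝟙-mono (mono u w)))
          (sum-mono-gain y 1 (λ w → 𝟙-mono (mono x w)) (≤-reflexive (trans (cong (λ t → 𝟙 t + 1) unowned) (cong 𝟙 (sym owned)))))
          where
          unowned : bigIn C x ∧ (bigIn C y ∧ adj B x y) ≡ false
          unowned = cong₂ _∧_ bx (cong₂ _∧_ by bxy)
          owned : bigIn C x ∧ (bigIn C y ∧ adj (e ∷ B) x y) ≡ true
          owned = cong₂ _∧_ bx (cong₂ _∧_ by (Ext.new X))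
        two-more : ∀ b → b + 2 * S + 2 ≤ b + 2 * S'
        two-more b = ≤-trans (≤-reflexive (arith b S)) (+-monoʳ-≤ b (*-monoʳ-≤ 2 S+1≤S'))
          where
          arith : ∀ b s → b + 2 * s + 2 ≡ b + 2 * (s + 1)
          arith = solve-∀
        one-more : 2 + K + S ≤ 1 + K + S'
        one-more = cert _ _ 0 S+1≤S' (arith K S S')
          where
          arith : ∀ K s s' → 2 + K + s + s' + 0 ≡ 1 + K + s' + (s + 1)
          arith = solve-∀
        upgrade : ∀ {u my} b → Ok C B v u my (b + 2 * S) → Good (adj C) (adj (e ∷ B)) u my (b + 2 * S')
        upgrade {u} {my} b ok = inj₁ (≤-trans (block-≤ {A = adj C} {B = adj B} X u my) (≤-trans (Ok-≤ {C} {B} {v} {u} {my} ok) (two-more b)))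
        double' : ∀ u w → adj C u w ≡ true → bigIn C u ≡ true → bigIn C w ≡ true →
          Good (adj C) (adj (e ∷ B)) u (just w) (b₂ + 2 * S') ⊎ Good (adj C) (adj (e ∷ B)) w (just u) (b₂ + 2 * S')
        double' u w uw bu bw with double u w uw bu bw
        ... | inj₁ ok = inj₁ (upgrade b₂ ok)
        ... | inj₂ ok = inj₂ (upgrade b₂ ok)
        apart' : ∀ u w → bigIn C u ≡ true → bigIn C w ≡ true → u ≢ w → adj C u w ≡ false → adj (e ∷ B) u w ≡ false →
          deg C u ≤ 1 + K + S' ⊎ deg C w ≤ 1 + K + S'
        apart' u w bu bw u≢w uw buw with apart u w bu bw u≢w uw (¬true⇒false (λ p → true≢false (Ext.old X {u} {w} p) buw))
        ... | inj₁ d = inj₁ (≤-trans d one-more)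
        ... | inj₂ d = inj₂ (≤-trans d one-more)

      module _ (all-separated : ∀ x y → bigIn C x ≡ true → bigIn C y ≡ true → x ≢ y → adj C x y ≡ false → adj B x y ≡ false → ⊥) where

        -- Only the unit of `v` depends on the reply; the other bounds survive any block.
        assemble : ∀ {e} → e ∈ freeEdges C B →
          (∀ x → bigIn C x ≡ true → (∀ y → adj C x y ≡ true → bigIn C y ≡ false) → InUnit v x nothing →
            Good (adj C) (adj (e ∷ B)) x nothing (b₁ + 2 * S)) →
          (∀ x y → adj C x y ≡ true → bigIn C x ≡ true → bigIn C y ≡ true → InUnit v x (just y) →
            Good (adj C) (adj (e ∷ B)) x (just y) (b₂ + 2 * S) ⊎ Good (adj C) (adj (e ∷ B)) y (just x) (b₂ + 2 * S)) →
          Result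
        assemble {e} m one two = e , m , record
          { loopless = λ {u} {w} → loopless {u} {w} ; free = free
          ; apart = λ x y bx by x≢y xy bxy → ⊥-elim (all-separated x y bx by x≢y xy (¬true⇒false (λ p → true≢false (trans (cong (sameEdge (x , y) e ∨_) p) (∨-zeroʳ _)) bxy)))
          ; single = single' ; double = double' }
          where
          S' = separated C (e ∷ B)
          single' : ∀ x → bigIn C x ≡ true → (∀ y → adj C x y ≡ true → bigIn C y ≡ false) → Good (adj C) (adj (e ∷ B)) x nothing (b₁ + 2 * S')
          single' x bx lone with single x bx lone
          ... | inj₁ g       = keep {x} {nothing} b₁ e g
          ... | inj₂ (i , _) = raise {x} {nothing} b₁ e (one x bx lone i)
          raise₂ : ∀ {x y} → Good (adj C) (adj (e ∷ B)) x (just y) (b₂ + 2 * S) ⊎ Good (adj C) (adj (e ∷ B)) y (just x) (b₂ + 2 * S) →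
            Good (adj C) (adj (e ∷ B)) x (just y) (b₂ + 2 * S') ⊎ Good (adj C) (adj (e ∷ B)) y (just x) (b₂ + 2 * S')
          raise₂ {x} {y} (inj₁ g) = inj₁ (raise {x} {just y} b₂ e g)
          raise₂ {x} {y} (inj₂ g) = inj₂ (raise {y} {just x} b₂ e g)
          double' : ∀ x y → adj C x y ≡ true → bigIn C x ≡ true → bigIn C y ≡ true →
            Good (adj C) (adj (e ∷ B)) x (just y) (b₂ + 2 * S') ⊎ Good (adj C) (adj (e ∷ B)) y (just x) (b₂ + 2 * S')
          double' x y xy bx by with double x y xy bx by
          ... | inj₁ (inj₁ g)       = inj₁ (keep {x} {just y} b₂ e g)
          ... | inj₂ (inj₁ g)       = inj₂ (keep {y} {just x} b₂ e g)
          ... | inj₁ (inj₂ (i , _)) = raise₂ {x} {y} (two x y xy bx by i)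
          ... | inj₂ (inj₂ (i , _)) = raise₂ {x} {y} (swap (two y x (adj-sym C {x} {y} xy) by bx i))

        answer-leaf : ∀ {e₀} → e₀ ∈ freeEdges C B → Result
        answer-leaf {e₀} m₀ with bool (bigIn C v)
        -- No watched unit has `v` as a centre, so any free edge will do.
        ... | inj₂ ¬bv = assemble m₀ (λ { x bx _ (first refl) → ⊥-elim (true≢false bx ¬bv) })
                (λ { x y _ bx by (first refl) → ⊥-elim (true≢false bx ¬bv) ; x y _ bx by second → ⊥-elim (true≢false by ¬bv) })
        ... | inj₁ bv with FP.any? (λ y → (adj C v y Data.Bool.≟ true) ×-dec (bigIn C y Data.Bool.≟ true))
        ...   | no ¬p = lone-reply (reply-in-unit {my = nothing} m₀ (crowded₁ {C} {v} bv) (Ok-≤ {C} {B} {v} {v} {nothing} (single v bv lone)))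
          where
          lone : ∀ y → adj C v y ≡ true → bigIn C y ≡ false
          lone y vy = ¬true⇒false (λ by → ¬p (y , vy , by))
          lone-reply : ∃[ e ] (e ∈ freeEdges C B × Good (adj C) (adj (e ∷ B)) v nothing (b₁ + 2 * S)) → Result
          lone-reply (e , m , g) = assemble m (λ { x _ _ (first refl) → g })
            (λ { x y xy bx by (first refl) → ⊥-elim (true≢false by (lone y xy))
               ; x y xy bx by second → ⊥-elim (true≢false bx (lone x (adj-sym C {x} {y} xy))) })
        ...   | yes (y , vy , by) = choose (double v y vy bv by)
          where
          only : ∀ {z} → adj C v z ≡ true → bigIn C z ≡ true → z ≡ y
          only {z} vz bz = unique {v} {z} {y} bz by (adj-sym C {v} {z} vz) (adj-sym C {v} {y} vy)
          conclude : ∀ {e} → e ∈ freeEdges C B →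
            Good (adj C) (adj (e ∷ B)) v (just y) (b₂ + 2 * S) ⊎ Good (adj C) (adj (e ∷ B)) y (just v) (b₂ + 2 * S) → Result
          conclude {e} m g = assemble m (λ { x _ lone (first refl) → ⊥-elim (true≢false by (lone y vy)) }) two
            where
            two : ∀ x z → adj C x z ≡ true → bigIn C x ≡ true → bigIn C z ≡ true → InUnit v x (just z) →
              Good (adj C) (adj (e ∷ B)) x (just z) (b₂ + 2 * S) ⊎ Good (adj C) (adj (e ∷ B)) z (just x) (b₂ + 2 * S)
            two x z xz bx bz (first refl) with only {z} xz bz
            ... | refl = g
            two x z xz bx bz second with only {x} (adj-sym C {x} {z} xz) bx
            ... | refl = swap g
          choose : Ok C B v v (just y) (b₂ + 2 * S) ⊎ Ok C B v y (just v) (b₂ + 2 * S) → Result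
          choose (inj₁ ok) with reply-in-unit {my = just y} m₀ (crowded₂ {C} {v} {y} bv by) (Ok-≤ {C} {B} {v} {v} {just y} ok)
          ... | e , m , g = conclude m (inj₁ g)
          choose (inj₂ ok) with reply-in-unit {my = just v} m₀ (crowded₂ {C} {y} {v} by bv) (Ok-≤ {C} {B} {v} {y} {just v} ok)
          ... | e , m , g = conclude m (inj₂ g)

      reply : ∀ {e₀} → e₀ ∈ freeEdges C B → Result
      reply m₀ with FP.any? (λ x → FP.any? (λ y → (bigIn C x Data.Bool.≟ true) ×-dec ((bigIn C y Data.Bool.≟ true) ×-dec
                      ((¬? (x F.≟ y)) ×-dec ((adj C x y Data.Bool.≟ false) ×-dec (adj B x y Data.Bool.≟ false))))))
      ... | yes (x , y , bx , by , x≢y , xy , bxy) = separate {x} {y} bx by x≢y xy bxy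
      ... | no none = answer-leaf (λ x y bx by x≢y xy bxy → none (x , y , bx , by , x≢y , xy , bxy)) m₀

  -- The score against Blocker's strategy.

  private
    -- An effective number of vertices: 4ν exceeds every value b₂ + 2 · `separated` + 2 that a
    -- potential may reach. The constant 29 = 27 + 1 + 1 also appears in the linear part n(29 + 2K)
    -- of the path count, so one threshold serves both.
    ν : ℕ
    ν = n + (3 * K + (29 + 2 * (R * R)))

  scoreBound : ℕ
  scoreBound = 23 * (n * 27 + n * suc K + n * suc K) + 8 * (ν * ν)

  module _ {C B : List (Edge n)} (l : Loopless C) (free : P₅-free (graph C l)) where

    open Graph (graph C l) using (dbl; leaves; isLeaf)
    open Static (graph C l) free

    -- A leaf has only one centre, and the isolated vertices are dropped from the potential.
    leaves-≤-Φ : ∀ x y → dbl K x y ≡ true → 6 * leaves x + 4 * leaves y ≤ Φ (adj C) (adj B) x (just y)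
    leaves-≤-Φ x y d = begin
      6 * leaves x + 4 * leaves y
        ≡⟨ cong₂ _+_ (*-distribˡ-sum 6 (λ z → 𝟙 (isLeaf x z))) (*-distribˡ-sum 4 (λ z → 𝟙 (isLeaf y z))) ⟩
      sum (λ z → 6 * 𝟙 (isLeaf x z)) + sum (λ z → 4 * 𝟙 (isLeaf y z))
        ≡⟨ sym (∑-distrib-+ {n} (λ z → 6 * 𝟙 (isLeaf x z)) (λ z → 4 * 𝟙 (isLeaf y z))) ⟩
      sum (λ z → 6 * 𝟙 (isLeaf x z) + 4 * 𝟙 (isLeaf y z))
        ≤⟨ sum-mono (λ z → point (deg C z) (adj C x z) (adj C y z) (adj B x z) (adj B y z) (exclusive z)) ⟩
      Φ (adj C) (adj B) x (just y) ∎
      where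
      open ≤-Reasoning
      exclusive : ∀ z → adj C x z ≡ true → adj C y z ≡ true → ⊥
      exclusive z xz yz with dbl-parts 3≤K {x} {y} d
      ... | xy , bx , by = l {x} {y} xy (big-neighbour-unique 3≤K {z} {x} {y} bx by xz yz)
      point : ∀ d a b c e → (a ≡ true → b ≡ true → ⊥) → 6 * 𝟙 (a ∧ (d ≡ᵇ 1)) + 4 * 𝟙 (b ∧ (d ≡ᵇ 1)) ≤ weight d a b c e
      point 1 true  true  c e ex = ⊥-elim (ex refl refl)
      point 1 true  false c e ex = ≤-refl
      point 1 false true  c e ex = ≤-refl
      point 1 false false c e ex = z≤n
      point 0 true  true  c e ex = z≤n
      point 0 true  false c e ex = z≤n
      point 0 false true  c e ex = z≤n
      point 0 false false c e ex = z≤n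
      point (suc (suc d)) true  true  c e ex = z≤n
      point (suc (suc d)) true  false c e ex = z≤n
      point (suc (suc d)) false true  c e ex = z≤n
      point (suc (suc d)) false false c e ex = z≤n

    -- The factor 46 is 2 · 23, since every path is counted in both directions.
    score-≤ : (∀ x y → adj C x y ≡ true → bigIn C x ≡ true → bigIn C y ≡ true →
        Φ (adj C) (adj B) x (just y) ≤ b₂ + 2 * separated C B + 2 ⊎ Φ (adj C) (adj B) y (just x) ≤ b₂ + 2 * separated C B + 2) →
      46 * pathCopies 4 C ≤ scoreBound
    score-≤ h = begin
      46 * pathCopies 4 C
        ≡⟨ *-assoc 23 2 (pathCopies 4 C) ⟩
      23 * (2 * pathCopies 4 C)
        ≡⟨ cong (23 *_) (twice-copies C l) ⟩
      23 * sum₄ (λ a x y b → 𝟙 (path₄ C a x y b))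
        ≤⟨ *-monoʳ-≤ 23 (P₄-count 3≤K (path₄ C) (λ {a} {x} {y} {b} → shape {a} {x} {y} {b})) ⟩
      23 * (n * 27 + n * suc K + n * suc K + doubleStars 3≤K)
        ≡⟨ *-distribˡ-+ 23 (n * 27 + n * suc K + n * suc K) (doubleStars 3≤K) ⟩
      23 * (n * 27 + n * suc K + n * suc K) + 23 * doubleStars 3≤K
        ≤⟨ +-monoʳ-≤ (23 * (n * 27 + n * suc K + n * suc K)) (DoubleStars.double-stars-bound (graph C l) free 3≤K (m≤m+n n _) pairs) ⟩
      scoreBound ∎
      where
      open ≤-Reasoning
      shape : P₄-shape 3≤K (path₄ C)
      shape {a} {x} {y} {b} p with path₄-parts C {a} {x} {y} {b} p
      ... | ax , xy , yb , a≢y , _ , x≢b = adj-sym C {a} {x} ax , xy , yb , a≢y , x≢b ∘ sym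
      enough : b₂ + 2 * separated C B + 2 ≤ 4 * ν
      enough = cert _ _ (2 * K + 2 * (R * R) + 96) (times 2 (separated-≤ {C} {B} l free)) (arith n K (R * R) (separated C B))
        where
        arith : ∀ n K r s → 4 * n + 6 * suc K + (4 * (2 + K) + 4 * r + 4) + 2 * s + 2 + 2 * r + (2 * K + 2 * r + 96)
          ≡ 4 * (n + (3 * K + (29 + 2 * r))) + 2 * s
        arith = solve-∀
      pairs : ∀ x y → dbl K x y ≡ true → 6 * leaves x + 4 * leaves y ≤ 4 * ν ⊎ 6 * leaves y + 4 * leaves x ≤ 4 * ν
      pairs x y d with dbl-parts 3≤K {x} {y} d
      ... | xy , bx , by with h x y xy bx by
      ...   | inj₁ p = inj₁ (≤-trans (leaves-≤-Φ x y d) (≤-trans p enough))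
      ...   | inj₂ p = inj₂ (≤-trans (leaves-≤-Φ y x (dbl-sym 3≤K {x} {y} d)) (≤-trans p enough))

  -- Constructor may run out of legal edges at any time, so the score is bounded in every position
  -- and not only at the end.
  value-≤ : ∀ {V} → (∀ {p} → 46 * p ≤ scoreBound → p ≤ V) → gPath n 4 5 ≤ V
  value-≤ {V} fits = turnC (length (allEdges n)) [] [] start
    where
    score-C : ∀ {C B} → ToMove C B → pathCopies 4 C ≤ V
    score-C {C} {B} inv = fits (score-≤ {C} {B} (ToMove.loopless inv) (ToMove.free inv) bound)
      where
      bound : ∀ x y → adj C x y ≡ true → bigIn C x ≡ true → bigIn C y ≡ true →
        Φ (adj C) (adj B) x (just y) ≤ b₂ + 2 * separated C B + 2 ⊎ Φ (adj C) (adj B) y (just x) ≤ b₂ + 2 * separated C B + 2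
      bound x y xy bx by with ToMove.double inv x y xy bx by
      ... | inj₁ g = inj₁ (Good-≤ {A = adj C} {B = adj B} {x} {just y} g)
      ... | inj₂ g = inj₂ (Good-≤ {A = adj C} {B = adj B} {y} {just x} g)
    score-B : ∀ {C B v} → ToReply C B v → pathCopies 4 C ≤ V
    score-B {C} {B} {v} inv = fits (score-≤ {C} {B} (ToReply.loopless inv) (ToReply.free inv) bound)
      where
      bound : ∀ x y → adj C x y ≡ true → bigIn C x ≡ true → bigIn C y ≡ true →
        Φ (adj C) (adj B) x (just y) ≤ b₂ + 2 * separated C B + 2 ⊎ Φ (adj C) (adj B) y (just x) ≤ b₂ + 2 * separated C B + 2
      bound x y xy bx by with ToReply.double inv x y xy bx by
      ... | inj₁ g = inj₁ (Ok-≤ {C} {B} {v} {x} {just y} g)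
      ... | inj₂ g = inj₂ (Ok-≤ {C} {B} {v} {y} {just x} g)
    turnC : ∀ fuel C B → ToMove C B → gameValue 4 5 fuel true C B ≤ V
    turnB : ∀ fuel C B v → ToReply C B v → gameValue 4 5 fuel false C B ≤ V
    turnC zero       C B inv = score-C inv
    turnC (suc fuel) C B inv = Constructor-≤ 4 5 fuel C B (score-C inv)
      (λ {e} m legal → turnB fuel (e ∷ C) B (proj₁ (claim inv m legal)) (proj₂ (claim inv m legal)))
    turnB zero       C B v inv = score-B inv
    turnB (suc fuel) C B v inv = Blocker-≤ 4 5 fuel C B (score-B inv) (λ m → next (Reply.reply inv m))
      where
      next : ∃[ e ] (e ∈ freeEdges C B × ToMove C (e ∷ B)) → ∃[ e ] (e ∈ freeEdges C B × gameValue 4 5 fuel true C (e ∷ B) ≤ V)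
      next (e , m , inv') = e , m , turnC fuel C (e ∷ B) inv'

-- The upper bound in numbers.

-- After multiplication by 20 the errors are at most (23 + 46 + 64 + 128)n² = 261n², out of the
-- 460n² allowed.
score-arith : ∀ {n k K c e} g → 1 ≤ k → 10 * (k * K) ≤ n → 10 * (k * (29 + c)) ≤ n → e ≡ 3 * K + (29 + c) →
  46 * g ≤ 23 * (n * 27 + n * suc K + n * suc K) + 8 * ((n + e) * (n + e)) →
  23 * k * g ≤ 4 * k * (n * n) + 23 * (n * n)
score-arith {n} {k} {K} {c} {e} g 1≤k hK hc refl hg =
  *-cancelˡ-≤ 20 (cert _ _ (199 * (n * n)) (times (10 * k) hg ⊹ times (23 * n) h29 ⊹ times (46 * n) hK ⊹ times (16 * n) he ⊹ times (8 * e) he ⊹ times (32 * n) e≤4n) (arith n k K g e))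
  where
  arith : ∀ n k K g e → 20 * (23 * k * g) + (10 * k * (23 * (n * 27 + n * suc K + n * suc K) + 8 * ((n + e) * (n + e))) + 23 * n * n + 46 * n * n + 16 * n * (4 * n) + 8 * e * (4 * n) + 32 * n * (4 * n)) + 199 * (n * n)
    ≡ 20 * (4 * k * (n * n) + 23 * (n * n)) + (10 * k * (46 * g) + 23 * n * (10 * (k * 29)) + 46 * n * (10 * (k * K)) + 16 * n * (10 * (k * e)) + 8 * e * (10 * (k * e)) + 32 * n * e)
  arith = solve-∀
  h29 : 10 * (k * 29) ≤ n
  h29 = ≤-trans (*-monoʳ-≤ 10 (*-monoʳ-≤ k (m≤m+n 29 c))) hc
  he : 10 * (k * e) ≤ 4 * n
  he = cert _ _ 0 (times 3 hK ⊹ hc) (solve (n ∷ k ∷ K ∷ c ∷ []))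
  e≤4n : e ≤ 4 * n
  e≤4n = ≤-trans (≤-trans (≤-trans (≤-reflexive (sym (*-identityˡ e))) (*-monoˡ-≤ e 1≤k)) (m≤m+n (k * e) _)) he

-- Makes 10k(29 + 2R²) at most `n`, as R ≤ 10k. It also forces `K` to be at least 29.
upper-threshold : ℕ → ℕ
upper-threshold k = 10 * (k * (29 + 2 * (10 * k * (10 * k))))

upper-bound : ∀ k n → 1 ≤ k → upper-threshold k ≤ n → 23 * k * gPath n 4 5 ≤ 4 * k * (n * n) + 23 * (n * n)
upper-bound (suc k') n 1≤k h = score-arith {n} {k} {K} {2 * (R * R)} (gPath n 4 5) 1≤k hK hc refl
  (≤-trans (*-monoʳ-≤ 46 value) (≤-trans (≤-reflexive (*-comm 46 (Z / 46))) (m/n*n≤m Z 46)))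
  where
  k = suc k'
  -- This is 10k - 1. Then big means degree above ⌊n/10k⌋, at most `R` vertices are big, and the
  -- errors linear in `K` are of order n²/k.
  R = 9 + 10 * k'
  K = n / suc R
  R+1 : suc R ≡ 10 * k
  R+1 = sym (*-suc 10 k')
  R≤10k : R ≤ 10 * k
  R≤10k = ≤-trans (n≤1+n R) (≤-reflexive R+1)
  hK : 10 * (k * K) ≤ n
  hK = ≤-trans (≤-reflexive (trans (sym (*-assoc 10 k K)) (trans (cong (_* K) (sym R+1)) (*-comm (suc R) K)))) (m/n*n≤m n (suc R))
  hc : 10 * (k * (29 + 2 * (R * R))) ≤ n
  hc = ≤-trans (*-monoʳ-≤ 10 (*-monoʳ-≤ k (+-monoʳ-≤ 29 (*-monoʳ-≤ 2 (*-mono-≤ R≤10k R≤10k))))) h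
  few : n < suc R * suc K
  few = begin-strict
    n                              ≡⟨ m≡m%n+[m/n]*n n (suc R) ⟩
    n % suc R + K * suc R          <⟨ +-monoˡ-< (K * suc R) (m%n<n n (suc R)) ⟩
    suc R + K * suc R              ≡⟨ *-comm (suc K) (suc R) ⟩
    suc R * suc K                  ∎
    where open ≤-Reasoning
  29≤K : 29 ≤ K
  29≤K = ≤-pred (*-cancelˡ-< (suc R) 29 (suc K) (≤-<-trans bound few))
    where
    bound : suc R * 29 ≤ n
    bound = ≤-trans (*-monoʳ-≤ (suc R) (m≤m+n 29 (2 * (R * R)))) (≤-trans (≤-reflexive (trans (cong (_* (29 + 2 * (R * R))) R+1) (*-assoc 10 k _))) hc)
  3≤K : 3 ≤ K
  3≤K = ≤-trans (m≤m+n 3 26) 29≤K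
  Z = Blocker.scoreBound {n} {K} {R} 3≤K few
  value : gPath n 4 5 ≤ Z / 46
  value = Blocker.value-≤ {n} {K} {R} 3≤K few (λ {p} le → ≤-trans (≤-reflexive (trans (sym (m*n/n≡m p 46)) (cong (_/ 46) (*-comm p 46)))) (/-monoˡ-≤ 46 le))

-- The error term is n²/k, with `k` arbitrary and `n` large in terms of `k`; this expresses o(n²),
-- and the denominators are cleared to stay within ℕ.
theorem1p4 : (k : ℕ) → k > 0 → ∃[ N ] ((n : ℕ) → N ≤ n →
    (8 * k * (n * n) ≤ 49 * k * gPath n 4 5 + 49 * (n * n))
    × (23 * k * gPath n 4 5 ≤ 4 * k * (n * n) + 23 * (n * n)))
theorem1p4 k k>0 = 7 + 3 * k + upper-threshold k , λ n N≤n →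
    lower-bound k n (≤-trans (≤-trans (m≤m+n 7 (3 * k)) (m≤m+n _ _)) N≤n) (≤-trans (≤-trans (m≤n+m (3 * k) 7) (m≤m+n _ _)) N≤n)
  , upper-bound k n k>0 (≤-trans (m≤n+m (upper-threshold k) (7 + 3 * k)) N≤n)
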